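{- Let $P\subseteq\mathbb{R}^2$ be a half-integral polygon with $0\in\mathrm{int}(P)$. Then the following are equivalent: (1) $P^\ast$ is an LDP polygon; (2) every edge of $P$ has lattice distance $1$ from $0$; (3) $|kP\cap\mathbb{Z}^2|=|\mathrm{int}((k+1)P)\cap\mathbb{Z}^2|$ for all $k\ge0$, and the affine hull of every edge of $P$ contains lattice points; (4) the Ehrhart quasi-polynomial of $P$ is $L_P(t)=\mathrm{Area}(P)t^2+\mathrm{Area}(P)t+1$; (5) $\mathrm{int}(P)\cap\mathbb{Z}^2=\{(0,0)\}$ and $P$ is pseudo-integral.
   Context: A rational polygon is the convex hull of finitely many points of $\mathbb{Q}^2$ with nonempty interior; it is half-integral if the smallest positive integer $d$ with $dP$ having all vertices in $\mathbb{Z}^2$ is $2$. Its Ehrhart quasi-polynomial $L_P$ satisfies $L_P(k)=|kP\cap\mathbb{Z}^2|$ for positive integers $k$; $P$ is pseudo-integral if $L_P$ is a polynomial. The dual is $P^\ast=\{y\in\mathbb{R}^2\mid\langle y,x\rangle\ge-1\ \forall x\in P\}$. An LDP polygon is a lattice polygon $Q$ with $0\in\mathrm{int}(Q)$ whose vertices all have relatively prime coordinates. For a line $H=\{x\mid\langle x,n\rangle=c\}$ with $n\in\mathbb{Z}^2$ primitive, the lattice distance of a point $l$ to $H$ is $|\langle l,n\rangle-c|$; the lattice distance to an edge is that to its affine hull. -}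

module Defs where

open import Data.Nat as ℕ using (ℕ; suc)
open import Data.Nat.GCD as NG using ()
open import Data.Integer as ℤ using (ℤ; +_)
open import Data.Rational using (ℚ; 0ℚ; 1ℚ; _+_; _*_; _-_; -_; ∣_∣; _≤_; _<_; _/_)
open import Data.Product using (Σ; _×_; _,_; proj₁; proj₂)
open import Data.List using (List; []; _∷_; length; map; zip; _++_; [_])
open import Data.List.Membership.Propositional using (_∈_)
open import Data.List.Relation.Unary.All using (All)
open import Data.List.Relation.Unary.Unique.Propositional using (Unique)
open import Relation.Binary.PropositionalEquality using (_≡_; _≢_)
open import Relation.Nullary using (¬_)
open import Function using (_⇔_)

ℚ² : Set
ℚ² = ℚ × ℚ

ℤ² : Set
ℤ² = ℤ × ℤ

origin : ℚ²
origin = (0ℚ , 0ℚ)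

ℕ→ℚ : ℕ → ℚ
ℕ→ℚ n = (+ n) / 1

emb : ℤ² → ℚ²
emb (a , b) = ((a / 1) , (b / 1))

_⊕_ : ℚ² → ℚ² → ℚ²
(a , b) ⊕ (c , d) = ((a + c) , (b + d))

_⊙_ : ℚ → ℚ² → ℚ²
t ⊙ (a , b) = ((t * a) , (t * b))

⟨_,_⟩ : ℚ² → ℚ² → ℚ
⟨ (a , b) , (c , d) ⟩ = (a * c) + (b * d)

det : ℚ² → ℚ² → ℚ
det (a , b) (c , d) = (a * d) - (b * c)

-- A subset of ℚ² (the rational points of a subset of ℝ²)
Region : Set₁
Region = ℚ² → Set

sumℚ : List ℚ → ℚ
sumℚ [] = 0ℚ
sumℚ (x ∷ xs) = x + sumℚ xs

combo : List (ℚ × ℚ²) → ℚ²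
combo [] = origin
combo ((l , v) ∷ ws) = (l ⊙ v) ⊕ combo ws

Conv : List ℚ² → Region
Conv V x = Σ (List (ℚ × ℚ²)) λ ws →
  All (λ p → (0ℚ ≤ proj₁ p) × (proj₂ p ∈ V)) ws ×
  (sumℚ (map proj₁ ws) ≡ 1ℚ) × (combo ws ≡ x)

-- Interior (w.r.t. the Euclidean topology; sup-norm balls with
-- rational radius, tested on rational points).
Int : Region → Region
Int S x = Σ ℚ λ ε → (0ℚ < ε) ×
  (∀ y → ∣ proj₁ y - proj₁ x ∣ < ε → ∣ proj₂ y - proj₂ x ∣ < ε → S y)

-- Dilation kP = { k·y | y ∈ P }, k ∈ ℕ (0P = {0} for nonempty P)
Dil : ℕ → Region → Region
Dil k S x = Σ ℚ² λ y → S y × (x ≡ ℕ→ℚ k ⊙ y)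

Vertex : Region → ℚ² → Set
Vertex S v = S v × (∀ a b t → S a → S b → 0ℚ < t → t < 1ℚ →
  v ≡ (t ⊙ a) ⊕ ((1ℚ - t) ⊙ b) → a ≡ b)

Edge : Region → ℚ² → ℚ² → Set
Edge S v w = Vertex S v × Vertex S w × (v ≢ w) ×
  Σ ℚ² λ n → Σ ℚ λ c → (n ≢ origin) × (⟨ v , n ⟩ ≡ c) × (⟨ w , n ⟩ ≡ c) ×
  (∀ x → S x → c ≤ ⟨ x , n ⟩)

PrimitiveVec : ℤ² → Set
PrimitiveVec (a , b) = NG.gcd (ℤ.∣ a ∣) (ℤ.∣ b ∣) ≡ 1

-- lattice distance of l to the line {x | ⟨x,n⟩ = c}, n primitive in ℤ²
latDist : ℚ² → ℤ² → ℚ → ℚ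
latDist l n c = ∣ ⟨ l , emb n ⟩ - c ∣

LatDistToEdge : ℚ² → ℚ² → ℚ² → ℚ → Set
LatDistToEdge l v w d = Σ ℤ² λ n → Σ ℚ λ c → PrimitiveVec n ×
  (⟨ v , emb n ⟩ ≡ c) × (⟨ w , emb n ⟩ ≡ c) × (latDist l n c ≡ d)

AffHullHasLatticePt : ℚ² → ℚ² → Set
AffHullHasLatticePt v w = Σ ℤ² λ z → Σ ℚ λ t → emb z ≡ v ⊕ (t ⊙ (w ⊕ ((- 1ℚ) ⊙ v)))

HasCard : (ℤ² → Set) → ℕ → Set
HasCard S n = Σ (List ℤ²) λ zs → (length zs ≡ n) × Unique zs × (∀ z → (z ∈ zs) ⇔ S z)

LatticeCount : Region → ℕ → Set
LatticeCount S n = HasCard (λ z → S (emb z)) n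

EhrhartValue : Region → ℕ → ℚ → Set
EhrhartValue P t q = Σ ℕ λ n → LatticeCount (Dil t P) n × (ℕ→ℚ n ≡ q)

evalPoly : List ℚ → ℚ → ℚ
evalPoly [] x = 0ℚ
evalPoly (c ∷ cs) x = c + (x * evalPoly cs x)

PseudoIntegral : Region → Set
PseudoIntegral P = Σ (List ℚ) λ cs → ∀ t → EhrhartValue P (suc t) (evalPoly cs (ℕ→ℚ (suc t)))

-- Half-integral: smallest positive d with all vertices of dP integral is 2
IntegralPt : ℚ² → Set
IntegralPt x = Σ ℤ² λ z → emb z ≡ x

HalfIntegral : Region → Set
HalfIntegral P = (∀ v → Vertex P v → IntegralPt ((ℕ→ℚ 2) ⊙ v)) ×
  ¬ (∀ v → Vertex P v → IntegralPt v)

Dual : Region → Region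
Dual P y = ∀ x → P x → (- 1ℚ) ≤ ⟨ y , x ⟩

LDP : Region → Set
LDP Q = (Σ (List ℤ²) λ W → ∀ x → Q x ⇔ Conv (map emb W) x) ×
  Int Q origin ×
  (∀ v → Vertex Q v → Σ ℤ² λ z → (emb z ≡ v) × PrimitiveVec z)

cyclicPairs : List ℚ² → List (ℚ² × ℚ²)
cyclicPairs [] = []
cyclicPairs (x ∷ xs) = zip (x ∷ xs) (xs ++ [ x ])

shoelace : List ℚ² → ℚ
shoelace W = (+ 1 / 2) * sumℚ (map (λ p → det (proj₁ p) (proj₂ p)) (cyclicPairs W))

-- W lists each vertex of P exactly once, in counter-clockwise cyclic
-- order: P lies (weakly) to the left of each directed boundary segment.
CCWVertexList : Region → List ℚ² → Set
CCWVertexList P W = Unique W × (∀ v → (v ∈ W) ⇔ Vertex P v) ×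
  All (λ p → ∀ x → P x → 0ℚ ≤ det (proj₂ p ⊕ ((- 1ℚ) ⊙ proj₁ p)) (x ⊕ ((- 1ℚ) ⊙ proj₁ p)))
      (cyclicPairs W)

IsArea : Region → ℚ → Set
IsArea P A = Σ (List ℚ²) λ W → CCWVertexList P W × (shoelace W ≡ A)

{-# OPTIONS --safe #-}
module Submission where

-- Everything is read off from the edges [v , w) of P, each of which spans a half-open cone at the origin; every nonzero
-- lattice point lies in exactly one of these cones (and in exactly one of the cones over (v , w]).  In a basis of ℤ² adapted
-- to the edge the lattice points of its cone on the level j are the integers k with a j / H ≤ k < b j / H, where H is
-- twice the lattice distance of the edge from 0 and b − a = L is twice its lattice length.  Adding the counts for both
-- half-open conventions replaces ⌈x⌉ by the odd function ⌈x⌉ + ⌊x⌋, which is 2x at half-integers, so that pairing the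
-- levels j and s H − j gives
--     |2sP ∩ ℤ²| = 1 + ½ Σ s L (s H + 1),
-- and similar formulas hold for |P ∩ ℤ²|, |3P ∩ ℤ²| and for the interiors.  Each of (2)–(5) turns out to be equivalent
-- to H = 2 for all edges: (3), (4) and (5) yield linear relations between the sums Σ L H, Σ L, Σ L ⌊H / 2⌋ and the sum of
-- L over the edges with even H, and these force a sum of nonnegative multiples of L to vanish.
-- In (5) the polynomial is determined by its values at the even integers, where it is known from the formula above.
-- For (1) ⇔ (2), the edge normals with value −1 on the edge are the vertices of the dual; that the dual is their convex
-- hull follows by applying the description by edges to that hull.

open import Defs
open import Algebra.Bundles using (AbelianGroup)
open import Data.Empty using (⊥; ⊥-elim)
open import Data.Integer as ℤ using (ℤ; +_; 0ℤ; 1ℤ)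
open import Data.Integer.DivMod using (_/ℕ_; [n/ℕd]*d≤n; n<s[n/ℕd]*d)
import Data.Integer.Divisibility.Signed as ℤD
import Data.Integer.Properties as ℤP
open import Algebra.Properties.Group (AbelianGroup.group ℤP.+-0-abelianGroup) using (∙-cancelˡ)
import Data.Integer.Solver
open import Data.List using (List; []; _∷_; [_]; _++_; zip; length; filter; map; upTo)
open import Data.List.Membership.Propositional using (_∈_; find; lose)
open import Data.List.Membership.Propositional.Properties
  using (∈-filter⁺; ∈-filter⁻; ∈-++⁺ˡ; ∈-++⁺ʳ; ∈-++⁻; ∈-map⁺; ∈-map⁻; ∈-∃++; ∈-upTo⁺; ∈-upTo⁻)
open import Data.List.Properties using (filter-notAll; length-++; length-map; length-upTo; ∷-injectiveˡ; ∷-injectiveʳ)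
open import Data.List.Relation.Unary.All as All using (All; []; _∷_)
import Data.List.Relation.Unary.All.Properties as AllP
open import Data.List.Relation.Unary.AllPairs as AllPairs using (AllPairs; []; _∷_)
import Data.List.Relation.Unary.AllPairs.Properties as AllPairsP
open import Data.List.Relation.Unary.Any as Any using (Any; here; there; any?)
open import Data.List.Relation.Unary.Unique.Propositional using (Unique)
import Data.List.Relation.Unary.Unique.Propositional.Properties as UniqueP
open import Data.Nat as ℕ using (ℕ; zero; suc)
open import Data.Nat.Coprimality using (1-coprimeTo) renaming (sym to coprime-sym)
import Data.Nat.Divisibility as ℕD
open import Data.Nat.DivMod using (m≡m%n+[m/n]*n; m%n<n; m*n/n≡m; m/n≡1+[m∸n]/n)
import Data.Nat.GCD as ℕG
import Data.Nat.Properties as ℕP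
import Data.Nat.Solver
open import Data.Product using (Σ; _×_; _,_; proj₁; proj₂)
open import Data.Product.Properties using (≡-dec)
open import Data.Rational as ℚ
  using (ℚ; 0ℚ; 1ℚ; _+_; _*_; _-_; -_; ∣_∣; _≤_; _<_; _/_; 1/_; _⊔_; _⊓_; positive; nonNegative; ≢-nonZero)
import Data.Rational.Properties as ℚP
open import Data.Rational.Solver using (module +-*-Solver)
open import Data.Sum using (_⊎_; inj₁; inj₂; [_,_]′)
open import Function using (flip; _∘_; _⇔_; mk⇔; Equivalence)
open import Relation.Binary.Definitions using (tri<; tri≈; tri>; DecidableEquality)
open import Relation.Binary.PropositionalEquality hiding ([_])
open import Relation.Nullary using (¬_; Dec; yes; no)
open import Relation.Nullary.Decidable using (_×-dec_; _⊎-dec_; ¬?)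
open +-*-Solver using (solve; _:+_; _:*_; _:-_; :-_; _:=_; con)
open Equivalence using (to; from)

-- The hypotheses provide only a finite list of generators, so the edges have to be constructed. A
-- generator is dropped when it lies in the hull of the origin and at most two others; the survivors
-- are sorted by angle, with signs of determinants in place of angles and the Plücker relation in
-- place of transitivity. Dropping is justified through half-planes containing the origin, never by
-- rewriting convex combinations; the hull is recovered at the end from its edges. In the cone over
-- an edge the dilate kP is cut off at level ⌊k H / 2⌋, and its interior at the largest integer
-- below k H / 2. Pairing levels gives a closed formula when the cut-off is a multiple of H or one
-- less. The weight of the levels up to ⌊H / 2⌋ depends in general on the position of the edge
-- modulo H. It is therefore kept as an unknown and eliminated: 3P differs from P by a full period,
-- and P differs from its interior only by the lattice points on the edges.

private
  module S = Data.Integer.Solver.+-*-Solver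
  module T = Data.Nat.Solver.+-*-Solver

-- Order arithmetic in ℚ

<⇒≱ : ∀ {a b} → a < b → ¬ b ≤ a
<⇒≱ p q = ℚP.<-irrefl refl (ℚP.<-≤-trans p q)

pos*pos : ∀ {a b} → 0ℚ < a → 0ℚ < b → 0ℚ < a * b
pos*pos {a} {b} p q = ℚP.positive⁻¹ (a * b) {{ℚP.pos*pos⇒pos a {{positive p}} b {{positive q}}}}

nonNeg*nonNeg : ∀ {a b} → 0ℚ ≤ a → 0ℚ ≤ b → 0ℚ ≤ a * b
nonNeg*nonNeg {a} {b} p q =
  ℚP.nonNegative⁻¹ (a * b) {{ℚP.nonNeg*nonNeg⇒nonNeg a {{nonNegative p}} b {{nonNegative q}}}}

nonNeg+nonNeg : ∀ {a b} → 0ℚ ≤ a → 0ℚ ≤ b → 0ℚ ≤ a + b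
nonNeg+nonNeg p q = ℚP.+-mono-≤ p q

pos+nonNeg : ∀ {a b} → 0ℚ < a → 0ℚ ≤ b → 0ℚ < a + b
pos+nonNeg p q = ℚP.+-mono-<-≤ p q

nonNeg+pos : ∀ {a b} → 0ℚ ≤ a → 0ℚ < b → 0ℚ < a + b
nonNeg+pos p q = ℚP.+-mono-≤-< p q

≤⇒0≤ : ∀ {a b} → a ≤ b → 0ℚ ≤ b - a
≤⇒0≤ {a} {b} p = subst (_≤ b - a) (ℚP.+-inverseʳ a) (ℚP.+-monoˡ-≤ (- a) p)

<⇒0< : ∀ {a b} → a < b → 0ℚ < b - a
<⇒0< {a} {b} p = subst (_< b - a) (ℚP.+-inverseʳ a) (ℚP.+-monoˡ-< (- a) p)

private
  a+[b-a] : ∀ a b → a + (b - a) ≡ b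
  a+[b-a] = solve 2 (λ a b → a :+ (b :- a) := b) refl

0≤⇒≤ : ∀ {a b} → 0ℚ ≤ b - a → a ≤ b
0≤⇒≤ {a} {b} p = subst₂ _≤_ (ℚP.+-identityʳ a) (a+[b-a] a b) (ℚP.+-monoʳ-≤ a p)

0<⇒< : ∀ {a b} → 0ℚ < b - a → a < b
0<⇒< {a} {b} p = subst₂ _<_ (ℚP.+-identityʳ a) (a+[b-a] a b) (ℚP.+-monoʳ-< a p)

≤-from : ∀ {a b c} → 0ℚ ≤ c → c ≡ b - a → a ≤ b
≤-from p refl = 0≤⇒≤ p

<-from : ∀ {a b c} → 0ℚ < c → c ≡ b - a → a < b
<-from p refl = 0<⇒< p

pos-cancel : ∀ {a b} → 0ℚ ≤ a → 0ℚ < a * b → 0ℚ < b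
pos-cancel {a} {b} p q = ℚP.*-cancelˡ-<-nonNeg a {{nonNegative p}} (subst (_< a * b) (sym (ℚP.*-zeroʳ a)) q)

nonNeg-cancel : ∀ {a b} → 0ℚ < a → 0ℚ ≤ a * b → 0ℚ ≤ b
nonNeg-cancel {a} {b} p q = ℚP.*-cancelˡ-≤-pos a {{positive p}} (subst (_≤ a * b) (sym (ℚP.*-zeroʳ a)) q)

zero-cancel : ∀ {a b} → 0ℚ < a → a * b ≡ 0ℚ → b ≡ 0ℚ
zero-cancel {a} {b} p q = ℚP.≤-antisym
  (ℚP.*-cancelˡ-≤-pos a {{positive p}} (ℚP.≤-reflexive (trans q (sym (ℚP.*-zeroʳ a)))))
  (nonNeg-cancel p (ℚP.≤-reflexive (sym q)))

0≤⇒pos⊎zero : ∀ {a} → 0ℚ ≤ a → 0ℚ < a ⊎ a ≡ 0ℚ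
0≤⇒pos⊎zero {a} p with ℚP.<-cmp 0ℚ a
... | tri< q _ _ = inj₁ q
... | tri≈ _ q _ = inj₂ (sym q)
... | tri> _ _ q = ⊥-elim (<⇒≱ q p)

-- Orientation forms and half-open cones

record AreaForm (D : ℚ² → ℚ² → ℚ) : Set where
  field
    anti    : ∀ a b → D a b ≡ - D b a
    plücker : ∀ a b c d → D a c * D b d ≡ D a b * D c d + D a d * D b c

  alternating : ∀ a → D a a ≡ 0ℚ
  alternating a = zero-cancel {1ℚ + 1ℚ} (ℚP.positive⁻¹ (1ℚ + 1ℚ))
    (trans (solve 1 (λ x → (con 1ℚ :+ con 1ℚ) :* x := x :+ x) refl (D a a))
           (trans (cong (λ z → D a a + z) (anti a a)) (ℚP.+-inverseʳ (D a a))))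

  swap-both : ∀ a b c d → D a b * D c d ≡ D b a * D d c
  swap-both a b c d = trans (cong₂ _*_ (anti a b) (anti c d))
    (solve 2 (λ p q → (:- p) :* (:- q) := p :* q) refl (D b a) (D d c))

  neg⇒pos : ∀ {a b} → D a b < 0ℚ → 0ℚ < D b a
  neg⇒pos {a} {b} p = subst (0ℚ <_) (sym (anti b a)) (ℚP.neg-antimono-< p)

  pos⇒neg : ∀ {a b} → 0ℚ < D a b → D b a < 0ℚ
  pos⇒neg {a} {b} p = subst (_< 0ℚ) (sym (anti b a)) (ℚP.neg-antimono-< p)

  ≤0⇒nonNeg : ∀ {a b} → D a b ≤ 0ℚ → 0ℚ ≤ D b a
  ≤0⇒nonNeg {a} {b} p = subst (0ℚ ≤_) (sym (anti b a)) (ℚP.neg-antimono-≤ p)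

  zero-swap : ∀ {a b} → D a b ≡ 0ℚ → D b a ≡ 0ℚ
  zero-swap {a} {b} p = trans (anti b a) (cong -_ p)

  pos⇒¬nonNeg : ∀ {a b} → 0ℚ < D a b → ¬ 0ℚ ≤ D b a
  pos⇒¬nonNeg p q = <⇒≱ (pos⇒neg p) q

opaque
  -- Opaque copies of `det` and `⟨_,_⟩`, so that the laws stated below are used in place of
  -- coordinates.
  cross : ℚ² → ℚ² → ℚ
  cross = det

  dot : ℚ² → ℚ² → ℚ
  dot = ⟨_,_⟩

  cross≡det : ∀ a b → cross a b ≡ det a b
  cross≡det _ _ = refl

  dot≡⟨⟩ : ∀ a b → dot a b ≡ ⟨ a , b ⟩
  dot≡⟨⟩ _ _ = refl

  cross-form : AreaForm cross
  cross-form = record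
    { anti = λ { (a₁ , a₂) (b₁ , b₂) →
        solve 4 (λ a₁ a₂ b₁ b₂ → a₁ :* b₂ :- a₂ :* b₁ := :- (b₁ :* a₂ :- b₂ :* a₁)) refl a₁ a₂ b₁ b₂ }
    ; plücker = λ { (a₁ , a₂) (b₁ , b₂) (c₁ , c₂) (d₁ , d₂) →
        solve 8 (λ a₁ a₂ b₁ b₂ c₁ c₂ d₁ d₂ →
          let dt = λ x₁ x₂ y₁ y₂ → x₁ :* y₂ :- x₂ :* y₁ in
          dt a₁ a₂ c₁ c₂ :* dt b₁ b₂ d₁ d₂
            := dt a₁ a₂ b₁ b₂ :* dt c₁ c₂ d₁ d₂ :+ dt a₁ a₂ d₁ d₂ :* dt b₁ b₂ c₁ c₂)
          refl a₁ a₂ b₁ b₂ c₁ c₂ d₁ d₂ } }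

-- Reversal of the orientation. Only antisymmetry and the Plücker relation are assumed of D, so
-- every angular statement also yields its mirror image.
flip-form : ∀ {D} → AreaForm D → AreaForm (flip D)
flip-form {D} F = record
  { anti = λ a b → anti b a
  ; plücker = λ a b c d → trans (plücker c d a b)
      (cong₂ _+_ (trans (swap-both c d a b) (ℚP.*-comm (D d c) (D b a)))
                 (ℚP.*-comm (D c b) (D d a))) }
  where open AreaForm F

-- The clockwise-most point of L in the open half-plane to the left of x.
nearest : ∀ {D} → AreaForm D → ∀ x L → (∀ {p} → p ∈ L → ¬ 0ℚ < D x p) ⊎
  Σ ℚ² λ q → q ∈ L × 0ℚ < D x q × (∀ {p} → p ∈ L → 0ℚ < D x p → 0ℚ ≤ D q p)
nearest F x [] = inj₁ λ ()
nearest {D} F x (p ∷ L) with 0ℚ ℚP.<? D x p | nearest F x L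
... | no ¬p | inj₁ none = inj₁ λ { (here refl) → ¬p ; (there r) → none r }
... | no ¬p | inj₂ (q , q∈ , xq , best) =
  inj₂ (q , there q∈ , xq , λ { (here refl) xp → ⊥-elim (¬p xp) ; (there r) → best r })
... | yes xp | inj₁ none =
  inj₂ (p , here refl , xp ,
    λ { (here refl) _ → ℚP.≤-reflexive (sym (AreaForm.alternating F p)) ; (there r) xr → ⊥-elim (none r xr) })
... | yes xp | inj₂ (q , q∈ , xq , best) with 0ℚ ℚP.≤? D q p
... | yes qp = inj₂ (q , there q∈ , xq , λ { (here refl) _ → qp ; (there r) → best r })
... | no ¬qp = inj₂ (p , here refl , xp ,
  λ { (here refl) _ → ℚP.≤-reflexive (sym (AreaForm.alternating F p))
    -- In the half-plane to the left of x the relation 0 ≤ D is transitive, since D x q * D p z = D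
    -- x p * D q z + D x z * D p q.
    ; (there {x = _} r) xr → nonNeg-cancel xq (subst (0ℚ ≤_) (sym (AreaForm.plücker F x p q _))
        (nonNeg+nonNeg (nonNeg*nonNeg (ℚP.<⇒≤ xp) (best r xr))
                       (nonNeg*nonNeg (ℚP.<⇒≤ xr) (ℚP.<⇒≤ (AreaForm.neg⇒pos F (ℚP.≰⇒> ¬qp)))))) })

-- Only signs of D occur, so the module serves twice: with `cross` for the cones over [v , w), and
-- with the flipped form and reversed edges for (v , w]. By `ed-next` no generator lies strictly
-- inside the cone of an edge.
module Sectors {D} (F : AreaForm D) (W : List ℚ²) (Ed : ℚ² → ℚ² → Set)
  (surroundˡ : ∀ x → x ≢ origin → Σ ℚ² λ p → p ∈ W × 0ℚ < D p x)
  (surroundʳ : ∀ x → x ≢ origin → Σ ℚ² λ p → p ∈ W × 0ℚ < D x p)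
  (ed-pos : ∀ {v w} → Ed v w → 0ℚ < D v w)
  (ed-next : ∀ {v w p} → Ed v w → p ∈ W → 0ℚ < D v p → 0ℚ ≤ D w p)
  (ed-mem : ∀ {v w} → Ed v w → v ∈ W × w ∈ W)
  (ed-from : ∀ {v} → v ∈ W → Σ ℚ² λ w → Ed v w)
  (same-ray : ∀ {v v′ s} → v ∈ W → v′ ∈ W → D v v′ ≡ 0ℚ → 0ℚ < D v s → 0ℚ < D v′ s → v ≡ v′)
  where
  open AreaForm F

  -- If x is on the ray of a generator v, the edge leaving v works. Otherwise v is the last
  -- generator before x, found by `nearest` in the mirror image; the head of its edge lies beyond x,
  -- or it would be a later generator before x.
  sector : ∀ x → x ≢ origin → Σ ℚ² λ v → Σ ℚ² λ w → Ed v w × 0ℚ ≤ D v x × 0ℚ < D x w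
  sector x x≢0 with surroundʳ x x≢0
  -- Since 0 < D x s, the condition 0 < D v s rules out the ray opposite to x.
  ... | s , s∈ , xs with any? (λ v → (D v x ℚP.≟ 0ℚ) ×-dec (0ℚ ℚP.<? D v s)) W
  ... | yes onRay with find onRay
  ... | v , v∈ , vx , vs with ed-from v∈
  ... | w , e = v , w , e , ℚP.≤-reflexive (sym vx) ,
    pos-cancel (ℚP.<⇒≤ vs) (subst (0ℚ <_) (sym (plücker v x s w))
      (nonNeg+pos (ℚP.≤-reflexive (sym (trans (cong (_* D s w) vx) (ℚP.*-zeroˡ (D s w)))))
                  (pos*pos (ed-pos e) xs)))
  sector x x≢0 | s , s∈ , xs | no ¬onRay with nearest (flip-form F) x W
  ... | inj₁ none = let p , p∈ , px = surroundˡ x x≢0 in ⊥-elim (none p∈ px)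
  ... | inj₂ (v , v∈ , vx , best) with ed-from v∈
  ... | w , e with ℚP.<-cmp 0ℚ (D x w)
  ... | tri< xw _ _ = v , w , e , ℚP.<⇒≤ vx , xw
  ... | tri≈ _ xw _ = ⊥-elim (¬onRay (lose (proj₂ (ed-mem e)) (wx , pos-cancel (ℚP.<⇒≤ vx)
          (subst (0ℚ <_) (sym (plücker v w x s))
            (pos+nonNeg (pos*pos (ed-pos e) xs)
              (ℚP.≤-reflexive (sym (trans (cong (D v s *_) wx) (ℚP.*-zeroʳ (D v s))))))))))
    where wx = zero-swap (sym xw)
  ... | tri> _ _ xw = ⊥-elim (pos⇒¬nonNeg (ed-pos e) (best (proj₂ (ed-mem e)) (neg⇒pos xw)))

  private
    -- By Plücker `v′` would also satisfy 0 < D v′ w and so lie strictly inside the cone of (v , w),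
    -- against `ed-next`.
    no-later : ∀ {x v w v′ w′} → Ed v w → Ed v′ w′ → 0ℚ ≤ D v x → 0ℚ < D x w →
      0ℚ ≤ D v′ x → ¬ 0ℚ < D v v′
    no-later {x} {v} {w} {v′} e e′ vx xw v′x vv′ = pos⇒¬nonNeg
      (pos-cancel vx (subst (0ℚ <_) (sym (plücker v v′ x w))
        (pos+nonNeg (pos*pos vv′ xw) (nonNeg*nonNeg (ℚP.<⇒≤ (ed-pos e)) v′x))))
      (ed-next e (proj₁ (ed-mem e′)) vv′)

    -- `v′` would be parallel to the independent vectors v and x, hence to everything, against 0 < D
    -- v′ w′.
    on-ray : ∀ {x v w v′ w′} → Ed v w → Ed v′ w′ → 0ℚ < D x w → 0ℚ < D x w′ → D v v′ ≡ 0ℚ →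
      D v′ x ≡ 0ℚ → ¬ 0ℚ < D v x
    on-ray {x} {v} {w} {v′} {w′} e e′ xw xw′ vv′ v′x vx = ℚP.<-irrefl refl
      (subst (0ℚ <_) (trans (plücker v′ x w′ w) (trans (cong₂ _+_ (cong (_* D w′ w) v′x) (cong (_* D x w′) v′w))
          (trans (cong₂ _+_ (ℚP.*-zeroˡ (D w′ w)) (ℚP.*-zeroˡ (D x w′))) refl)))
        (pos*pos (ed-pos e′) xw))
      where
      v′w : D v′ w ≡ 0ℚ
      v′w = zero-cancel vx (trans (plücker v v′ x w) (trans (cong₂ _+_ (cong (_* D x w) vv′) (cong (D v w *_) v′x))
              (trans (cong₂ _+_ (ℚP.*-zeroˡ (D x w)) (ℚP.*-zeroʳ (D v w))) refl)))

  sector-unique : ∀ {x v w v′ w′} → Ed v w → Ed v′ w′ → 0ℚ ≤ D v x → 0ℚ < D x w →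
    0ℚ ≤ D v′ x → 0ℚ < D x w′ → v ≡ v′
  sector-unique {x} {v} {w} {v′} {w′} e e′ vx xw v′x xw′ with ℚP.<-cmp 0ℚ (D v v′)
  ... | tri< vv′ _ _ = ⊥-elim (no-later e e′ vx xw v′x vv′)
  ... | tri> _ _ vv′ = ⊥-elim (no-later e′ e v′x xw′ vx (neg⇒pos vv′))
  ... | tri≈ _ vv′ _ with 0≤⇒pos⊎zero vx | 0≤⇒pos⊎zero v′x
  ... | inj₁ vx⁺ | inj₁ v′x⁺ = same-ray (proj₁ (ed-mem e)) (proj₁ (ed-mem e′)) (sym vv′) vx⁺ v′x⁺
  ... | inj₁ vx⁺ | inj₂ v′x⁰ = ⊥-elim (on-ray e e′ xw xw′ (sym vv′) v′x⁰ vx⁺)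
  ... | inj₂ vx⁰ | inj₁ v′x⁺ = ⊥-elim (on-ray e′ e xw′ xw (zero-swap (sym vv′)) vx⁰ v′x⁺)
  ... | inj₂ vx⁰ | inj₂ v′x⁰ = same-ray (proj₁ (ed-mem e)) (proj₁ (ed-mem e′)) (sym vv′) (ed-pos e)
    (pos-cancel (ℚP.<⇒≤ xw′) (subst (0ℚ <_) (trans (sym (plücker v′ x w w′)) (ℚP.*-comm (D v′ w) (D x w′)))
      (nonNeg+pos (ℚP.≤-reflexive (sym (trans (cong (_* D w w′) v′x⁰) (ℚP.*-zeroˡ (D w w′)))))
                  (pos*pos (ed-pos e′) xw))))

open AreaForm cross-form

-- Removing redundant points and sorting the rest around the origin

infix 4 _≟²_
_≟²_ : DecidableEquality ℚ²
_≟²_ = ≡-dec ℚP._≟_ ℚP._≟_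

square-nonNeg : ∀ a → 0ℚ ≤ a * a
square-nonNeg a with ℚP.≤-total 0ℚ a
... | inj₁ p = nonNeg*nonNeg p p
... | inj₂ p = subst (0ℚ ≤_) (solve 1 (λ a → (:- a) :* (:- a) := a :* a) refl a) (nonNeg*nonNeg q q)
  where q = ℚP.neg-antimono-≤ p

square-pos : ∀ {a} → a ≢ 0ℚ → 0ℚ < a * a
square-pos {a} a≢0 with 0≤⇒pos⊎zero (square-nonNeg a) | ℚP.<-cmp 0ℚ a
... | inj₁ p | _ = p
... | inj₂ _ | tri< p _ _ = pos*pos p p
... | inj₂ _ | tri≈ _ e _ = ⊥-elim (a≢0 (sym e))
... | inj₂ _ | tri> _ _ p = subst (0ℚ <_) (solve 1 (λ a → (:- a) :* (:- a) := a :* a) refl a) (pos*pos q q)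
  where q = ℚP.neg-antimono-< p

rot neg² : ℚ² → ℚ²
rot (a , b) = (- b , a)
neg² (a , b) = (- a , - b)

opaque
  unfolding cross dot

  norm-pos : ∀ {p} → p ≢ origin → 0ℚ < dot p p
  norm-pos {a , b} p≢0 with a ℚP.≟ 0ℚ | b ℚP.≟ 0ℚ
  ... | no a≢0 | _ = pos+nonNeg (square-pos a≢0) (square-nonNeg b)
  ... | yes _ | no b≢0 = nonNeg+pos (square-nonNeg a) (square-pos b≢0)
  ... | yes refl | yes refl = ⊥-elim (p≢0 refl)

  norm-nonNeg : ∀ p → 0ℚ ≤ dot p p
  norm-nonNeg (a , b) = nonNeg+nonNeg (square-nonNeg a) (square-nonNeg b)

  dot-rot : ∀ x p → dot p (rot x) ≡ cross x p
  dot-rot (a , b) (c , d) = solve 4 (λ a b c d → c :* (:- b) :+ d :* a := a :* d :- b :* c) refl a b c d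

  dot-origin : ∀ n → dot origin n ≡ 0ℚ
  dot-origin (a , b) = cong₂ _+_ (ℚP.*-zeroˡ a) (ℚP.*-zeroˡ b)

  dot-comm : ∀ p q → dot p q ≡ dot q p
  dot-comm (a , b) (c , d) = cong₂ _+_ (ℚP.*-comm a c) (ℚP.*-comm b d)

  cross-neg : ∀ x p → cross x (neg² p) ≡ cross p x
  cross-neg (a , b) (c , d) = solve 4 (λ a b c d → a :* (:- d) :- b :* (:- c) := c :* b :- d :* a) refl a b c d

  -- The Binet-Cauchy identity in the plane.
  dot-cross : ∀ p a n → dot p a * dot p n ≡ dot p p * dot a n + cross p a * cross n p
  dot-cross (p₁ , p₂) (a₁ , a₂) (n₁ , n₂) = solve 6 (λ p₁ p₂ a₁ a₂ n₁ n₂ →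
    let ip = λ x₁ x₂ y₁ y₂ → x₁ :* y₁ :+ x₂ :* y₂ in
    ip p₁ p₂ a₁ a₂ :* ip p₁ p₂ n₁ n₂ :=
    ip p₁ p₂ p₁ p₂ :* ip a₁ a₂ n₁ n₂ :+ (p₁ :* a₂ :- p₂ :* a₁) :* (n₁ :* p₂ :- n₂ :* p₁)) refl p₁ p₂ a₁ a₂ n₁ n₂

  -- Cramer's rule: p expanded in the basis a, b with denominators cleared, and paired with n.
  cramer : ∀ a b p n → cross a b * dot p n ≡ cross p b * dot a n + cross a p * dot b n
  cramer (a₁ , a₂) (b₁ , b₂) (p₁ , p₂) (n₁ , n₂) = solve 8 (λ a₁ a₂ b₁ b₂ p₁ p₂ n₁ n₂ →
    let dt = λ x₁ x₂ y₁ y₂ → x₁ :* y₂ :- x₂ :* y₁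
        ip = λ x₁ x₂ y₁ y₂ → x₁ :* y₁ :+ x₂ :* y₂ in
    dt a₁ a₂ b₁ b₂ :* ip p₁ p₂ n₁ n₂ :=
    dt p₁ p₂ b₁ b₂ :* ip a₁ a₂ n₁ n₂ :+ dt a₁ a₂ p₁ p₂ :* ip b₁ b₂ n₁ n₂) refl a₁ a₂ b₁ b₂ p₁ p₂ n₁ n₂

proportional : ∀ p a n → cross p a ≡ 0ℚ → dot p a * dot p n ≡ dot p p * dot a n
proportional p a n pa = trans (dot-cross p a n)
  (trans (cong (λ t → dot p p * dot a n + t * cross n p) pa)
    (trans (cong (λ z → dot p p * dot a n + z) (ℚP.*-zeroˡ (cross n p))) (ℚP.+-identityʳ _)))

-- p lies on the segment from the origin to a.
Shadowed : ℚ² → ℚ² → Set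
Shadowed p a = cross p a ≡ 0ℚ × 0ℚ < dot p a × dot p p ≤ dot p a

-- p lies in the triangle with corners 0, a, b: its barycentric coordinates, multiplied by
-- `cross a b`, are nonnegative.
InTriangle : ℚ² → ℚ² → ℚ² → Set
InTriangle p a b = 0ℚ < cross a b × 0ℚ ≤ cross a p × 0ℚ ≤ cross p b × cross a p + cross p b ≤ cross a b

-- Decidable membership in the hull of the origin and at most two other points. Excluding the second
-- case separates rays (`same-ray-dot`), excluding the third yields strict convexity (`supporting`).
Redundant : List ℚ² → ℚ² → Set
Redundant V p = p ≡ origin ⊎
  Any (λ a → a ≢ p × Shadowed p a) V ⊎
  Any (λ a → a ≢ p × Any (λ b → b ≢ p × InTriangle p a b) V) V

redundant? : ∀ V p → Dec (Redundant V p)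
redundant? V p = (p ≟² origin) ⊎-dec
  (any? (λ a → ¬? (a ≟² p) ×-dec (cross p a ℚP.≟ 0ℚ) ×-dec (0ℚ ℚP.<? dot p a) ×-dec (dot p p ℚP.≤? dot p a)) V ⊎-dec
   any? (λ a → ¬? (a ≟² p) ×-dec any? (λ b → ¬? (b ≟² p) ×-dec (0ℚ ℚP.<? cross a b) ×-dec
     (0ℚ ℚP.≤? cross a p) ×-dec (0ℚ ℚP.≤? cross p b) ×-dec (cross a p + cross p b ℚP.≤? cross a b)) V) V)

Below : List ℚ² → ℚ² → ℚ → Set
Below V n c = ∀ {v} → v ∈ V → dot v n ≤ c

shadowed-below : ∀ {p a n c} → 0ℚ ≤ c → Shadowed p a → dot a n ≤ c → dot p n ≤ c
shadowed-below {p} {a} {n} {c} 0≤c (pa , pos , le) an≤c = 0≤⇒≤ (nonNeg-cancel pos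
  (subst (0ℚ ≤_)
    (trans (solve 4 (λ x y c z → (x :- y) :* c :+ y :* (c :- z) := x :* c :- y :* z) refl (dot p a) (dot p p) c (dot a n))
      (trans (cong (λ t → dot p a * c - t) (sym (proportional p a n pa)))
        (solve 3 (λ x c z → x :* c :- x :* z := x :* (c :- z)) refl (dot p a) c (dot p n))))
    (nonNeg+nonNeg (nonNeg*nonNeg (≤⇒0≤ le) 0≤c) (nonNeg*nonNeg (norm-nonNeg p) (≤⇒0≤ an≤c)))))

inTriangle-below : ∀ {p a b n c} → 0ℚ ≤ c → InTriangle p a b → dot a n ≤ c → dot b n ≤ c → dot p n ≤ c
inTriangle-below {p} {a} {b} {n} {c} 0≤c (ab , ap , pb , le) an bn = 0≤⇒≤ (nonNeg-cancel ab
  (subst (0ℚ ≤_)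
    (trans (solve 6 (λ D x y c s t → (D :- (x :+ y)) :* c :+ y :* (c :- s) :+ x :* (c :- t) := D :* c :- (y :* s :+ x :* t)) refl
       (cross a b) (cross a p) (cross p b) c (dot a n) (dot b n))
      (trans (cong (λ t → cross a b * c - t) (sym (cramer a b p n)))
        (solve 3 (λ x c z → x :* c :- x :* z := x :* (c :- z)) refl (cross a b) c (dot p n))))
    (nonNeg+nonNeg (nonNeg+nonNeg (nonNeg*nonNeg (≤⇒0≤ le) 0≤c) (nonNeg*nonNeg pb (≤⇒0≤ an)))
                   (nonNeg*nonNeg ap (≤⇒0≤ bn)))))

module _ (V : List ℚ²) (p : ℚ²) (red : Redundant V p) where
  private
    keep? = λ q → ¬? (q ≟² p)

  without : List ℚ²
  without = filter keep? V

  without-below : ∀ {n c} → 0ℚ ≤ c → Below without n c → Below V n c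
  without-below {n} {c} 0≤c below {v} v∈ with v ≟² p
  ... | no v≢p = below (∈-filter⁺ keep? v∈ v≢p)
  ... | yes refl = redundant-below red
    where
    redundant-below : Redundant V p → dot p n ≤ c
    redundant-below (inj₁ refl) = subst (_≤ c) (sym (dot-origin n)) 0≤c
    redundant-below (inj₂ (inj₁ r)) = let a , a∈ , a≢p , sh = find r in
      shadowed-below {p} {a} 0≤c sh (below (∈-filter⁺ keep? a∈ a≢p))
    redundant-below (inj₂ (inj₂ r)) = let a , a∈ , a≢p , r′ = find r ; b , b∈ , b≢p , tr = find r′ in
      inTriangle-below {p} {a} {b} 0≤c tr (below (∈-filter⁺ keep? a∈ a≢p)) (below (∈-filter⁺ keep? b∈ b≢p))

Irreducible : List ℚ² → Set
Irreducible W = ∀ {p} → p ∈ W → ¬ Redundant W p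

-- `below` says that nothing of the hull is lost. It is restricted to half-planes containing the
-- origin, 0 ≤ c, because a removed point is a combination of other points and the origin.
record Reduction (V : List ℚ²) : Set where
  field
    W           : List ℚ²
    W⊆V         : ∀ {v} → v ∈ W → v ∈ V
    below       : ∀ {n c} → 0ℚ ≤ c → Below W n c → Below V n c
    irreducible : Irreducible W

-- The bound k on the length makes the recursion structural: each round deletes at least the
-- redundant point just found.
reduce : ∀ k V → length V ℕ.≤ k → Reduction V
reduce k V len with any? (redundant? V) V
... | no none = record { W = V ; W⊆V = λ v → v ; below = λ _ b → b ; irreducible = λ p∈ r → none (lose p∈ r) }
reduce zero [] len | yes ()
reduce (suc k) V len | yes some with find some
... | p , p∈ , red = record
  { W = R.W
  ; W⊆V = λ v∈ → proj₁ (∈-filter⁻ (λ q → ¬? (q ≟² p)) (R.W⊆V v∈))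
  ; below = λ 0≤c b → without-below V p red 0≤c (R.below 0≤c b)
  ; irreducible = R.irreducible }
  where
  module R = Reduction (reduce k (without V p red)
    (ℕP.≤-pred (ℕP.≤-trans (filter-notAll (λ q → ¬? (q ≟² p)) V (lose p∈ (λ ¬e → ¬e refl))) len)))

-- In `strict`, `cross p w + cross v p` is linear in p and equals `cross v w` on the line through v
-- and w, so every other vertex lies strictly on the origin's side of that line.
record Polygon (W : List ℚ²) : Set where
  field
    unique   : Unique W
    surround : ∀ x → x ≢ origin → Σ ℚ² λ p → p ∈ W × 0ℚ < cross x p
    same-ray : ∀ {v v′ s} → v ∈ W → v′ ∈ W → cross v v′ ≡ 0ℚ → 0ℚ < cross v s → 0ℚ < cross v′ s → v ≡ v′
    same-rayʳ : ∀ {v v′ s} → v ∈ W → v′ ∈ W → cross v v′ ≡ 0ℚ → 0ℚ < cross s v → 0ℚ < cross s v′ → v ≡ v′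
    nonzero  : ∀ {v} → v ∈ W → v ≢ origin
    ed-pos   : ∀ {v w} → (v , w) ∈ cyclicPairs W → 0ℚ < cross v w
    ed-next  : ∀ {v w p} → (v , w) ∈ cyclicPairs W → p ∈ W → 0ℚ < cross v p → 0ℚ ≤ cross w p
    ed-mem   : ∀ {v w} → (v , w) ∈ cyclicPairs W → v ∈ W × w ∈ W
    ed-from  : ∀ {v} → v ∈ W → Σ ℚ² λ w → (v , w) ∈ cyclicPairs W
    ed-to    : ∀ {w} → w ∈ W → Σ ℚ² λ v → (v , w) ∈ cyclicPairs W
    strict   : ∀ {v w p} → (v , w) ∈ cyclicPairs W → p ∈ W → p ≢ v → p ≢ w → cross p w + cross v p < cross v w

-- Angular order, cut at the generic ray through o so that every point lies strictly on one side of it.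
module Angular (o : ℚ²) where
  -- The letters record the side of the axis, u for the left of o and l for the right. The left side
  -- comes first; within one side angles differ by less than a half turn, so `cross` decides.
  data _≺_ (p q : ℚ²) : Set where
    ul : 0ℚ < cross o p → 0ℚ < cross q o → p ≺ q
    uu : 0ℚ < cross o p → 0ℚ < cross o q → 0ℚ < cross p q → p ≺ q
    ll : 0ℚ < cross p o → 0ℚ < cross q o → 0ℚ < cross p q → p ≺ q

  asym : ∀ {p q} → 0ℚ < cross p q → 0ℚ < cross q p → ⊥
  asym pq qp = pos⇒¬nonNeg pq (ℚP.<⇒≤ qp)

  ≺-irrefl : ∀ {p} → ¬ p ≺ p
  ≺-irrefl {p} (ul a b) = asym a b
  ≺-irrefl {p} (uu _ _ c) = ℚP.<-irrefl (sym (alternating p)) c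
  ≺-irrefl {p} (ll _ _ c) = ℚP.<-irrefl (sym (alternating p)) c

  ≺-trans : ∀ {p q r} → p ≺ q → q ≺ r → p ≺ r
  ≺-trans (ul a b) (ul c d) = ⊥-elim (asym b c)
  ≺-trans (ul a b) (uu c d _) = ⊥-elim (asym b c)
  ≺-trans (ul a b) (ll c d _) = ul a d
  ≺-trans (uu a b _) (ul c d) = ul a d
  ≺-trans {p} {q} {r} (uu a b pq) (uu c d qr) = uu a d (pos-cancel (ℚP.<⇒≤ b)
    (subst (0ℚ <_) (sym (plücker o p q r)) (pos+nonNeg (pos*pos a qr) (ℚP.<⇒≤ (pos*pos d pq)))))
  ≺-trans (uu a b _) (ll c d _) = ⊥-elim (asym b c)
  ≺-trans (ll a b _) (ul c d) = ⊥-elim (asym b c)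
  ≺-trans (ll a b _) (uu c d _) = ⊥-elim (asym b c)
  ≺-trans {p} {q} {r} (ll a b pq) (ll c d qr) = ll a d (pos-cancel (ℚP.<⇒≤ b)
    (subst (0ℚ <_) (trans (sym (plücker p q r o)) (ℚP.*-comm (cross p r) (cross q o)))
      (pos+nonNeg (pos*pos pq d) (ℚP.<⇒≤ (pos*pos a qr)))))

  data Cyclic (v w q : ℚ²) : Set where
    vwq : v ≺ w → w ≺ q → Cyclic v w q
    wqv : w ≺ q → q ≺ v → Cyclic v w q
    qvw : q ≺ v → v ≺ w → Cyclic v w q

  -- A turn of less than half a circle from v to q meets w on its way. The cases are the sides of
  -- the axis; when the points lie on both sides, Plücker with o as fourth vector gives the missing
  -- sign.
  between : ∀ {v w q} → Cyclic v w q → 0ℚ < cross v q → 0ℚ < cross v w × 0ℚ < cross w q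
  between (vwq (ul _ b) (ul c _)) vq = ⊥-elim (asym b c)
  between (vwq (ul _ b) (uu c _ _)) vq = ⊥-elim (asym b c)
  between {v} {w} {q} (vwq (ul a b) (ll c d wq)) vq = pos-cancel (ℚP.<⇒≤ d)
    (subst (0ℚ <_) (sym (trans (plücker q v o w) (cong₂ _+_ (swap-both q v o w) (swap-both q w v o))))
      (pos+nonNeg (pos*pos vq b) (ℚP.<⇒≤ (pos*pos wq a)))) , wq
  between {v} {w} {q} (vwq (uu a b vw) (ul c d)) vq = vw , pos-cancel (ℚP.<⇒≤ a)
    (subst (0ℚ <_) (sym (trans (plücker o w v q) (cong (λ z → cross o w * cross v q + z) (swap-both o q w v))))
      (pos+nonNeg (pos*pos b vq) (ℚP.<⇒≤ (pos*pos d vw))))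
  between (vwq (uu _ _ vw) (uu _ _ wq)) vq = vw , wq
  between (vwq (uu _ b _) (ll c _ _)) vq = ⊥-elim (asym b c)
  between (vwq (ll _ b _) (ul c _)) vq = ⊥-elim (asym b c)
  between (vwq (ll _ b _) (uu c _ _)) vq = ⊥-elim (asym b c)
  between (vwq (ll _ _ vw) (ll _ _ wq)) vq = vw , wq
  between {v} {w} {q} (wqv (uu a b wq) (ul c d)) vq = pos-cancel (ℚP.<⇒≤ b)
    (subst (0ℚ <_) (sym (trans (plücker o v q w) (cong (_+ cross o w * cross v q) (swap-both o v q w))))
      (pos+nonNeg (pos*pos d wq) (ℚP.<⇒≤ (pos*pos a vq)))) , wq
  between (wqv (ul a b) (ul c d)) vq = ⊥-elim (asym c b)
  between (wqv (ll a b _) (ul c d)) vq = ⊥-elim (asym b c)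
  between (wqv _ (uu _ _ qv)) vq = ⊥-elim (asym vq qv)
  between (wqv _ (ll _ _ qv)) vq = ⊥-elim (asym vq qv)
  between (qvw (ul a b) (ul c d)) vq = ⊥-elim (asym b c)
  between (qvw (ul a b) (uu c d _)) vq = ⊥-elim (asym b c)
  between {v} {w} {q} (qvw (ul a b) (ll c d vw)) vq = vw , pos-cancel (ℚP.<⇒≤ c)
    (subst (0ℚ <_) (sym (plücker v w o q)) (pos+nonNeg (pos*pos vw a) (ℚP.<⇒≤ (pos*pos vq d))))
  between (qvw (uu _ _ qv) _) vq = ⊥-elim (asym vq qv)
  between (qvw (ll _ _ qv) _) vq = ⊥-elim (asym vq qv)

  module Sorting (_∈W : ℚ² → Set)
    (compare : ∀ {p q} → p ∈W → q ∈W → p ≡ q ⊎ p ≺ q ⊎ q ≺ p) where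

    insert : ∀ p S → p ∈W → (∀ {q} → q ∈ S → q ∈W) → AllPairs _≺_ S → Σ (List ℚ²) λ S′ →
      AllPairs _≺_ S′ × (∀ {x} → x ∈ S′ → x ≡ p ⊎ x ∈ S) × p ∈ S′ × (∀ {x} → x ∈ S → x ∈ S′)
    insert p [] p∈ ⊆W [] = p ∷ [] , [] ∷ [] , (λ { (here e) → inj₁ e }) , here refl , λ ()
    insert p (q ∷ S) p∈ ⊆W (q≺S ∷ sorted) with compare p∈ (⊆W (here refl))
    -- A point already present is dropped, so the result is strictly increasing even if the input
    -- has repetitions.
    ... | inj₁ refl = q ∷ S , q≺S ∷ sorted , inj₂ , here refl , λ x∈ → x∈
    ... | inj₂ (inj₁ p≺q) = p ∷ q ∷ S , (p≺q ∷ All.map (≺-trans p≺q) q≺S) ∷ q≺S ∷ sorted ,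
      (λ { (here e) → inj₁ e ; (there x∈) → inj₂ x∈ }) , here refl , there
    ... | inj₂ (inj₂ q≺p) with insert p S p∈ (⊆W ∘ there) sorted
    ... | S′ , sorted′ , from , p∈S′ , S⊆S′ = q ∷ S′ ,
      All.tabulate (λ x∈ → [ (λ { refl → q≺p }) , All.lookup q≺S ]′ (from x∈)) ∷ sorted′ ,
      (λ { (here e) → inj₂ (here e) ; (there x∈) → [ inj₁ , inj₂ ∘ there ]′ (from x∈) }) ,
      there p∈S′ , λ { (here e) → here e ; (there x∈) → there (S⊆S′ x∈) }

    sort : ∀ L → (∀ {q} → q ∈ L → q ∈W) → Σ (List ℚ²) λ S →
      AllPairs _≺_ S × (∀ {x} → x ∈ S → x ∈ L) × (∀ {x} → x ∈ L → x ∈ S)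
    sort [] _ = [] , [] , (λ x∈ → x∈) , λ x∈ → x∈
    sort (p ∷ L) ⊆W with sort L (⊆W ∘ there)
    ... | S , sorted , S⊆L , L⊆S with insert p S (⊆W (here refl)) (⊆W ∘ there ∘ S⊆L) sorted
    ... | S′ , sorted′ , from , p∈S′ , S⊆S′ = S′ , sorted′ ,
      (λ x∈ → [ here , there ∘ S⊆L ]′ (from x∈)) ,
      λ { (here refl) → p∈S′ ; (there x∈) → S⊆S′ (L⊆S x∈) }

  -- y stands for the head of the full list, which closes the cycle; it has to stay fixed while the
  -- recursion shortens the list.
  steps : ∀ {v w y} x xs → AllPairs _≺_ (x ∷ xs) → (v , w) ∈ zip (x ∷ xs) (xs ++ [ y ]) → v ∈ (x ∷ xs) ×
    ((w ∈ xs × v ≺ w × (∀ {p} → p ∈ (x ∷ xs) → p ≡ v ⊎ p ≡ w ⊎ p ≺ v ⊎ w ≺ p)) ⊎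
     (w ≡ y × (∀ {p} → p ∈ (x ∷ xs) → p ≡ v ⊎ p ≺ v)))
  steps x [] _ (here refl) = here refl , inj₂ (refl , λ { (here e) → inj₁ e })
  steps x (z ∷ zs) ((x≺z ∷ _) ∷ (z≺zs ∷ _)) (here refl) = here refl , inj₁ (here refl , x≺z ,
    λ { (here e) → inj₁ e ; (there (here e)) → inj₂ (inj₁ e)
      ; (there (there p∈)) → inj₂ (inj₂ (inj₂ (All.lookup z≺zs p∈))) })
  steps x (z ∷ zs) (x≺ ∷ sorted) (there e∈) with steps z zs sorted e∈
  ... | v∈ , inj₁ (w∈ , v≺w , gap) = there v∈ , inj₁ (there w∈ , v≺w ,
    λ { (here refl) → inj₂ (inj₂ (inj₁ (All.lookup x≺ v∈))) ; (there p∈) → gap p∈ })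
  ... | v∈ , inj₂ (w≡y , last) = there v∈ , inj₂ (w≡y ,
    λ { (here refl) → inj₂ (All.lookup x≺ v∈) ; (there p∈) → last p∈ })

  cyclic-gap : ∀ {v w} S → AllPairs _≺_ S → (v , w) ∈ cyclicPairs S →
    v ∈ S × w ∈ S × (∀ {p} → p ∈ S → p ≡ v ⊎ p ≡ w ⊎ Cyclic v w p)
  cyclic-gap (x ∷ xs) (x≺ ∷ sorted) e∈ with steps x xs (x≺ ∷ sorted) e∈
  ... | v∈ , inj₁ (w∈ , v≺w , gap) = v∈ , there w∈ , λ p∈ → rearrange v≺w (gap p∈)
    where
    rearrange : ∀ {p v w} → v ≺ w → p ≡ v ⊎ p ≡ w ⊎ p ≺ v ⊎ w ≺ p → p ≡ v ⊎ p ≡ w ⊎ Cyclic v w p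
    rearrange _ (inj₁ e) = inj₁ e
    rearrange _ (inj₂ (inj₁ e)) = inj₂ (inj₁ e)
    rearrange v≺w (inj₂ (inj₂ (inj₁ p≺v))) = inj₂ (inj₂ (qvw p≺v v≺w))
    rearrange v≺w (inj₂ (inj₂ (inj₂ w≺p))) = inj₂ (inj₂ (vwq v≺w w≺p))
  ... | v∈ , inj₂ (refl , last) = v∈ , here refl ,
    λ { (here refl) → inj₂ (inj₁ refl)
      ; (there p∈) → [ inj₁ , (λ p≺v → inj₂ (inj₂ (wqv (All.lookup x≺ p∈) p≺v))) ]′ (last (there p∈)) }

zip-from : ∀ {v : ℚ²} x xs y → v ∈ (x ∷ xs) → Σ ℚ² λ w → (v , w) ∈ zip (x ∷ xs) (xs ++ [ y ])
zip-from x [] y (here refl) = y , here refl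
zip-from x (z ∷ zs) y (here refl) = z , here refl
zip-from x (z ∷ zs) y (there v∈) = let w , e = zip-from z zs y v∈ in w , there e

zip-to : ∀ {w : ℚ²} x xs y → w ∈ xs ++ [ y ] → Σ ℚ² λ v → (v , w) ∈ zip (x ∷ xs) (xs ++ [ y ])
zip-to x [] y (here refl) = x , here refl
zip-to x (z ∷ zs) y (here refl) = x , here refl
zip-to x (z ∷ zs) y (there w∈) = let v , e = zip-to z zs y w∈ in v , there e

-- A slope s larger than all the slopes y / x of the points avoids them. A lower bound for s, rather
-- than a single value, is what the induction can carry.
generic-slope : ∀ W → (∀ {p} → p ∈ W → p ≢ origin) →
  Σ ℚ λ b → ∀ {p} s → b < s → p ∈ W → det (1ℚ , s) p ≢ 0ℚ
generic-slope [] _ = 0ℚ , λ _ _ ()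
generic-slope ((x , y) ∷ W) nonzero with generic-slope W (nonzero ∘ there) | x ℚP.≟ 0ℚ
... | b , avoid | yes refl = b , λ
  { s b<s (here refl) e → nonzero (here refl) (cong (0ℚ ,_)
      (trans (solve 2 (λ s y → y := con 1ℚ :* y :- s :* con 0ℚ) refl s y) e))
  ; s b<s (there p∈) → avoid s b<s p∈ }
... | b , avoid | no x≢0 = b ⊔ c , λ
  { s bc<s (here refl) e → x≢0 (zero-cancel (<⇒0< (ℚP.≤-<-trans (ℚP.p≤q⊔p b c) bc<s))
      (trans (solve 3 (λ s c x → (s :- c) :* x := s :* x :- c :* x) refl s c x)
        (trans (cong (λ t → s * x - t) cx) (trans (solve 3 (λ s x y → s :* x :- y := :- (con 1ℚ :* y :- s :* x)) refl s x y)
          (cong -_ e)))))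
  ; s bc<s (there p∈) → avoid s (ℚP.≤-<-trans (ℚP.p≤p⊔q b c) bc<s) p∈ }
  where
  instance _ = ≢-nonZero x≢0
  c = y * (1/ x)
  cx : c * x ≡ y
  cx = trans (ℚP.*-assoc y (1/ x) x) (trans (cong (y *_) (ℚP.*-inverseˡ x)) (ℚP.*-identityʳ y))

generic-axis : ∀ W → (∀ {p} → p ∈ W → p ≢ origin) → Σ ℚ² λ o → ∀ {p} → p ∈ W → cross o p ≢ 0ℚ
generic-axis W nonzero with generic-slope W nonzero
... | b , avoid = (1ℚ , b + 1ℚ) , λ {p} p∈ e → avoid (b + 1ℚ)
  (subst (_< b + 1ℚ) (ℚP.+-identityʳ b) (ℚP.+-monoʳ-< b (ℚP.positive⁻¹ 1ℚ))) p∈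
  (trans (sym (cross≡det (1ℚ , b + 1ℚ) p)) e)

-- For parallel points (v·v′)² = |v|² |v′|², so |v|² or |v′|² is at most v·v′, and the corresponding
-- point is shadowed by the other.
same-ray-dot : ∀ {W v v′ n} → Irreducible W → v ∈ W → v′ ∈ W → cross v v′ ≡ 0ℚ →
  0ℚ < dot v n → 0ℚ < dot v′ n → v ≡ v′
same-ray-dot {W} {v} {v′} {n} irr v∈ v′∈ vv′ vn v′n with v ≟² v′
... | yes e = e
... | no v≢v′ = ⊥-elim (contradiction (vv ℚP.≤? v·v′) (v′v′ ℚP.≤? v·v′))
  where
  vv = dot v v
  v′v′ = dot v′ v′
  v·v′ = dot v v′
  v·v′-pos : 0ℚ < v·v′
  v·v′-pos = pos-cancel (ℚP.<⇒≤ vn) (subst (0ℚ <_) (trans (sym (proportional v v′ n vv′)) (ℚP.*-comm v·v′ (dot v n)))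
    (pos*pos (norm-pos (λ v≡0 → irr v∈ (inj₁ v≡0))) v′n))
  square : v·v′ * v·v′ ≡ vv * v′v′
  square = proportional v v′ v′ vv′
  contradiction : Dec (vv ≤ v·v′) → Dec (v′v′ ≤ v·v′) → ⊥
  contradiction (yes le) _ = irr v∈ (inj₂ (inj₁ (lose v′∈ ((v≢v′ ∘ sym) , vv′ , v·v′-pos , le))))
  contradiction _ (yes le) = irr v′∈ (inj₂ (inj₁ (lose v∈ (v≢v′ , zero-swap vv′ ,
    subst (0ℚ <_) (dot-comm v v′) v·v′-pos , subst (v′v′ ≤_) (dot-comm v v′) le))))
  contradiction (no lt) (no lt′) = ℚP.<-irrefl square (<-from
    (pos+nonNeg (pos*pos v·v′-pos (<⇒0< (ℚP.≰⇒> lt)))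
                (nonNeg*nonNeg (norm-nonNeg v) (ℚP.<⇒≤ (<⇒0< (ℚP.≰⇒> lt′)))))
    (solve 3 (λ c a b → c :* (a :- c) :+ a :* (b :- c) := a :* b :- c :* c) refl v·v′ vv v′v′))

same-ray-right : ∀ {W v v′ s} → Irreducible W → v ∈ W → v′ ∈ W → cross v v′ ≡ 0ℚ →
  0ℚ < cross s v → 0ℚ < cross s v′ → v ≡ v′
same-ray-right {s = s} irr v∈ v′∈ vv′ sv sv′ = same-ray-dot {n = rot s} irr v∈ v′∈ vv′
  (subst (0ℚ <_) (sym (dot-rot s _)) sv) (subst (0ℚ <_) (sym (dot-rot s _)) sv′)

same-ray-left : ∀ {W v v′ s} → Irreducible W → v ∈ W → v′ ∈ W → cross v v′ ≡ 0ℚ →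
  0ℚ < cross v s → 0ℚ < cross v′ s → v ≡ v′
same-ray-left {v = v} {v′} {s} irr v∈ v′∈ vv′ vs v′s = same-ray-right {s = neg² s} irr v∈ v′∈ vv′
  (neg-side v vs) (neg-side v′ v′s)
  where
  neg-side : ∀ v → 0ℚ < cross v s → 0ℚ < cross (neg² s) v
  neg-side v vs = neg⇒pos (subst (_< 0ℚ) (sym (cross-neg v s)) (pos⇒neg vs))

-- Otherwise p is on or beyond the line through v and w. If p is to the left of v, then w lies in
-- the triangle 0, v, p; if not, v lies in the triangle 0, p, w. Either point would be redundant.
supporting : ∀ {W v w p} → Irreducible W → v ∈ W → w ∈ W → p ∈ W → 0ℚ < cross v w →
  (0ℚ < cross v p → 0ℚ ≤ cross w p) → p ≢ v → p ≢ w → cross p w + cross v p < cross v w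
supporting {W} {v} {w} {p} irr v∈ w∈ p∈ vw next p≢v p≢w with cross v w ℚP.≤? cross p w + cross v p
... | no ¬le = ℚP.≰⇒> ¬le
... | yes le with 0ℚ ℚP.<? cross v p
... | yes vp = ⊥-elim (irr w∈ (inj₂ (inj₂ (lose v∈ (v≢w , lose p∈ (p≢w ,
    vp , ℚP.<⇒≤ vw , next vp , ≤-from (≤⇒0≤ le)
      (trans (solve 3 (λ a b d → (a :+ b) :- d := b :- (d :+ (:- a))) refl (cross p w) (cross v p) (cross v w))
             (cong (λ t → cross v p - (cross v w + t)) (sym (anti w p))))))))))
  where
  v≢w : v ≢ w
  v≢w refl = ℚP.<-irrefl (sym (alternating v)) vw
... | no ¬vp = ⊥-elim (irr v∈ (inj₂ (inj₂ (lose p∈ (p≢v , lose w∈ (w≢v ,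
    pw , ≤0⇒nonNeg (ℚP.≮⇒≥ ¬vp) , ℚP.<⇒≤ vw , ≤-from (≤⇒0≤ le) eq))))))
  where
  w≢v : w ≢ v
  w≢v refl = ℚP.<-irrefl (sym (alternating v)) vw
  eq : cross p w + cross v p - cross v w ≡ cross p w - (cross p v + cross v w)
  eq = trans (cong (λ t → cross p w + t - cross v w) (anti v p))
    (solve 3 (λ a b d → (a :+ (:- b)) :- d := a :- (b :+ d)) refl (cross p w) (cross p v) (cross v w))
  pw : 0ℚ < cross p w
  pw = ℚP.<-≤-trans (nonNeg+pos (≤0⇒nonNeg (ℚP.≮⇒≥ ¬vp)) vw) (≤-from (≤⇒0≤ le) eq)

module AroundOrigin {W₀ : List ℚ²} (irreducible : Irreducible W₀)
  (surround₀ : ∀ x → x ≢ origin → Σ ℚ² λ p → p ∈ W₀ × 0ℚ < cross x p)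
  {o : ℚ²} (generic : ∀ {p} → p ∈ W₀ → cross o p ≢ 0ℚ) where
  open Angular o

  side : ∀ {p} → p ∈ W₀ → 0ℚ < cross o p ⊎ 0ℚ < cross p o
  side {p} p∈ with ℚP.<-cmp 0ℚ (cross o p)
  ... | tri< a _ _ = inj₁ a
  ... | tri≈ _ e _ = ⊥-elim (generic p∈ (sym e))
  ... | tri> _ _ c = inj₂ (neg⇒pos c)

  compare : ∀ {p q} → p ∈ W₀ → q ∈ W₀ → p ≡ q ⊎ p ≺ q ⊎ q ≺ p
  compare {p} {q} p∈ q∈ with side p∈ | side q∈
  ... | inj₁ a | inj₂ b = inj₂ (inj₁ (ul a b))
  ... | inj₂ a | inj₁ b = inj₂ (inj₂ (ul b a))
  ... | inj₁ a | inj₁ b with ℚP.<-cmp 0ℚ (cross p q)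
  ...   | tri< c _ _ = inj₂ (inj₁ (uu a b c))
  ...   | tri≈ _ e _ = inj₁ (same-ray-right irreducible p∈ q∈ (sym e) a b)
  ...   | tri> _ _ c = inj₂ (inj₂ (uu b a (neg⇒pos c)))
  compare {p} {q} p∈ q∈ | inj₂ a | inj₂ b with ℚP.<-cmp 0ℚ (cross p q)
  ...   | tri< c _ _ = inj₂ (inj₁ (ll a b c))
  ...   | tri≈ _ e _ = inj₁ (same-ray-left irreducible p∈ q∈ (sym e) a b)
  ...   | tri> _ _ c = inj₂ (inj₂ (ll b a (neg⇒pos c)))

  cyclic-from : ∀ {v} S → v ∈ S → Σ ℚ² λ w → (v , w) ∈ cyclicPairs S
  cyclic-from (x ∷ xs) = zip-from x xs x

  cyclic-to : ∀ {w} S → w ∈ S → Σ ℚ² λ v → (v , w) ∈ cyclicPairs S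
  cyclic-to (x ∷ xs) (here refl) = zip-to x xs x (∈-++⁺ʳ xs (here refl))
  cyclic-to (x ∷ xs) (there w∈) = zip-to x xs x (∈-++⁺ˡ w∈)

  module _ {S : List ℚ²} (sorted : AllPairs _≺_ S)
    (S⊆W₀ : ∀ {x} → x ∈ S → x ∈ W₀) (W₀⊆S : ∀ {x} → x ∈ W₀ → x ∈ S) where

    -- The nearest generator q to the left of v is the list successor w: otherwise v, w, q are in
    -- cyclic order and `between` puts w strictly before q, against the choice of q.
    successor : ∀ {v w} → (v , w) ∈ cyclicPairs S → 0ℚ < cross v w × (∀ {p} → p ∈ S → 0ℚ < cross v p → 0ℚ ≤ cross w p)
    successor {v} {w} e with cyclic-gap S sorted e
    ... | v∈ , w∈ , gap with nearest cross-form v S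
    ... | inj₁ none = let p , p∈ , vp = surround₀ v (λ v≡0 → irreducible (S⊆W₀ v∈) (inj₁ v≡0)) in
      ⊥-elim (none (W₀⊆S p∈) vp)
    ... | inj₂ (q , q∈ , vq , best) with gap q∈
    ... | inj₁ refl = ⊥-elim (ℚP.<-irrefl (sym (alternating q)) vq)
    ... | inj₂ (inj₁ refl) = vq , best
    ... | inj₂ (inj₂ cyc) = let vw , wq = between cyc vq in ⊥-elim (pos⇒¬nonNeg wq (best w∈ vw))

    sorted-polygon : Polygon S
    sorted-polygon = record
      { unique   = AllPairs.map (λ { p≺q refl → ≺-irrefl p≺q }) sorted
      ; surround = λ x x≢0 → let p , p∈ , xp = surround₀ x x≢0 in p , W₀⊆S p∈ , xp
      ; same-ray = λ v∈ v′∈ → same-ray-left irreducible (S⊆W₀ v∈) (S⊆W₀ v′∈)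
      ; same-rayʳ = λ v∈ v′∈ → same-ray-right irreducible (S⊆W₀ v∈) (S⊆W₀ v′∈)
      ; nonzero  = λ v∈ e → irreducible (S⊆W₀ v∈) (inj₁ e)
      ; ed-pos   = λ e → proj₁ (successor e)
      ; ed-next  = λ e → proj₂ (successor e)
      ; ed-mem   = λ e → let v∈ , w∈ , _ = cyclic-gap S sorted e in v∈ , w∈
      ; ed-from  = cyclic-from S
      ; ed-to    = cyclic-to S
      ; strict   = λ e p∈ → let v∈ , w∈ , _ = cyclic-gap S sorted e in
          supporting irreducible (S⊆W₀ v∈) (S⊆W₀ w∈) (S⊆W₀ p∈) (proj₁ (successor e)) (proj₂ (successor e) p∈)
      }

-- If no point of the reduced list were to the left of x, a half-plane with bound 0 would contain
-- the list, hence all of V.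
reduction-surround : ∀ {V} (R : Reduction V) → (∀ n → n ≢ origin → Σ ℚ² λ p → p ∈ V × 0ℚ < dot p n) →
  ∀ x → x ≢ origin → Σ ℚ² λ p → p ∈ Reduction.W R × 0ℚ < cross x p
reduction-surround R positive-in x x≢0 with any? (λ p → 0ℚ ℚP.<? dot p (rot x)) (Reduction.W R)
... | yes some = let p , p∈ , pos = find some in p , p∈ , subst (0ℚ <_) (dot-rot x p) pos
... | no none = let p , p∈ , pos = positive-in (rot x) rot≢0 in
  ⊥-elim (<⇒≱ pos (Reduction.below R {rot x} ℚP.≤-refl (λ w∈ → ℚP.≮⇒≥ (λ wp → none (lose w∈ wp))) p∈))
  where
  rot≢0 : rot x ≢ origin
  rot≢0 e = x≢0 (cong₂ _,_ (cong proj₂ e) (ℚP.neg-injective (cong proj₁ e)))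

polygon : ∀ V → (∀ n → n ≢ origin → Σ ℚ² λ p → p ∈ V × 0ℚ < dot p n) →
  Σ (List ℚ²) λ W → Polygon W × (∀ {x} → x ∈ W → x ∈ V) × (∀ {n c} → 0ℚ ≤ c → Below W n c → Below V n c)
polygon V positive-in with reduce (length V) V ℕP.≤-refl
... | R with generic-axis (Reduction.W R) (λ p∈ e → Reduction.irreducible R p∈ (inj₁ e))
... | o , generic with Angular.Sorting.sort o (_∈ Reduction.W R)
  (AroundOrigin.compare (Reduction.irreducible R) (reduction-surround R positive-in) generic) (Reduction.W R) (λ q∈ → q∈)
... | S , sorted , S⊆W₀ , W₀⊆S = S ,
  AroundOrigin.sorted-polygon (Reduction.irreducible R) (reduction-surround R positive-in) generic sorted S⊆W₀ W₀⊆S ,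
  (λ x∈ → Reduction.W⊆V R (S⊆W₀ x∈)) , λ 0≤c b → Reduction.below R 0≤c (λ w∈ → b (W₀⊆S w∈))

-- Vector identities in the plane

opaque
  reciprocal : ∀ {a} → 0ℚ < a → Σ ℚ λ b → 0ℚ < b × a * b ≡ 1ℚ
  reciprocal {a} 0<a = (1/ a) , pos-cancel (ℚP.<⇒≤ 0<a) (subst (0ℚ <_) (sym inv) (ℚP.positive⁻¹ 1ℚ)) , inv
    where
    instance
      a-nonZero : ℚ.NonZero a
      a-nonZero = ≢-nonZero (λ a≡0 → ℚP.<-irrefl (sym a≡0) 0<a)
    inv : a * (1/ a) ≡ 1ℚ
    inv = ℚP.*-inverseʳ a

⊙-assoc : ∀ s t x → s ⊙ (t ⊙ x) ≡ (s * t) ⊙ x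
⊙-assoc s t (a , b) = cong₂ _,_ (sym (ℚP.*-assoc s t a)) (sym (ℚP.*-assoc s t b))

⊙-identity : ∀ x → 1ℚ ⊙ x ≡ x
⊙-identity (a , b) = cong₂ _,_ (ℚP.*-identityˡ a) (ℚP.*-identityˡ b)

⊙-zero : ∀ x → 0ℚ ⊙ x ≡ origin
⊙-zero (a , b) = cong₂ _,_ (ℚP.*-zeroˡ a) (ℚP.*-zeroˡ b)

⊙-origin : ∀ s → s ⊙ origin ≡ origin
⊙-origin s = cong₂ _,_ (ℚP.*-zeroʳ s) (ℚP.*-zeroʳ s)

⊙-distrib : ∀ s x y → s ⊙ (x ⊕ y) ≡ (s ⊙ x) ⊕ (s ⊙ y)
⊙-distrib s (a , b) (c , d) = cong₂ _,_ (ℚP.*-distribˡ-+ s a c) (ℚP.*-distribˡ-+ s b d)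

⊕-assoc : ∀ x y z → (x ⊕ y) ⊕ z ≡ x ⊕ (y ⊕ z)
⊕-assoc (a , b) (c , d) (e , f) = cong₂ _,_ (ℚP.+-assoc a c e) (ℚP.+-assoc b d f)

⊕-identityʳ : ∀ x → x ⊕ origin ≡ x
⊕-identityʳ (a , b) = cong₂ _,_ (ℚP.+-identityʳ a) (ℚP.+-identityʳ b)

⊕-identityˡ : ∀ x → origin ⊕ x ≡ x
⊕-identityˡ (a , b) = cong₂ _,_ (ℚP.+-identityˡ a) (ℚP.+-identityˡ b)

⊙-⊕-self : ∀ t x → (t ⊙ x) ⊕ ((1ℚ - t) ⊙ x) ≡ x
⊙-⊕-self t (a , b) = cong₂ _,_ (lem t a) (lem t b)
  where
  lem : ∀ t a → t * a + (1ℚ - t) * a ≡ a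
  lem = solve 2 (λ t a → t :* a :+ (con 1ℚ :- t) :* a := a) refl

opaque
  unfolding cross dot

  dot-⊕ : ∀ x y n → dot (x ⊕ y) n ≡ dot x n + dot y n
  dot-⊕ (a , b) (c , d) (e , f) =
    solve 6 (λ a b c d e f → (a :+ c) :* e :+ (b :+ d) :* f := (a :* e :+ b :* f) :+ (c :* e :+ d :* f)) refl a b c d e f

  dot-⊙ : ∀ s x n → dot (s ⊙ x) n ≡ s * dot x n
  dot-⊙ s (a , b) (e , f) = solve 5 (λ s a b e f → (s :* a) :* e :+ (s :* b) :* f := s :* (a :* e :+ b :* f)) refl s a b e f

  cross-⊙ʳ : ∀ s x y → cross x (s ⊙ y) ≡ s * cross x y
  cross-⊙ʳ s (a , b) (e , f) = solve 5 (λ s a b e f → a :* (s :* f) :- b :* (s :* e) := s :* (a :* f :- b :* e)) refl s a b e f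

  cross-expand : ∀ v w x → cross v w ⊙ x ≡ (cross x w ⊙ v) ⊕ (cross v x ⊙ w)
  cross-expand (v₁ , v₂) (w₁ , w₂) (x₁ , x₂) = cong₂ _,_
    (solve 6 (λ v₁ v₂ w₁ w₂ x₁ x₂ → let dt = λ x₁ x₂ y₁ y₂ → x₁ :* y₂ :- x₂ :* y₁ in
      dt v₁ v₂ w₁ w₂ :* x₁ := dt x₁ x₂ w₁ w₂ :* v₁ :+ dt v₁ v₂ x₁ x₂ :* w₁) refl v₁ v₂ w₁ w₂ x₁ x₂)
    (solve 6 (λ v₁ v₂ w₁ w₂ x₁ x₂ → let dt = λ x₁ x₂ y₁ y₂ → x₁ :* y₂ :- x₂ :* y₁ in
      dt v₁ v₂ w₁ w₂ :* x₂ := dt x₁ x₂ w₁ w₂ :* v₂ :+ dt v₁ v₂ x₁ x₂ :* w₂) refl v₁ v₂ w₁ w₂ x₁ x₂)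

  dot-separates : ∀ {a b} x y → 0ℚ < cross a b → dot x a ≡ dot y a → dot x b ≡ dot y b → x ≡ y
  dot-separates {a₁ , a₂} {b₁ , b₂} (x₁ , x₂) (y₁ , y₂) ab xa xb = cong₂ _,_
    (cancel (trans (coord₁ x₁ x₂) (trans (cong₂ (λ s t → s * b₂ - t * a₂) xa xb) (sym (coord₁ y₁ y₂)))))
    (cancel (trans (coord₂ x₁ x₂) (trans (cong₂ (λ s t → t * a₁ - s * b₁) xa xb) (sym (coord₂ y₁ y₂)))))
    where
    D : ℚ
    D = a₁ * b₂ - a₂ * b₁
    coord₁ : ∀ z₁ z₂ → D * z₁ ≡ (z₁ * a₁ + z₂ * a₂) * b₂ - (z₁ * b₁ + z₂ * b₂) * a₂
    coord₁ z₁ z₂ = solve 6 (λ a₁ a₂ b₁ b₂ z₁ z₂ → (a₁ :* b₂ :- a₂ :* b₁) :* z₁ :=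
      (z₁ :* a₁ :+ z₂ :* a₂) :* b₂ :- (z₁ :* b₁ :+ z₂ :* b₂) :* a₂) refl a₁ a₂ b₁ b₂ z₁ z₂
    coord₂ : ∀ z₁ z₂ → D * z₂ ≡ (z₁ * b₁ + z₂ * b₂) * a₁ - (z₁ * a₁ + z₂ * a₂) * b₁
    coord₂ z₁ z₂ = solve 6 (λ a₁ a₂ b₁ b₂ z₁ z₂ → (a₁ :* b₂ :- a₂ :* b₁) :* z₂ :=
      (z₁ :* b₁ :+ z₂ :* b₂) :* a₁ :- (z₁ :* a₁ :+ z₂ :* a₂) :* b₁) refl a₁ a₂ b₁ b₂ z₁ z₂
    cancel : ∀ {s t} → D * s ≡ D * t → s ≡ t
    cancel {s} {t} e = trans (solve 2 (λ s t → s := t :+ (s :- t)) refl s t)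
      (trans (cong (λ z → t + z) (zero-cancel ab (trans (solve 3 (λ D s t → D :* (s :- t) := D :* s :- D :* t) refl D s t)
        (trans (cong (_- D * t) e) (ℚP.+-inverseʳ (D * t)))))) (ℚP.+-identityʳ t))

  -- w - v turned clockwise: the outer normal of a counter-clockwise edge. On the line through v and
  -- w it takes the value `cross v w`, twice the area of the triangle 0, v, w.
  normal : ℚ² → ℚ² → ℚ²
  normal (v₁ , v₂) (w₁ , w₂) = w₂ - v₂ , v₁ - w₁

  dot-normal : ∀ v w x → dot x (normal v w) ≡ cross x w + cross v x
  dot-normal (v₁ , v₂) (w₁ , w₂) (x₁ , x₂) = solve 6 (λ v₁ v₂ w₁ w₂ x₁ x₂ →
    x₁ :* (w₂ :- v₂) :+ x₂ :* (v₁ :- w₁) := (x₁ :* w₂ :- x₂ :* w₁) :+ (v₁ :* x₂ :- v₂ :* x₁)) refl v₁ v₂ w₁ w₂ x₁ x₂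

  -- The turn from the edge p v to the edge v w is the slack of w in the inequality of the edge p v.
  cross-normal : ∀ p v w → cross (normal p v) (normal v w) ≡ cross p v - (cross w v + cross p w)
  cross-normal (p₁ , p₂) (v₁ , v₂) (w₁ , w₂) = solve 6 (λ p₁ p₂ v₁ v₂ w₁ w₂ →
    let dt = λ x₁ x₂ y₁ y₂ → x₁ :* y₂ :- x₂ :* y₁ in
    (v₂ :- p₂) :* (v₁ :- w₁) :- (p₁ :- v₁) :* (w₂ :- v₂) :=
    dt p₁ p₂ v₁ v₂ :- (dt w₁ w₂ v₁ v₂ :+ dt p₁ p₂ w₁ w₂)) refl p₁ p₂ v₁ v₂ w₁ w₂

  -- Parallel points on one line off the origin coincide; keeping the factor c avoids a division.
  equal-dots : ∀ {v w n c} → dot v n ≡ c → dot w n ≡ c → cross v w ≡ 0ℚ → c ⊙ v ≡ c ⊙ w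
  equal-dots {v₁ , v₂} {w₁ , w₂} {n₁ , n₂} {c} vn wn vw = cong₂ _,_
    (trans (cong (_* v₁) (sym wn)) (trans (solve 6 (λ v₁ v₂ w₁ w₂ n₁ n₂ → (w₁ :* n₁ :+ w₂ :* n₂) :* v₁ :=
        (v₁ :* n₁ :+ v₂ :* n₂) :* w₁ :+ (v₁ :* w₂ :- v₂ :* w₁) :* n₂) refl v₁ v₂ w₁ w₂ n₁ n₂)
      (trans (cong₂ (λ s t → s * w₁ + t * n₂) vn vw) (trans (cong (λ z → c * w₁ + z) (ℚP.*-zeroˡ n₂)) (ℚP.+-identityʳ _)))))
    (trans (cong (_* v₂) (sym wn)) (trans (solve 6 (λ v₁ v₂ w₁ w₂ n₁ n₂ → (w₁ :* n₁ :+ w₂ :* n₂) :* v₂ :=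
        (v₁ :* n₁ :+ v₂ :* n₂) :* w₂ :+ (v₁ :* w₂ :- v₂ :* w₁) :* (:- n₁)) refl v₁ v₂ w₁ w₂ n₁ n₂)
      (trans (cong₂ (λ s t → s * w₂ + t * (- n₁)) vn vw) (trans
          (cong (λ z → c * w₂ + z) (ℚP.*-zeroˡ (- n₁))) (ℚP.+-identityʳ _)))))

-- Convex hulls

-- An arbitrary total weight s makes sums and multiples free of division. For s = 1 this is `Conv V`
-- by definition, and `weighted-normalise` leads back to it.
WeightedConv : List ℚ² → ℚ → Region
WeightedConv V s x = Σ (List (ℚ × ℚ²)) λ ws →
  All (λ p → (0ℚ ≤ proj₁ p) × (proj₂ p ∈ V)) ws × (sumℚ (map proj₁ ws) ≡ s) × (combo ws ≡ x)

module _ {V : List ℚ²} where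
  weighted-point : ∀ {p} → p ∈ V → WeightedConv V 1ℚ p
  weighted-point {p} p∈ = (1ℚ , p) ∷ [] , (ℚP.<⇒≤ (ℚP.positive⁻¹ 1ℚ) , p∈) ∷ [] , refl ,
    trans (cong (_⊕ origin) (⊙-identity p)) (⊕-identityʳ p)

  weighted-scale : ∀ {s c x} → 0ℚ ≤ c → WeightedConv V s x → WeightedConv V (c * s) (c ⊙ x)
  weighted-scale {s} {c} 0≤c (ws , ok , refl , refl) = scaled ws , ok′ ok , sums ws , combos ws
    where
    scaled : List (ℚ × ℚ²) → List (ℚ × ℚ²)
    scaled = map (λ p → c * proj₁ p , proj₂ p)
    ok′ : ∀ {ws} → All (λ p → (0ℚ ≤ proj₁ p) × (proj₂ p ∈ V)) ws → All (λ p → (0ℚ ≤ proj₁ p) × (proj₂ p ∈ V)) (scaled ws)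
    ok′ [] = []
    ok′ ((l , v) ∷ ok) = (nonNeg*nonNeg 0≤c l , v) ∷ ok′ ok
    sums : ∀ ws → sumℚ (map proj₁ (scaled ws)) ≡ c * sumℚ (map proj₁ ws)
    sums [] = sym (ℚP.*-zeroʳ c)
    sums ((l , v) ∷ ws) = trans (cong (λ z → c * l + z) (sums ws)) (sym (ℚP.*-distribˡ-+ c l _))
    combos : ∀ ws → combo (scaled ws) ≡ c ⊙ combo ws
    combos [] = sym (⊙-origin c)
    combos ((l , v) ∷ ws) = trans (cong₂ _⊕_ (sym (⊙-assoc c l v)) (combos ws)) (sym (⊙-distrib c (l ⊙ v) (combo ws)))

  weighted-add : ∀ {s t x y} → WeightedConv V s x → WeightedConv V t y → WeightedConv V (s + t) (x ⊕ y)
  weighted-add {t = t} {y = y} (ws , ok , refl , refl) (ws′ , ok′ , refl , refl) =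
    ws ++ ws′ , AllP.++⁺ ok ok′ , sums ws , combos ws
    where
    sums : ∀ ws → sumℚ (map proj₁ (ws ++ ws′)) ≡ sumℚ (map proj₁ ws) + t
    sums [] = sym (ℚP.+-identityˡ t)
    sums ((l , v) ∷ ws) = trans (cong (λ z → l + z) (sums ws)) (sym (ℚP.+-assoc l _ t))
    combos : ∀ ws → combo (ws ++ ws′) ≡ combo ws ⊕ y
    combos [] = sym (⊕-identityˡ y)
    combos ((l , v) ∷ ws) = trans (cong ((l ⊙ v) ⊕_) (combos ws)) (sym (⊕-assoc (l ⊙ v) (combo ws) y))

  weighted-normalise : ∀ {s x} → 0ℚ < s → WeightedConv V s (s ⊙ x) → Conv V x
  weighted-normalise {s} {x} 0<s wx with reciprocal 0<s
  ... | r , 0<r , sr≡1 = subst₂ (WeightedConv V) (trans (ℚP.*-comm r s) sr≡1)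
    (trans (⊙-assoc r s x) (trans (cong (_⊙ x) (trans (ℚP.*-comm r s) sr≡1)) (⊙-identity x)))
    (weighted-scale (ℚP.<⇒≤ 0<r) wx)

  conv-below : ∀ {n c x} → Below V n c → Conv V x → dot x n ≤ c
  conv-below {n} {c} below (ws , ok , sum≡1 , refl) =
    subst (dot (combo ws) n ≤_) (trans (cong (_* c) sum≡1) (ℚP.*-identityˡ c)) (bound ok)
    where
    bound : ∀ {ws} → All (λ p → (0ℚ ≤ proj₁ p) × (proj₂ p ∈ V)) ws → dot (combo ws) n ≤ sumℚ (map proj₁ ws) * c
    bound [] = ℚP.≤-reflexive (trans (dot-origin n) (sym (ℚP.*-zeroˡ c)))
    bound {(l , v) ∷ ws} ((0≤l , v∈) ∷ ok) = subst₂ _≤_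
      (sym (trans (dot-⊕ (l ⊙ v) (combo ws) n) (cong (_+ dot (combo ws) n) (dot-⊙ l v n))))
      (sym (ℚP.*-distribʳ-+ c l (sumℚ (map proj₁ ws))))
      (ℚP.+-mono-≤ (ℚP.*-monoˡ-≤-nonNeg l {{nonNegative 0≤l}} (below v∈)) (bound ok))

  private
    weights-nonNeg : ∀ {ws} → All (λ p → (0ℚ ≤ proj₁ p) × (proj₂ p ∈ V)) ws → 0ℚ ≤ sumℚ (map proj₁ ws)
    weights-nonNeg [] = ℚP.≤-refl
    weights-nonNeg ((l , _) ∷ ok) = nonNeg+nonNeg l (weights-nonNeg ok)

    zero-sum : ∀ {a b} → 0ℚ ≤ a → 0ℚ ≤ b → a + b ≡ 0ℚ → a ≡ 0ℚ
    zero-sum {a} {b} 0≤a 0≤b e with 0≤⇒pos⊎zero 0≤a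
    ... | inj₂ z = z
    ... | inj₁ 0<a = ⊥-elim (ℚP.<-irrefl (sym e) (pos+nonNeg 0<a 0≤b))

    zero-weights : ∀ {ws} → All (λ p → (0ℚ ≤ proj₁ p) × (proj₂ p ∈ V)) ws → sumℚ (map proj₁ ws) ≡ 0ℚ → combo ws ≡ origin
    zero-weights [] _ = refl
    zero-weights {(l , v) ∷ ws} ((0≤l , _) ∷ ok) e with zero-sum 0≤l (weights-nonNeg ok) e
    ... | refl = cong₂ _⊕_ (⊙-zero v) (zero-weights ok (trans (sym (ℚP.+-identityˡ _)) e))

  -- At the first positive weight, on p say, either the remaining weights vanish and v is p, or v
  -- lies properly between p and the normalised remainder q; extremality gives p ≡ q, and then v ≡
  -- p.
  vertex-generator : ∀ {v} → Vertex (Conv V) v → v ∈ V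
  vertex-generator {v} ((ws , ok , sum≡1 , combo≡v) , extreme) = search ok sum≡1 combo≡v
    where
    search : ∀ {ws} → All (λ p → (0ℚ ≤ proj₁ p) × (proj₂ p ∈ V)) ws → sumℚ (map proj₁ ws) ≡ 1ℚ → combo ws ≡ v → v ∈ V
    search {(l , p) ∷ ws} ((0≤l , p∈) ∷ ok) sum≡1 combo≡v with 0≤⇒pos⊎zero 0≤l
    ... | inj₂ refl = search ok (trans (sym (ℚP.+-identityˡ _)) sum≡1)
            (trans (sym (⊕-identityˡ _)) (trans (cong (_⊕ combo ws) (sym (⊙-zero p))) combo≡v))
    ... | inj₁ 0<l with 0≤⇒pos⊎zero (weights-nonNeg ok)
    ...   | inj₂ rest≡0 = subst (_∈ V) (trans (sym (⊙-identity p)) (trans (cong (_⊙ p) (sym l≡1))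
              (trans (sym (⊕-identityʳ (l ⊙ p))) (trans (cong ((l ⊙ p) ⊕_) (sym (zero-weights ok rest≡0))) combo≡v)))) p∈
      where
      l≡1 : l ≡ 1ℚ
      l≡1 = trans (sym (ℚP.+-identityʳ l)) (trans (cong (λ z → l + z) (sym rest≡0)) sum≡1)
    ...   | inj₁ 0<r with reciprocal 0<r
    ...     | i , 0<i , ri≡1 = subst (_∈ V) p≡v p∈
      where
      r = sumℚ (map proj₁ ws)
      q = i ⊙ combo ws
      r≡1-l : 1ℚ - l ≡ r
      r≡1-l = trans (cong (_- l) (sym sum≡1)) (solve 2 (λ l r → (l :+ r) :- l := r) refl l r)
      rq : r ⊙ q ≡ combo ws
      rq = trans (⊙-assoc r i (combo ws)) (trans (cong (_⊙ combo ws) ri≡1) (⊙-identity (combo ws)))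
      v≡ : v ≡ (l ⊙ p) ⊕ ((1ℚ - l) ⊙ q)
      v≡ = trans (sym combo≡v) (cong ((l ⊙ p) ⊕_) (sym (trans (cong (_⊙ q) r≡1-l) rq)))
      p≡q : p ≡ q
      p≡q = extreme p q l (weighted-point p∈)
        (weighted-normalise 0<r (subst (WeightedConv V r) (sym rq) (ws , ok , refl , refl)))
        0<l (<-from 0<r (sym r≡1-l)) v≡
      p≡v : p ≡ v
      p≡v = sym (trans v≡ (trans (cong (λ z → (l ⊙ p) ⊕ ((1ℚ - l) ⊙ z)) (sym p≡q)) (⊙-⊕-self l p)))

-- The nonnegative terms t (d - a) and (1 - t) (d - b) have sum zero.
convex-equality : ∀ {t a b d} → 0ℚ < t → t < 1ℚ → a ≤ d → b ≤ d → d ≡ t * a + (1ℚ - t) * b → a ≡ d × b ≡ d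
convex-equality {t} {a} {b} {d} 0<t t<1 a≤d b≤d e = from-zero a≡ , from-zero b≡
  where
  total : t * (d - a) + (1ℚ - t) * (d - b) ≡ 0ℚ
  total = trans (solve 4 (λ t a b d → t :* (d :- a) :+ (con 1ℚ :- t) :* (d :- b) :=
      d :- (t :* a :+ (con 1ℚ :- t) :* b)) refl t a b d)
    (trans (cong (_- (t * a + (1ℚ - t) * b)) e) (ℚP.+-inverseʳ (t * a + (1ℚ - t) * b)))
  zero-summand : ∀ {x y} → 0ℚ ≤ x → 0ℚ ≤ y → x + y ≡ 0ℚ → x ≡ 0ℚ
  zero-summand 0≤x 0≤y e with 0≤⇒pos⊎zero 0≤x
  ... | inj₂ z = z
  ... | inj₁ 0<x = ⊥-elim (ℚP.<-irrefl (sym e) (pos+nonNeg 0<x 0≤y))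
  x≥0 = nonNeg*nonNeg (ℚP.<⇒≤ 0<t) (≤⇒0≤ a≤d)
  y≥0 = nonNeg*nonNeg (ℚP.<⇒≤ (<⇒0< t<1)) (≤⇒0≤ b≤d)
  a≡ : d - a ≡ 0ℚ
  a≡ = zero-cancel 0<t (zero-summand x≥0 y≥0 total)
  b≡ : d - b ≡ 0ℚ
  b≡ = zero-cancel (<⇒0< t<1) (zero-summand y≥0 x≥0 (trans (ℚP.+-comm ((1ℚ - t) * (d - b)) (t * (d - a))) total))
  from-zero : ∀ {a} → d - a ≡ 0ℚ → a ≡ d
  from-zero {a} e = trans (solve 2 (λ a d → a := d :- (d :- a)) refl a d) (trans (cong (λ z → d - z) e)
      (solve 1 (λ d → d :- con 0ℚ := d) refl d))

-- Faces of a polygon around the origin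

height : ℚ² → ℚ² → ℚ² → ℚ
height v w x = dot x (normal v w)

opaque
  unfolding dot
  dot-bound : ∀ d n {ε} → ∣ proj₁ d ∣ < ε → ∣ proj₂ d ∣ < ε → dot d n ≤ ε * (∣ proj₁ n ∣ + ∣ proj₂ n ∣)
  dot-bound (d₁ , d₂) (n₁ , n₂) {ε} d₁<ε d₂<ε =
    subst (d₁ * n₁ + d₂ * n₂ ≤_) (sym (ℚP.*-distribˡ-+ ε ∣ n₁ ∣ ∣ n₂ ∣)) (ℚP.+-mono-≤ (term d₁ n₁ d₁<ε) (term d₂ n₂ d₂<ε))
    where
    x≤∣x∣ : ∀ x → x ≤ ∣ x ∣
    x≤∣x∣ x with ℚP.≤-total 0ℚ x
    ... | inj₁ p = ℚP.≤-reflexive (sym (ℚP.0≤p⇒∣p∣≡p p))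
    ... | inj₂ p = ℚP.≤-trans p (ℚP.0≤∣p∣ x)
    term : ∀ d n → ∣ d ∣ < ε → d * n ≤ ε * ∣ n ∣
    term d n d<ε = ℚP.≤-trans (x≤∣x∣ (d * n)) (ℚP.≤-trans (ℚP.≤-reflexive (ℚP.∣p*q∣≡∣p∣*∣q∣ d n))
      (ℚP.*-monoʳ-≤-nonNeg ∣ n ∣ {{nonNegative (ℚP.0≤∣p∣ n)}} (ℚP.<⇒≤ d<ε)))

  dot-sub : ∀ x y n → dot (proj₁ y - proj₁ x , proj₂ y - proj₂ x) n ≡ dot y n - dot x n
  dot-sub (a , b) (c , d) (e , f) = solve 6 (λ a b c d e f →
    (c :- a) :* e :+ (d :- b) :* f := (c :* e :+ d :* f) :- (a :* e :+ b :* f)) refl a b c d e f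

-- The summand 1 makes this invertible also for n = 0.
size : ℚ² → ℚ
size n = 1ℚ + (∣ proj₁ n ∣ + ∣ proj₂ n ∣)

size-pos : ∀ n → 0ℚ < size n
size-pos n = pos+nonNeg (ℚP.positive⁻¹ 1ℚ) (nonNeg+nonNeg (ℚP.0≤∣p∣ (proj₁ n)) (ℚP.0≤∣p∣ (proj₂ n)))

module _ {s r : ℚ} (sr≡1 : s * r ≡ 1ℚ) where
  scaled-gap : ∀ g {m t} → s ≡ m + t → g * r * t ≡ g - g * r * m
  scaled-gap g {m} {t} refl = trans
    (solve 4 (λ g r m t → g :* r :* t := g :* ((m :+ t) :* r) :- g :* r :* m) refl g r m t)
    (cong (_- g * r * m) (trans (cong (g *_) sr≡1) (ℚP.*-identityʳ g)))

opaque
  ball-below : ∀ n {g} → 0ℚ < g → Σ ℚ λ ε → 0ℚ < ε × (∀ {δ d} → δ ≤ ε → ∣ proj₁ d ∣ < δ → ∣ proj₂ d ∣ < δ → dot d n < g)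
  ball-below n {g} 0<g with reciprocal (size-pos n)
  ... | r , 0<r , sr≡1 = g * r , pos*pos 0<g 0<r , λ {δ} {d} δ≤ d₁ d₂ →
    ℚP.≤-<-trans (dot-bound d n (ℚP.<-≤-trans d₁ δ≤) (ℚP.<-≤-trans d₂ δ≤)) below
    where
    below : g * r * (∣ proj₁ n ∣ + ∣ proj₂ n ∣) < g
    below = <-from (pos*pos (pos*pos 0<g 0<r) (ℚP.positive⁻¹ 1ℚ)) (scaled-gap {size n} {r} sr≡1 g (ℚP.+-comm 1ℚ
        (∣ proj₁ n ∣ + ∣ proj₂ n ∣)))

  small-step : ∀ n {ε} → 0ℚ < ε → Σ ℚ λ δ → 0ℚ < δ × ∣ δ * proj₁ n ∣ < ε × ∣ δ * proj₂ n ∣ < ε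
  small-step n {ε} 0<ε with reciprocal (size-pos n)
  ... | r , 0<r , sr≡1 = ε * r , pos*pos 0<ε 0<r ,
    bound (proj₁ n) (rest (proj₂ n)) (regroup ∣ proj₁ n ∣ ∣ proj₂ n ∣) ,
    bound (proj₂ n) (rest (proj₁ n)) (regroup′ ∣ proj₁ n ∣ ∣ proj₂ n ∣)
    where
    regroup : ∀ a b → 1ℚ + (a + b) ≡ a + (1ℚ + b)
    regroup = solve 2 (λ a b → con 1ℚ :+ (a :+ b) := a :+ (con 1ℚ :+ b)) refl
    regroup′ : ∀ a b → 1ℚ + (a + b) ≡ b + (1ℚ + a)
    regroup′ = solve 2 (λ a b → con 1ℚ :+ (a :+ b) := b :+ (con 1ℚ :+ a)) refl
    rest : ∀ m → 0ℚ < 1ℚ + ∣ m ∣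
    rest m = pos+nonNeg (ℚP.positive⁻¹ 1ℚ) (ℚP.0≤∣p∣ m)
    bound : ∀ m {t} → 0ℚ < t → size n ≡ ∣ m ∣ + t → ∣ ε * r * m ∣ < ε
    bound m {t} 0<t e = subst (_< ε) (sym (trans (ℚP.∣p*q∣≡∣p∣*∣q∣ (ε * r) m)
        (cong (_* ∣ m ∣) (ℚP.0≤p⇒∣p∣≡p (ℚP.<⇒≤ (pos*pos 0<ε 0<r))))))
      (<-from {b = ε} (pos*pos (pos*pos 0<ε 0<r) 0<t) (scaled-gap {size n} {r} sr≡1 ε e))

minus-zero : ∀ x → x - 0ℚ ≡ x
minus-zero = solve 1 (λ x → x :- con 0ℚ := x) refl

-- A small multiple of n belongs to the hull and has positive product with n; if all generators were
-- nonpositive on n, so would be the hull.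
interior-positive : ∀ {V} → Int (Conv V) origin → ∀ n → n ≢ origin → Σ ℚ² λ p → p ∈ V × 0ℚ < dot p n
interior-positive {V} (ε , 0<ε , ball) n n≢0 with any? (λ p → 0ℚ ℚP.<? dot p n) V
... | yes some = find some
... | no none = ⊥-elim (stuck (small-step n 0<ε))
  where
  stuck : ¬ Σ ℚ λ δ → 0ℚ < δ × ∣ δ * proj₁ n ∣ < ε × ∣ δ * proj₂ n ∣ < ε
  stuck (δ , 0<δ , δ₁ , δ₂) = <⇒≱ (pos*pos 0<δ (norm-pos n≢0)) (subst (_≤ 0ℚ) (dot-⊙ δ n n) below)
    where
    inside : Conv V (δ ⊙ n)
    inside = ball (δ ⊙ n) (subst (λ t → ∣ t ∣ < ε) (sym (minus-zero (δ * proj₁ n))) δ₁)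
                          (subst (λ t → ∣ t ∣ < ε) (sym (minus-zero (δ * proj₂ n))) δ₂)
    below : dot (δ ⊙ n) n ≤ 0ℚ
    below = conv-below (λ v∈ → ℚP.≮⇒≥ (λ vn → none (lose v∈ vn))) inside

neg²-nonzero : ∀ {x} → x ≢ origin → neg² x ≢ origin
neg²-nonzero x≢0 e = x≢0 (cong₂ _,_ (ℚP.neg-injective (cong proj₁ e)) (ℚP.neg-injective (cong proj₂ e)))

module Faces {W : List ℚ²} (poly : Polygon W) where
  open Polygon poly public

  IsEdge : ℚ² → ℚ² → Set
  IsEdge v w = (v , w) ∈ cyclicPairs W

  surroundˡ : ∀ x → x ≢ origin → Σ ℚ² λ p → p ∈ W × 0ℚ < cross p x
  surroundˡ x x≢0 = let p , p∈ , pos = surround (neg² x) (neg²-nonzero x≢0) in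
    p , p∈ , subst (0ℚ <_) (trans (anti (neg² x) p) (trans (cong -_ (cross-neg p x)) (sym (anti p x)))) pos

  open Sectors cross-form W IsEdge surroundˡ surround ed-pos ed-next ed-mem ed-from same-ray public
    using (sector; sector-unique)

  private
    ed-prev : ∀ {v w p} → IsEdge v w → p ∈ W → 0ℚ < cross p w → 0ℚ ≤ cross p v
    ed-prev {v} {w} {p} e p∈ pw with 0ℚ ℚP.≤? cross p v
    ... | yes pv = pv
    ... | no ¬pv = ⊥-elim (pos⇒¬nonNeg pw (ed-next e p∈ (neg⇒pos (ℚP.≰⇒> ¬pv))))

  -- The mirror image, with heads in the role of tails, gives the cones over (v , w].
  open Sectors (flip-form cross-form) W (flip IsEdge) surround surroundˡ ed-pos ed-prev
    (λ e → proj₂ (ed-mem e) , proj₁ (ed-mem e)) ed-to (λ v∈ v′∈ vv′ → same-rayʳ v∈ v′∈ (zero-swap vv′)) public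
    renaming (sector to sectorˡ; sector-unique to sectorˡ-unique)

  height-tail : ∀ v w → height v w v ≡ cross v w
  height-tail v w = trans (dot-normal v w v) (trans (cong (λ z → cross v w + z) (alternating v)) (ℚP.+-identityʳ _))

  height-head : ∀ v w → height v w w ≡ cross v w
  height-head v w = trans (dot-normal v w w) (trans (cong (_+ cross v w) (alternating w)) (ℚP.+-identityˡ _))

  vertex-height : ∀ {v w p} → IsEdge v w → p ∈ W → height v w p ≤ cross v w
  vertex-height {v} {w} {p} e p∈ with p ≟² v | p ≟² w
  ... | yes refl | _ = ℚP.≤-reflexive (height-tail p w)
  ... | no _ | yes refl = ℚP.≤-reflexive (height-head v p)
  ... | no p≢v | no p≢w = subst (_≤ cross v w) (sym (dot-normal v w p)) (ℚP.<⇒≤ (strict e p∈ p≢v p≢w))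

  -- For c ≥ 0, the c-fold dilate and its interior as systems of edge inequalities.
  In In< : ℚ → Region
  In c x = ∀ {v w} → IsEdge v w → height v w x ≤ c * cross v w
  In< c x = ∀ {v w} → IsEdge v w → height v w x < c * cross v w

  private
    gap-identity : ∀ {v w v′ w′} x c → cross v w * (c * cross v′ w′ - height v′ w′ x) ≡
      (c * cross v w - height v w x) * cross v′ w′ +
      (cross x w * (cross v′ w′ - height v′ w′ v) + cross v x * (cross v′ w′ - height v′ w′ w))
    gap-identity {v} {w} {v′} {w′} x c = trans
      (trans (solve 4 (λ D c D′ h → D :* (c :* D′ :- h) := D :* c :* D′ :- D :* h) refl D c D′ (height v′ w′ x))
        (cong (λ t → D * c * D′ - t) (cramer v w x (normal v′ w′))))
      (trans (solve 7 (λ D c D′ a b p q → D :* c :* D′ :- (a :* p :+ b :* q) :=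
          (c :* D :- (a :+ b)) :* D′ :+ (a :* (D′ :- p) :+ b :* (D′ :- q))) refl
          D c D′ (cross x w) (cross v x) (height v′ w′ v) (height v′ w′ w))
        (cong (λ t → (c * D - t) * D′ + (cross x w * (D′ - height v′ w′ v) + cross v x * (D′ - height v′ w′ w)))
          (sym (dot-normal v w x))))
      where
      D = cross v w
      D′ = cross v′ w′

    slack : ∀ {v w v′ w′ x} → IsEdge v w → IsEdge v′ w′ → 0ℚ ≤ cross v x → 0ℚ ≤ cross x w →
      0ℚ ≤ cross x w * (cross v′ w′ - height v′ w′ v) + cross v x * (cross v′ w′ - height v′ w′ w)
    slack e e′ vx xw = let v∈ , w∈ = ed-mem e in
      nonNeg+nonNeg (nonNeg*nonNeg xw (≤⇒0≤ (vertex-height e′ v∈))) (nonNeg*nonNeg vx (≤⇒0≤ (vertex-height e′ w∈)))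

  -- Expanding x in the basis v, w of its cone, `gap-identity` bounds the slack at any edge from
  -- below by a positive multiple of the slack at this one, so a single inequality suffices.
  sector-In : ∀ {c x v w} → IsEdge v w → 0ℚ ≤ cross v x → 0ℚ ≤ cross x w → height v w x ≤ c * cross v w → In c x
  sector-In {c} {x} {v} {w} e vx xw le {v′} {w′} e′ = 0≤⇒≤ (nonNeg-cancel (ed-pos e) (subst (0ℚ ≤_)
    (sym (gap-identity {v} {w} {v′} {w′} x c))
    (nonNeg+nonNeg (nonNeg*nonNeg (≤⇒0≤ le) (ℚP.<⇒≤ (ed-pos e′))) (slack e e′ vx xw))))

  sector-In< : ∀ {c x v w} → IsEdge v w → 0ℚ ≤ cross v x → 0ℚ ≤ cross x w → height v w x < c * cross v w → In< c x
  sector-In< {c} {x} {v} {w} e vx xw lt {v′} {w′} e′ = 0<⇒< (pos-cancel (ℚP.<⇒≤ (ed-pos e)) (subst (0ℚ <_)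
    (sym (gap-identity {v} {w} {v′} {w′} x c))
    (pos+nonNeg (pos*pos (<⇒0< lt) (ed-pos e′)) (slack e e′ vx xw))))

  some-edge : Σ ℚ² λ v → Σ ℚ² λ w → IsEdge v w
  some-edge = let p , p∈ , _ = surround (1ℚ , 0ℚ) (λ ()) ; w , e = ed-from p∈ in p , w , e

  origin-In< : ∀ {c} → 0ℚ < c → In< c origin
  origin-In< {c} 0<c {v} {w} e = subst (_< c * cross v w) (sym (dot-origin (normal v w))) (pos*pos 0<c (ed-pos e))

  In-zero : ∀ {x} → In 0ℚ x → x ≡ origin
  In-zero {x} inside with x ≟² origin
  ... | yes e = e
  ... | no x≢0 with sector x x≢0
  ... | v , w , e , vx , xw = ⊥-elim (<⇒≱ (pos+nonNeg xw vx)
    (subst₂ _≤_ (dot-normal v w x) (ℚP.*-zeroˡ (cross v w)) (inside e)))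

  In-⊙ : ∀ {k c x} → 0ℚ ≤ k → In c x → In (k * c) (k ⊙ x)
  In-⊙ {k} {c} {x} 0≤k inside {v} {w} e = subst₂ _≤_ (sym (dot-⊙ k x (normal v w))) (sym (ℚP.*-assoc k c (cross v w)))
    (ℚP.*-monoˡ-≤-nonNeg k {{nonNegative 0≤k}} (inside e))

  -- In one direction, a small step along the outer normal stays in R and strictly raises the
  -- height. In the other, each edge allows a radius, and the smallest of these finitely many works
  -- for all.
  interior : ∀ {R : Region} {c} → (∀ x → R x ⇔ In c x) → ∀ x → Int R x ⇔ In< c x
  interior {R} {c} R⇔ x = mk⇔ fwd bwd
    where
    fwd : Int R x → In< c x
    fwd (ε , 0<ε , ball) {v} {w} e with small-step (normal v w) 0<ε
    ... | δ , 0<δ , δ₁ , δ₂ = ℚP.<-≤-trans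
      (<-from (pos*pos 0<δ (norm-pos n≢0)) (trans (solve 2 (λ a b → b := (a :+ b) :- a) refl (dot x n) (δ * dot n n))
        (cong (_- dot x n) (sym (trans (dot-⊕ x (δ ⊙ n) n) (cong (λ z → dot x n + z) (dot-⊙ δ n n)))))))
      (to (R⇔ (x ⊕ (δ ⊙ n))) (ball (x ⊕ (δ ⊙ n)) (shift (proj₁ x) (proj₁ n) δ₁) (shift (proj₂ x) (proj₂ n) δ₂)) e)
      where
      n = normal v w
      n≢0 : n ≢ origin
      n≢0 e′ = ℚP.<-irrefl (trans (sym (dot-origin v)) (trans (dot-comm origin v)
        (trans (cong (dot v) (sym e′)) (height-tail v w)))) (ed-pos e)
      shift : ∀ a m → ∣ δ * m ∣ < ε → ∣ (a + δ * m) - a ∣ < ε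
      shift a m = subst (λ t → ∣ t ∣ < ε) (solve 2 (λ a b → b := (a :+ b) :- a) refl a (δ * m))
    bwd : In< c x → Int R x
    bwd inside = let ε , 0<ε , ball = common (cyclicPairs W) (λ e → e) in
      ε , 0<ε , λ y y₁ y₂ → from (R⇔ y) (λ e → ball e y₁ y₂)
      where
      common : ∀ L → (∀ {e} → e ∈ L → e ∈ cyclicPairs W) → Σ ℚ λ ε → 0ℚ < ε × (∀ {v w y} → (v , w) ∈ L →
        ∣ proj₁ y - proj₁ x ∣ < ε → ∣ proj₂ y - proj₂ x ∣ < ε → height v w y ≤ c * cross v w)
      common [] _ = 1ℚ , ℚP.positive⁻¹ 1ℚ , λ ()
      common ((v , w) ∷ L) ⊆E with common L (⊆E ∘ there) | ball-below (normal v w) (<⇒0< (inside (⊆E (here refl))))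
      ... | ε₁ , 0<ε₁ , rest | ε₂ , 0<ε₂ , ball = ε₁ ⊓ ε₂ , minimum , λ
        { {y = y} (here refl) y₁ y₂ → ℚP.<⇒≤ (<-from
            (<⇒0< (ball {d = proj₁ y - proj₁ x , proj₂ y - proj₂ x} (ℚP.p⊓q≤q ε₁ ε₂) y₁ y₂))
            (trans (cong (λ t → c * cross v w - height v w x - t) (dot-sub x y (normal v w)))
              (solve 3 (λ k a b → k :- a :- (b :- a) := k :- b) refl (c * cross v w) (height v w x) (height v w y))))
        ; (there e) y₁ y₂ → rest e (ℚP.<-≤-trans y₁ (ℚP.p⊓q≤p ε₁ ε₂)) (ℚP.<-≤-trans y₂ (ℚP.p⊓q≤p ε₁ ε₂)) }
        where
        minimum : 0ℚ < ε₁ ⊓ ε₂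
        minimum with ℚP.≤-total ε₁ ε₂
        ... | inj₁ le = subst (0ℚ <_) (sym (ℚP.p≤q⇒p⊓q≡p le)) 0<ε₁
        ... | inj₂ le = subst (0ℚ <_) (sym (ℚP.p≥q⇒p⊓q≡q le)) 0<ε₂

  module _ {V : List ℚ²} (W⊆V : ∀ {x} → x ∈ W → x ∈ V) where
    private
      -- -p lies in the cone over some edge a b. Adding `cross a b` times p to the expansion of
      -- `cross a b` times -p in a and b gives zero with positive total weight.
      origin-weight : Σ ℚ λ s → 0ℚ < s × WeightedConv V s origin
      origin-weight with some-edge
      ... | p , w , e with sector (neg² p) (neg²-nonzero (nonzero (proj₁ (ed-mem e))))
      ... | a , b , e′ , ap , pb = cross (neg² p) b * 1ℚ + cross a (neg² p) * 1ℚ + cross a b * 1ℚ ,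
        pos+nonNeg (pos+nonNeg (scale⁺ pb) (scale⁺′ ap)) (ℚP.<⇒≤ (scale⁺ (ed-pos e′))) ,
        subst (WeightedConv V _) sum-zero
          (weighted-add (weighted-add (weighted-scale (ℚP.<⇒≤ pb) (weighted-point (W⊆V (proj₁ (ed-mem e′)))))
                                      (weighted-scale ap (weighted-point (W⊆V (proj₂ (ed-mem e′))))))
                        (weighted-scale (ℚP.<⇒≤ (ed-pos e′)) (weighted-point (W⊆V (proj₁ (ed-mem e))))))
        where
        scale⁺ : ∀ {t} → 0ℚ < t → 0ℚ < t * 1ℚ
        scale⁺ {t} = subst (0ℚ <_) (sym (ℚP.*-identityʳ t))
        scale⁺′ : ∀ {t} → 0ℚ ≤ t → 0ℚ ≤ t * 1ℚ
        scale⁺′ {t} = subst (0ℚ ≤_) (sym (ℚP.*-identityʳ t))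
        sum-zero : ((cross (neg² p) b ⊙ a) ⊕ (cross a (neg² p) ⊙ b)) ⊕ (cross a b ⊙ p) ≡ origin
        sum-zero = trans (cong (_⊕ (cross a b ⊙ p)) (sym (cross-expand a b (neg² p))))
          (cong₂ _,_ (cancel (cross a b) (proj₁ p)) (cancel (cross a b) (proj₂ p)))
          where
          cancel : ∀ s t → s * (- t) + s * t ≡ 0ℚ
          cancel = solve 2 (λ s t → s :* (:- t) :+ s :* t := con 0ℚ) refl

    origin∈Conv : Conv V origin
    origin∈Conv = let s , 0<s , ws = origin-weight in
      weighted-normalise 0<s (subst (WeightedConv V s) (sym (⊙-origin s)) ws)

    -- x is a combination of the ends of its edge, and the slack `D - (cross x w + cross v x)` is
    -- the weight left for the origin.
    In⇒Conv : ∀ {x} → In 1ℚ x → Conv V x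
    In⇒Conv {x} inside with x ≟² origin
    ... | yes refl = origin∈Conv
    ... | no x≢0 with sector x x≢0
    ... | v , w , e , vx , xw = weighted-normalise (ed-pos e) (subst₂ (WeightedConv V) weight point
      (weighted-add (weighted-add (weighted-scale (ℚP.<⇒≤ xw) (weighted-point (W⊆V (proj₁ (ed-mem e)))))
                                  (weighted-scale vx (weighted-point (W⊆V (proj₂ (ed-mem e))))))
                    (weighted-scale rest origin∈Conv)))
      where
      D = cross v w
      rest : 0ℚ ≤ D - (cross x w + cross v x)
      rest = ≤⇒0≤ (subst₂ _≤_ (dot-normal v w x) (ℚP.*-identityˡ D) (inside e))
      weight : cross x w * 1ℚ + cross v x * 1ℚ + (D - (cross x w + cross v x)) * 1ℚ ≡ D
      weight = solve 3 (λ a b D → a :* con 1ℚ :+ b :* con 1ℚ :+ (D :- (a :+ b)) :* con 1ℚ := D) refl (cross x w) (cross v x) D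
      point : ((cross x w ⊙ v) ⊕ (cross v x ⊙ w)) ⊕ ((D - (cross x w + cross v x)) ⊙ origin) ≡ D ⊙ x
      point = trans (cong₂ _⊕_ (sym (cross-expand v w x)) (⊙-origin (D - (cross x w + cross v x)))) (⊕-identityʳ _)

vertex-cong : ∀ {S T : Region} {v} → (∀ x → S x ⇔ T x) → Vertex S v → Vertex T v
vertex-cong S⇔T (v∈ , extreme) = to (S⇔T _) v∈ , λ a b t a∈ b∈ → extreme a b t (from (S⇔T a) a∈) (from (S⇔T b) b∈)

dot-combination : ∀ t a b n → dot ((t ⊙ a) ⊕ ((1ℚ - t) ⊙ b)) n ≡ t * dot a n + (1ℚ - t) * dot b n
dot-combination t a b n = trans (dot-⊕ (t ⊙ a) ((1ℚ - t) ⊙ b) n) (cong₂ _+_ (dot-⊙ t a n) (dot-⊙ (1ℚ - t) b n))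

dot-neg² : ∀ x n → dot x (neg² n) ≡ - dot x n
dot-neg² x n = trans (cong (dot x) (neg²-⊙ n)) (trans (dot-comm x _) (trans (dot-⊙ (- 1ℚ) n x)
  (trans (cong (- 1ℚ *_) (dot-comm n x)) (solve 1 (λ d → (:- con 1ℚ) :* d := :- d) refl (dot x n)))))
  where
  neg²-⊙ : ∀ n → neg² n ≡ (- 1ℚ) ⊙ n
  neg²-⊙ (a , b) = cong₂ _,_ (lem a) (lem b)
    where
    lem : ∀ a → - a ≡ - 1ℚ * a
    lem = solve 1 (λ a → :- a := (:- con 1ℚ) :* a) refl

neg-swap-≤ : ∀ {a b} → - a ≤ b → - b ≤ a
neg-swap-≤ {a} {b} le = ≤-from (≤⇒0≤ le) (solve 2 (λ a b → b :- (:- a) := a :- (:- b)) refl a b)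

ℕ→ℚ-pos : ∀ k → 0ℚ < ℕ→ℚ (suc k)
ℕ→ℚ-pos k = ℚP.positive⁻¹ (ℕ→ℚ (suc k)) {{ℚP.normalize-pos (suc k) 1}}

ℕ→ℚ-nonNeg : ∀ k → 0ℚ ≤ ℕ→ℚ k
ℕ→ℚ-nonNeg zero = ℚP.≤-refl
ℕ→ℚ-nonNeg (suc k) = ℚP.<⇒≤ (ℕ→ℚ-pos k)

-- The hull described by its edges: dilates, interior, vertices, supporting lines

module RegionOf {V W : List ℚ²} (poly : Polygon W) (W⊆V : ∀ {x} → x ∈ W → x ∈ V)
  (below : ∀ {n c} → 0ℚ ≤ c → Below W n c → Below V n c) where
  open Faces poly

  P : Region
  P = Conv V

  Conv⇔In : ∀ x → P x ⇔ In 1ℚ x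
  Conv⇔In x = mk⇔ (λ x∈ {v} {w} e → subst (height v w x ≤_) (sym (ℚP.*-identityˡ _))
      (conv-below (below (ℚP.<⇒≤ (ed-pos e)) (λ p∈ → vertex-height e p∈)) x∈))
    (In⇒Conv W⊆V)

  height≤ : ∀ {v w x} → IsEdge v w → P x → height v w x ≤ cross v w
  height≤ {v} {w} {x} e x∈ = subst (height v w x ≤_) (ℚP.*-identityˡ _) (to (Conv⇔In x) x∈ e)

  Dil⇔In : ∀ k x → Dil k P x ⇔ In (ℕ→ℚ k) x
  Dil⇔In k x = mk⇔ (λ { (y , y∈ , refl) {v} {w} e → subst (λ c → height v w (ℕ→ℚ k ⊙ y) ≤ c * cross v w)
        (ℚP.*-identityʳ (ℕ→ℚ k)) (In-⊙ {c = 1ℚ} {x = y} (ℕ→ℚ-nonNeg k) (to (Conv⇔In y) y∈) e) })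
    (undilate k)
    where
    undilate : ∀ k → In (ℕ→ℚ k) x → Dil k P x
    undilate zero inside = origin , origin∈Conv W⊆V , trans (In-zero inside) (sym (⊙-origin 0ℚ))
    undilate (suc k) inside = let r , 0<r , kr≡1 = reciprocal (ℕ→ℚ-pos k) in
      r ⊙ x , from (Conv⇔In (r ⊙ x)) (λ {v} {w} e → subst (λ c → height v w (r ⊙ x) ≤ c * cross v w)
        (trans (ℚP.*-comm r _) kr≡1) (In-⊙ {c = ℕ→ℚ (suc k)} {x = x} (ℚP.<⇒≤ 0<r) inside e)) ,
      sym (trans (⊙-assoc (ℕ→ℚ (suc k)) r x) (trans (cong (_⊙ x) kr≡1) (⊙-identity x)))

  Int-Dil⇔In< : ∀ k x → Int (Dil k P) x ⇔ In< (ℕ→ℚ k) x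
  Int-Dil⇔In< k = interior {c = ℕ→ℚ k} (Dil⇔In k)

  Int⇔In< : ∀ x → Int P x ⇔ In< 1ℚ x
  Int⇔In< = interior {c = 1ℚ} Conv⇔In

  surround-dot : ∀ n → n ≢ origin → Σ ℚ² λ p → P p × 0ℚ < dot p n
  surround-dot n n≢0 = let p , p∈ , pos = surround (turn n) (λ e → n≢0 (cong₂ _,_ (ℚP.neg-injective (trans (cong proj₂ e) refl)) (cong proj₁ e))) in
    p , weighted-point (W⊆V p∈) , subst (0ℚ <_) (trans (sym (dot-rot (turn n) p)) (cong (dot p) (rot-turn n))) pos
    where
    turn : ℚ² → ℚ²
    turn (a , b) = b , - a
    rot-turn : ∀ n → rot (turn n) ≡ n
    rot-turn (a , b) = cong₂ _,_ (solve 1 (λ a → :- (:- a) := a) refl a) refl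

  private
    edge-tight : ∀ {v w x a b t} → IsEdge v w → height v w x ≡ cross v w → P a → P b → 0ℚ < t → t < 1ℚ →
      x ≡ (t ⊙ a) ⊕ ((1ℚ - t) ⊙ b) → height v w a ≡ cross v w × height v w b ≡ cross v w
    edge-tight {v} {w} {x} {a} {b} {t} e tight a∈ b∈ 0<t t<1 x≡ = convex-equality 0<t t<1 (height≤ e a∈) (height≤ e b∈)
      (trans (sym tight) (trans (cong (height v w) x≡) (dot-combination t a b (normal v w))))

  -- A segment in P with v in its relative interior stays on the lines of both edges at v, and their
  -- normals are independent because `strict` makes the boundary turn at v.
  generator-vertex : ∀ {v} → v ∈ W → Vertex P v
  generator-vertex {v} v∈ with ed-from v∈ | ed-to v∈
  ... | w , e | p , e′ = weighted-point (W⊆V v∈) , λ a b t a∈ b∈ 0<t t<1 v≡ →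
    let a₁ , b₁ = edge-tight e′ (height-head p v) a∈ b∈ 0<t t<1 v≡
        a₂ , b₂ = edge-tight e (height-tail v w) a∈ b∈ 0<t t<1 v≡
    in dot-separates a b turning (trans a₁ (sym b₁)) (trans a₂ (sym b₂))
    where
    w≢p : w ≢ p
    w≢p refl = pos⇒¬nonNeg (ed-pos e) (ℚP.<⇒≤ (ed-pos e′))
    w≢v : w ≢ v
    w≢v refl = ℚP.<-irrefl (sym (alternating w)) (ed-pos e)
    turning : 0ℚ < cross (normal p v) (normal v w)
    turning = subst (0ℚ <_) (sym (cross-normal p v w)) (<⇒0< (strict e′ (proj₂ (ed-mem e)) w≢p w≢v))

  -- P is also the hull of W, since both equal `In 1ℚ`.
  vertex-in-W : ∀ {v} → Vertex P v → v ∈ W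
  vertex-in-W vert = vertex-generator (vertex-cong (λ x → mk⇔ (λ x∈ → In⇒Conv (λ x∈ → x∈) (to (Conv⇔In x) x∈))
    (λ x∈ → from (Conv⇔In x) (λ {v} {w} e → subst (height v w x ≤_)
        (sym (ℚP.*-identityˡ _)) (conv-below (vertex-height e) x∈)))) vert)

  edge-is-Edge : ∀ {v w} → IsEdge v w → Edge P v w
  edge-is-Edge {v} {w} e = generator-vertex (proj₁ (ed-mem e)) , generator-vertex (proj₂ (ed-mem e)) , v≢w ,
    -- `Edge` asks for a minimum over P, hence the outer normal with reversed sign.
    neg² N , - cross v w , neg²-nonzero N≢0 , side (height-tail v w) , side (height-head v w) ,
    λ x x∈ → subst (- cross v w ≤_) (trans (sym (dot-neg² x N)) (dot≡⟨⟩ x (neg² N))) (ℚP.neg-antimono-≤ (height≤ e x∈))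
    where
    N = normal v w
    v≢w : v ≢ w
    v≢w refl = ℚP.<-irrefl (sym (alternating v)) (ed-pos e)
    N≢0 : N ≢ origin
    N≢0 e′ = ℚP.<-irrefl (trans (sym (dot-origin v)) (trans (dot-comm origin v) (trans (cong (dot v)
        (sym e′)) (height-tail v w)))) (ed-pos e)
    side : ∀ {x} → height v w x ≡ cross v w → ⟨ x , neg² N ⟩ ≡ - cross v w
    side {x} h = trans (sym (dot≡⟨⟩ x (neg² N))) (trans (dot-neg² x N) (cong -_ h))

  module EdgeOf {v w} (edge : Edge P v w) where
    private
      n = proj₁ (proj₂ (proj₂ (proj₂ edge)))
      c = proj₁ (proj₂ (proj₂ (proj₂ (proj₂ edge))))
      rest = proj₂ (proj₂ (proj₂ (proj₂ (proj₂ edge))))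
      v∈ = proj₁ (proj₁ edge)
      w∈ = proj₁ (proj₁ (proj₂ edge))
      v≢w = proj₁ (proj₂ (proj₂ edge))
      vn : dot v n ≡ c
      vn = trans (dot≡⟨⟩ v n) (proj₁ (proj₂ rest))
      wn : dot w n ≡ c
      wn = trans (dot≡⟨⟩ w n) (proj₁ (proj₂ (proj₂ rest)))
      support : ∀ {x} → P x → c ≤ dot x n
      support {x} x∈ = subst (c ≤_) (sym (dot≡⟨⟩ x n)) (proj₂ (proj₂ (proj₂ rest)) x x∈)

    c<0 : c < 0ℚ
    c<0 = let p , p∈ , pos = surround-dot (neg² n) (neg²-nonzero (proj₁ rest)) in
      ℚP.≤-<-trans (support p∈) (<-from {b = 0ℚ} (subst (0ℚ <_) (dot-neg² p n) pos)
          (solve 1 (λ d → :- d := con 0ℚ :- d) refl (dot p n)))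

    -- By Cramer m is a combination of the ends of the edge whose cone contains it. Both ends have
    -- value at least c, and c is negative, so the coefficients sum to at least one; as m is in P,
    -- it lies on the line of that edge.
    touched-edge : ∀ {m} → P m → dot m n ≡ c →
      Σ ℚ² λ v′ → Σ ℚ² λ w′ → IsEdge v′ w′ × height v′ w′ m ≡ cross v′ w′
    touched-edge {m} m∈ mn = touch (sector m m≢0)
      where
      m≢0 : m ≢ origin
      m≢0 e = ℚP.<-irrefl (trans (sym mn) (trans (cong (λ x → dot x n) e) (dot-origin n))) c<0
      touch : (Σ ℚ² λ v → Σ ℚ² λ w → IsEdge v w × 0ℚ ≤ cross v m × 0ℚ < cross m w) →
        Σ ℚ² λ v′ → Σ ℚ² λ w′ → IsEdge v′ w′ × height v′ w′ m ≡ cross v′ w′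
      touch (v′ , w′ , e , vm , mw) = v′ , w′ , e , ℚP.≤-antisym (height≤ e m∈) D≤h
        where
        D = cross v′ w′
        h = height v′ w′ m
        weights : D * c ≡ cross m w′ * dot v′ n + cross v′ m * dot w′ n
        weights = trans (cong (D *_) (sym mn)) (cramer v′ w′ m n)
        ge : (cross m w′ + cross v′ m) * c ≤ D * c
        ge = subst₂ _≤_ (sym (ℚP.*-distribʳ-+ c (cross m w′) (cross v′ m))) (sym weights)
          (ℚP.+-mono-≤ (ℚP.*-monoˡ-≤-nonNeg (cross m w′) {{nonNegative (ℚP.<⇒≤ mw)}} (support (weighted-point (W⊆V (proj₁
              (ed-mem e))))))
                       (ℚP.*-monoˡ-≤-nonNeg (cross v′ m) {{nonNegative vm}} (support (weighted-point (W⊆V (proj₂ (ed-mem e)))))))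
        D≤h : D ≤ h
        D≤h = subst (D ≤_) (sym (dot-normal v′ w′ m)) (0≤⇒≤ (nonNeg-cancel (ℚP.neg-antimono-< c<0) (subst (0ℚ ≤_)
          (solve 3 (λ s D c → D :* c :- s :* c := (:- c) :* (s :- D)) refl (cross m w′ + cross v′ m) D c) (≤⇒0≤ ge))))

    -- The ray through the midpoint of v and w hits an edge, which contains both.
    supporting-edge : Σ ℚ² λ v′ → Σ ℚ² λ w′ → IsEdge v′ w′ × height v′ w′ v ≡ cross v′ w′ × height v′ w′ w ≡ cross v′ w′
    supporting-edge = let v′ , w′ , e , tight = touched-edge m∈ mn in
      v′ , w′ , e , edge-tight e tight v∈ w∈ half-pos half<1 refl
      where
      half = ℤ.+ 1 / 2
      m = (half ⊙ v) ⊕ ((1ℚ - half) ⊙ w)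
      half-pos : 0ℚ < half
      half-pos = ℚP.positive⁻¹ half
      half<1 : half < 1ℚ
      half<1 = 0<⇒< (ℚP.positive⁻¹ (1ℚ - half))
      m∈ : P m
      m∈ = weighted-add (weighted-scale (ℚP.<⇒≤ half-pos) v∈) (weighted-scale (ℚP.<⇒≤ (<⇒0< half<1)) w∈)
      mn : dot m n ≡ c
      mn = trans (dot-combination half v w n) (trans (cong₂ (λ s t → half * s + (1ℚ - half) * t) vn wn)
        (solve 2 (λ h c → h :* c :+ (con 1ℚ :- h) :* c := c) refl half c))

    -- y is the supporting normal scaled to the value -1 on the edge. It is extreme because the
    -- constraints of v and w are tight at y, and v and w are independent: parallel points of this
    -- line would coincide.
    dual-vertex : Σ ℚ² λ y → Vertex (Dual P) y × dot v y ≡ - 1ℚ × dot w y ≡ - 1ℚ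
    dual-vertex = scale-normal (reciprocal (ℚP.neg-antimono-< c<0))
     where
     scale-normal : (Σ ℚ λ k → 0ℚ < k × - c * k ≡ 1ℚ) → Σ ℚ² λ y → Vertex (Dual P) y × dot v y ≡ - 1ℚ × dot w y ≡ - 1ℚ
     scale-normal (k , 0<k , ck≡1) = y , (y∈ , extreme) , at v vn , at w wn
      where
      y = k ⊙ n
      kc : k * c ≡ - 1ℚ
      kc = trans (solve 2 (λ k c → k :* c := :- ((:- c) :* k)) refl k c) (cong -_ ck≡1)
      dot-y : ∀ x → dot x y ≡ k * dot x n
      dot-y x = trans (dot-comm x y) (trans (dot-⊙ k n x) (cong (k *_) (dot-comm n x)))
      at : ∀ x → dot x n ≡ c → dot x y ≡ - 1ℚ
      at x xn = trans (dot-y x) (trans (cong (k *_) xn) kc)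
      y∈ : Dual P y
      y∈ x x∈ = subst₂ _≤_ kc (trans (sym (dot-y x)) (trans (dot-comm x y) (dot≡⟨⟩ y x)))
        (ℚP.*-monoˡ-≤-nonNeg k {{nonNegative (ℚP.<⇒≤ 0<k)}} (support x∈))
      tight : ∀ {x a b t} → P x → dot x y ≡ - 1ℚ → Dual P a → Dual P b → 0ℚ < t → t < 1ℚ →
        y ≡ (t ⊙ a) ⊕ ((1ℚ - t) ⊙ b) → dot a x ≡ dot b x
      tight {x} {a} {b} {t} x∈ xy a∈ b∈ 0<t t<1 y≡ = ℚP.neg-injective
        (trans (proj₁ both) (sym (proj₂ both)))
        where
        both : - dot a x ≡ 1ℚ × - dot b x ≡ 1ℚ
        both = convex-equality 0<t t<1 (neg-swap-≤ (subst (- 1ℚ ≤_) (sym (dot≡⟨⟩ a x)) (a∈ x x∈)))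
          (neg-swap-≤ (subst (- 1ℚ ≤_) (sym (dot≡⟨⟩ b x)) (b∈ x x∈)))
          (trans (cong -_ (sym (trans (trans (sym (dot-combination t a b x)) (cong (λ z → dot z x) (sym y≡)))
              (trans (dot-comm y x) xy))))
            (solve 3 (λ t a b → :- (t :* a :+ (con 1ℚ :- t) :* b) :=
                t :* (:- a) :+ (con 1ℚ :- t) :* (:- b)) refl t (dot a x) (dot b x)))
      v≡w-if-parallel : cross v w ≡ 0ℚ → v ≡ w
      v≡w-if-parallel vw = trans (sym (unscale v)) (trans (cong ((- k) ⊙_) (equal-dots {v} {w} {n} {c} vn wn vw)) (unscale w))
        where
        unscale : ∀ x → (- k) ⊙ (c ⊙ x) ≡ x
        unscale x = trans (⊙-assoc (- k) c x) (trans (cong (_⊙ x)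
          (trans (solve 2 (λ k c → (:- k) :* c := (:- c) :* k) refl k c) ck≡1)) (⊙-identity x))
      extreme : ∀ a b t → Dual P a → Dual P b → 0ℚ < t → t < 1ℚ → y ≡ (t ⊙ a) ⊕ ((1ℚ - t) ⊙ b) → a ≡ b
      extreme a b t a∈ b∈ 0<t t<1 y≡ with ℚP.<-cmp 0ℚ (cross v w)
      ... | tri≈ _ vw _ = ⊥-elim (v≢w (v≡w-if-parallel (sym vw)))
      ... | tri< vw _ _ = dot-separates {v} {w} a b vw (tight v∈ (at v vn) a∈ b∈ 0<t t<1 y≡) (tight w∈ (at w wn) a∈ b∈ 0<t t<1 y≡)
      ... | tri> _ _ vw = dot-separates {w} {v} a b (neg⇒pos vw) (tight w∈ (at w wn) a∈ b∈ 0<t t<1 y≡) (tight v∈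
          (at v vn) a∈ b∈ 0<t t<1 y≡)

-- Cardinalities of finite sets and lattice points in an interval

private
  variable
    X Y Ix : Set

-- The cardinality is an integer because the counts arise as differences of ceilings.
Card : (X → Set) → ℤ → Set
Card S i = Σ (List _) λ zs → (+ length zs ≡ i) × Unique zs × (∀ z → z ∈ zs ⇔ S z)

unique-length : {xs ys : List X} → Unique xs → (∀ {x} → x ∈ xs → x ∈ ys) → length xs ℕ.≤ length ys
unique-length {xs = []} _ _ = ℕ.z≤n
unique-length {xs = x ∷ xs} (x∉ ∷ unique) xs⊆ys with ∈-∃++ (xs⊆ys (here refl))
... | as , bs , refl = subst (suc (length xs) ℕ.≤_)
  (trans (cong suc (length-++ as)) (trans (sym (ℕP.+-suc (length as) (length bs))) (sym (length-++ as))))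
  (ℕ.s≤s (unique-length unique shrink))
  where
  shrink : ∀ {y} → y ∈ xs → y ∈ as ++ bs
  shrink y∈ with ∈-++⁻ as (xs⊆ys (there y∈))
  ... | inj₁ y∈as = ∈-++⁺ˡ y∈as
  ... | inj₂ (here refl) = ⊥-elim (All.lookup x∉ y∈ refl)
  ... | inj₂ (there y∈bs) = ∈-++⁺ʳ as y∈bs

card-unique : {S : X → Set} {i j : ℤ} → Card S i → Card S j → i ≡ j
card-unique (xs , refl , ux , mx) (ys , refl , uy , my) = cong +_ (ℕP.≤-antisym
  (unique-length ux (λ {x} x∈ → from (my x) (to (mx x) x∈)))
  (unique-length uy (λ {y} y∈ → from (mx y) (to (my y) y∈))))

card-cong : {S T : X → Set} {i : ℤ} → (∀ z → S z ⇔ T z) → Card S i → Card T i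
card-cong S⇔T (zs , len , unique , mem) = zs , len , unique ,
  λ z → mk⇔ (λ z∈ → to (S⇔T z) (to (mem z) z∈)) (λ t → from (mem z) (from (S⇔T z) t))

card-empty : {S : X → Set} → (∀ z → ¬ S z) → Card S 0ℤ
card-empty none = [] , refl , [] , λ z → mk⇔ (λ ()) (λ s → ⊥-elim (none z s))

card-singleton : (a : X) → Card (_≡ a) 1ℤ
card-singleton a = a ∷ [] , refl , [] ∷ [] , λ z → mk⇔ (λ { (here e) → e ; (there ()) }) here

card-∪ : {S T : X → Set} {i j : ℤ} → (∀ z → S z → ¬ T z) → Card S i → Card T j → Card (λ z → S z ⊎ T z) (i ℤ.+ j)
card-∪ disjoint (xs , refl , ux , mx) (ys , refl , uy , my) = xs ++ ys ,
  trans (cong +_ (length-++ xs)) (ℤP.pos-+ (length xs) (length ys)) ,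
  UniqueP.++⁺ ux uy (λ { (x∈ , y∈) → disjoint _ (to (mx _) x∈) (to (my _) y∈) }) ,
  λ z → mk⇔ (λ z∈ → [ inj₁ ∘ to (mx z) , inj₂ ∘ to (my z) ]′ (∈-++⁻ xs z∈))
            [ ∈-++⁺ˡ ∘ from (mx z) , ∈-++⁺ʳ xs ∘ from (my z) ]′

card-map : {S : X → Set} {i : ℤ} (f : X → Y) → (∀ {x y} → f x ≡ f y → x ≡ y) → Card S i →
  Card (λ z → Σ X λ x → S x × z ≡ f x) i
card-map f injective (xs , refl , unique , mem) = map f xs , cong +_ (length-map f xs) , UniqueP.map⁺ injective unique ,
  λ z → mk⇔ (λ z∈ → let x , x∈ , e = ∈-map⁻ f z∈ in x , to (mem x) x∈ , e)
            (λ { (x , s , refl) → ∈-map⁺ f (from (mem x) s) })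

card-interval : ∀ {lo hi} → lo ℤ.≤ hi → Card (λ k → lo ℤ.≤ k × k ℤ.< hi) (hi ℤ.- lo)
card-interval {lo} {hi} lo≤hi = card-cong members
  (card-map (λ i → lo ℤ.+ + i) (λ {x} {y} e → ℤP.+-injective (∙-cancelˡ lo (+ x) (+ y) e))
    (upTo n , trans (cong +_ (length-upTo n)) +n≡ , UniqueP.upTo⁺ n , λ i → mk⇔ ∈-upTo⁻ ∈-upTo⁺))
  where
  n = ℤ.∣ hi ℤ.- lo ∣
  +n≡ : + n ≡ hi ℤ.- lo
  +n≡ = ℤP.0≤i⇒+∣i∣≡i (ℤP.i≤j⇒0≤j-i lo≤hi)
  cancel : ∀ a b → a ℤ.+ (b ℤ.- a) ≡ b
  cancel = S.solve 2 (λ a b → a S.:+ (b S.:- a) S.:= b) refl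
  members : ∀ z → (Σ ℕ λ i → i ℕ.< n × z ≡ lo ℤ.+ + i) ⇔ (lo ℤ.≤ z × z ℤ.< hi)
  members z = mk⇔
    (λ { (i , i<n , refl) → ℤP.i≤i+j lo (+ i) , subst (lo ℤ.+ + i ℤ.<_) (trans (cong (λ t → lo ℤ.+ t) +n≡) (cancel lo hi))
      (ℤP.+-monoʳ-< lo (ℤ.+<+ i<n)) })
    (λ { (lo≤z , z<hi) → let +i≡ = ℤP.0≤i⇒+∣i∣≡i (ℤP.i≤j⇒0≤j-i lo≤z) in
      ℤ.∣ z ℤ.- lo ∣ , ℤP.drop‿+<+ (subst₂ ℤ._<_ (sym +i≡) (sym +n≡) (ℤP.+-monoˡ-< (ℤ.- lo) z<hi)) ,
      sym (trans (cong (λ t → lo ℤ.+ t) +i≡) (cancel lo z)) })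

sumTo : ℕ → (ℕ → ℤ) → ℤ
sumTo zero f = 0ℤ
sumTo (suc n) f = sumTo n f ℤ.+ f n

card-slices : (lo hi : ℕ → ℤ) → (∀ j → lo j ℤ.≤ hi j) → ∀ M →
  Card (λ p → proj₁ p ℕ.< M × lo (proj₁ p) ℤ.≤ proj₂ p × proj₂ p ℤ.< hi (proj₁ p)) (sumTo M (λ j → hi j ℤ.- lo j))
card-slices lo hi lo≤hi zero = card-empty λ { _ (() , _) }
card-slices lo hi lo≤hi (suc M) = card-cong members
  (card-∪ (λ { (j , k) (j<M , _) (_ , _ , e) → ℕP.<-irrefl (cong proj₁ e) j<M })
    (card-slices lo hi lo≤hi M) (card-map (M ,_) (cong proj₂) (card-interval (lo≤hi M))))
  where
  members : ∀ p → _ ⇔ (proj₁ p ℕ.< suc M × lo (proj₁ p) ℤ.≤ proj₂ p × proj₂ p ℤ.< hi (proj₁ p))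
  members (j , k) = mk⇔
    (λ { (inj₁ (j<M , r)) → ℕP.m≤n⇒m≤1+n j<M , r ; (inj₂ (_ , r , refl)) → ℕP.n<1+n j , r })
    split
    where
    split : j ℕ.< suc M × lo j ℤ.≤ k × k ℤ.< hi j → _
    split (j<1+M , r) with j ℕ.≟ M
    ... | yes refl = inj₂ (k , r , refl)
    ... | no j≢M = inj₁ (ℕP.≤∧≢⇒< (ℕP.≤-pred j<1+M) j≢M , r)

sumOver : (Ix → ℤ) → List Ix → ℤ
sumOver f [] = 0ℤ
sumOver f (i ∷ L) = f i ℤ.+ sumOver f L

card-⋃ : {S : Ix → X → Set} {f : Ix → ℤ} (L : List Ix) → (∀ {i} → i ∈ L → Card (S i) (f i)) →
  AllPairs (λ i j → ∀ z → S i z → ¬ S j z) L → Card (λ z → Any (λ i → S i z) L) (sumOver f L)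
card-⋃ [] _ _ = card-empty λ _ ()
card-⋃ {S = S} (i ∷ L) cards (apart ∷ disjoint) = card-cong
  (λ z → mk⇔ [ here , there ]′ (λ { (here s) → inj₁ s ; (there r) → inj₂ r }))
  (card-∪ (λ z s r → conflict apart z s r) (cards (here refl)) (card-⋃ L (cards ∘ there) disjoint))
  where
  conflict : ∀ {L} → All (λ j → ∀ z → S i z → ¬ S j z) L → ∀ z → S i z → ¬ Any (λ j → S j z) L
  conflict (a ∷ _) z s (here t) = a z s t
  conflict (_ ∷ as) z s (there r) = conflict as z s r

hasCard⇒card : ∀ {S n} → HasCard S n → Card S (+ n)
hasCard⇒card (zs , len , rest) = zs , cong +_ len , rest

card⇒hasCard : ∀ {S i} → Card S i → Σ ℕ λ n → HasCard S n × + n ≡ i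
card⇒hasCard (zs , len , rest) = length zs , (zs , refl , rest) , len

opaque
  -- ⌈a / H⌉ as -⌊-a / H⌋. All that is used of it is that it is the least k with a ≤ k H.
  ceil : ℤ → (H : ℕ) .{{_ : ℕ.NonZero H}} → ℤ
  ceil a H = ℤ.- ((ℤ.- a) /ℕ H)

module _ {a : ℤ} {H : ℕ} .{{_ : ℕ.NonZero H}} where
  private
    q = (ℤ.- a) /ℕ H
    0<H : 0ℤ ℤ.< + H
    0<H = ℤ.+<+ (ℕP.n≢0⇒n>0 (ℕ.≢-nonZero⁻¹ H))
    instance
      +H-pos : ℤ.Positive (+ H)
      +H-pos = ℤ.positive 0<H

  opaque
    unfolding ceil

    ceil-upper : a ℤ.≤ ceil a H ℤ.* + H
    ceil-upper = subst₂ ℤ._≤_ (ℤP.neg-involutive a) (ℤP.neg-distribˡ-* q (+ H)) (ℤP.neg-mono-≤ ([n/ℕd]*d≤n (ℤ.- a) H))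

    ceil-least : ∀ {k} → a ℤ.≤ k ℤ.* + H → ceil a H ℤ.≤ k
    ceil-least {k} a≤ = subst (ceil a H ℤ.≤_) (ℤP.neg-involutive k) (ℤP.neg-mono-≤ -k≤q)
      where
      -k<1+q : ℤ.- k ℤ.< ℤ.suc q
      -k<1+q = ℤP.*-cancelʳ-<-nonNeg (+ H) (ℤP.≤-<-trans (subst (ℤ._≤ ℤ.- a) (ℤP.neg-distribˡ-* k (+ H)) (ℤP.neg-mono-≤ a≤))
        (n<s[n/ℕd]*d (ℤ.- a) H))
      -k≤q : ℤ.- k ℤ.≤ q
      -k≤q = subst (ℤ.- k ℤ.≤_) (ℤP.pred-suc q) (ℤP.i<j⇒i≤pred[j] -k<1+q)

  ceil-galois : ∀ k → a ℤ.≤ k ℤ.* + H ⇔ ceil a H ℤ.≤ k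
  ceil-galois k = mk⇔ ceil-least (λ c≤k → ℤP.≤-trans ceil-upper (ℤP.*-monoʳ-≤-nonNeg (+ H) c≤k))

-- Integer coordinates

opaque
  unfolding cross dot

  ι : ℤ → ℚ
  ι a = a / 1

  embed : ℤ² → ℚ²
  embed = emb

  embed≡emb : ∀ z → embed z ≡ emb z
  embed≡emb _ = refl

  private
    reduced : ∀ a → a / 1 ≡ ℚ.mkℚ a 0 (coprime-sym (1-coprimeTo ℤ.∣ a ∣))
    reduced a = ℚP.↥p/↧p≡p (ℚ.mkℚ a 0 (coprime-sym (1-coprimeTo ℤ.∣ a ∣)))

  ι-+ : ∀ a b → ι (a ℤ.+ b) ≡ ι a + ι b
  ι-+ a b = sym (trans (cong₂ _+_ (reduced a) (reduced b)) (cong₂ (λ s t → (s ℤ.+ t) / 1) (ℤP.*-identityʳ a) (ℤP.*-identityʳ b)))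

  ι-* : ∀ a b → ι (a ℤ.* b) ≡ ι a * ι b
  ι-* a b = sym (cong₂ _*_ (reduced a) (reduced b))

  ι-neg : ∀ a → ι (ℤ.- a) ≡ - ι a
  ι-neg a = trans (solve 2 (λ x y → x := (x :+ y) :- y) refl (ι (ℤ.- a)) (ι a))
    (trans (cong (_- ι a) (trans (sym (ι-+ (ℤ.- a) a)) (cong ι (ℤP.+-inverseˡ a)))) (ℚP.+-identityˡ (- ι a)))

  ι-mono-≤ : ∀ {a b} → a ℤ.≤ b → ι a ≤ ι b
  ι-mono-≤ {a} {b} a≤b = subst₂ _≤_ (sym (reduced a)) (sym (reduced b))
    (ℚ.*≤* (subst₂ ℤ._≤_ (sym (ℤP.*-identityʳ a)) (sym (ℤP.*-identityʳ b)) a≤b))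

  ι-cancel-≤ : ∀ {a b} → ι a ≤ ι b → a ℤ.≤ b
  ι-cancel-≤ {a} {b} a≤b = subst₂ ℤ._≤_ (ℤP.*-identityʳ a) (ℤP.*-identityʳ b)
    (ℚP.drop-*≤* (subst₂ _≤_ (reduced a) (reduced b) a≤b))

  ι-mono-< : ∀ {a b} → a ℤ.< b → ι a < ι b
  ι-mono-< {a} {b} a<b = subst₂ _<_ (sym (reduced a)) (sym (reduced b))
    (ℚ.*<* (subst₂ ℤ._<_ (sym (ℤP.*-identityʳ a)) (sym (ℤP.*-identityʳ b)) a<b))

  ι-cancel-< : ∀ {a b} → ι a < ι b → a ℤ.< b
  ι-cancel-< {a} {b} a<b = subst₂ ℤ._<_ (ℤP.*-identityʳ a) (ℤP.*-identityʳ b)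
    (ℚP.drop-*<* (subst₂ _<_ (reduced a) (reduced b) a<b))

  ι0 : ι 0ℤ ≡ 0ℚ
  ι0 = refl

  ι1 : ι 1ℤ ≡ 1ℚ
  ι1 = refl

  dt : ℤ² → ℤ² → ℤ
  dt (a , b) (c , d) = a ℤ.* d ℤ.- b ℤ.* c

  comb : ℤ → ℤ² → ℤ → ℤ² → ℤ²
  comb p (a , b) q (c , d) = p ℤ.* a ℤ.+ q ℤ.* c , p ℤ.* b ℤ.+ q ℤ.* d

  embed-origin : embed (0ℤ , 0ℤ) ≡ origin
  embed-origin = refl

  embed-injective : ∀ {x y} → embed x ≡ embed y → x ≡ y
  embed-injective {a , b} {c , d} e = cong₂ _,_ (inj (cong proj₁ e)) (inj (cong proj₂ e))
    where
    inj : ∀ {a c} → ι a ≡ ι c → a ≡ c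
    inj e = ℤP.≤-antisym (ι-cancel-≤ (ℚP.≤-reflexive e)) (ι-cancel-≤ (ℚP.≤-reflexive (sym e)))

  cross-embed : ∀ x y → cross (embed x) (embed y) ≡ ι (dt x y)
  cross-embed (a , b) (c , d) = sym (trans (ι-+ (a ℤ.* d) (ℤ.- (b ℤ.* c)))
    (cong₂ _+_ (ι-* a d) (trans (ι-neg (b ℤ.* c)) (cong -_ (ι-* b c)))))

  normalℤ : ℤ² → ℤ²
  normalℤ (a , b) = b , ℤ.- a

  dot-normalℤ : ∀ x y → dot (embed x) (embed (normalℤ y)) ≡ ι (dt x y)
  dot-normalℤ (a , b) (c , d) = sym (trans (ι-+ (a ℤ.* d) (ℤ.- (b ℤ.* c)))
    (cong₂ _+_ (ι-* a d) (trans (cong ι (ℤP.neg-distribʳ-* b c)) (ι-* b (ℤ.- c)))))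

  dt-combˡ : ∀ p x q y z → dt (comb p x q y) z ≡ p ℤ.* dt x z ℤ.+ q ℤ.* dt y z
  dt-combˡ p (a , b) q (c , d) (e , f) = S.solve 8 (λ p a b q c d e f →
    (p S.:* a S.:+ q S.:* c) S.:* f S.:- (p S.:* b S.:+ q S.:* d) S.:* e S.:=
    p S.:* (a S.:* f S.:- b S.:* e) S.:+ q S.:* (c S.:* f S.:- d S.:* e)) refl p a b q c d e f

  dt-anti : ∀ x y → dt x y ≡ ℤ.- dt y x
  dt-anti (a , b) (c , d) = S.solve 4 (λ a b c d → a S.:* d S.:- b S.:* c S.:= S.:- (c S.:* b S.:- d S.:* a)) refl a b c d

  dt-self : ∀ x → dt x x ≡ 0ℤ
  dt-self (a , b) = S.solve 2 (λ a b → a S.:* b S.:- b S.:* a S.:= S.con 0ℤ) refl a b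

  coordinates : ∀ {c d} z → dt c d ≡ 1ℤ → z ≡ comb (dt z d) c (dt c z) d
  coordinates {c₁ , c₂} {d₁ , d₂} (x , y) unit = cong₂ _,_
    (trans (sym (ℤP.*-identityˡ x)) (trans (cong (ℤ._* x) (sym unit)) (S.solve 6 (λ c₁ c₂ d₁ d₂ x y →
      (c₁ S.:* d₂ S.:- c₂ S.:* d₁) S.:* x S.:= (x S.:* d₂ S.:- y S.:* d₁) S.:* c₁ S.:+ (c₁ S.:* y S.:- c₂ S.:* x) S.:* d₁)
      refl c₁ c₂ d₁ d₂ x y)))
    (trans (sym (ℤP.*-identityˡ y)) (trans (cong (ℤ._* y) (sym unit)) (S.solve 6 (λ c₁ c₂ d₁ d₂ x y →
      (c₁ S.:* d₂ S.:- c₂ S.:* d₁) S.:* y S.:= (x S.:* d₂ S.:- y S.:* d₁) S.:* c₂ S.:+ (c₁ S.:* y S.:- c₂ S.:* x) S.:* d₂)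
      refl c₁ c₂ d₁ d₂ x y)))

  -- A common divisor of the coordinates of d divides dt c d.
  unit⇒primitive : ∀ {c d} → dt c d ≡ 1ℤ → PrimitiveVec (normalℤ d)
  unit⇒primitive {c₁ , c₂} {d₁ , d₂} unit = ℕD.∣1⇒≡1 (subst (g ℕD.∣_) (cong ℤ.∣_∣ unit) (ℤD.∣⇒∣ᵤ
    (ℤD.∣m∣n⇒∣m-n {+ g} {c₁ ℤ.* d₂} {c₂ ℤ.* d₁}
      (ℤD.∣n⇒∣m*n c₁ (ℤD.∣ᵤ⇒∣ {+ g} {d₂} (ℕG.gcd[m,n]∣m ℤ.∣ d₂ ∣ ℤ.∣ ℤ.- d₁ ∣)))
      (ℤD.∣n⇒∣m*n c₂ (ℤD.∣ᵤ⇒∣ {+ g} {d₁} (subst (g ℕD.∣_) (ℤP.∣-i∣≡∣i∣ d₁) (ℕG.gcd[m,n]∣n ℤ.∣ d₂ ∣ ℤ.∣ ℤ.- d₁ ∣)))))))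
    where
    g : ℕ
    g = ℕG.gcd ℤ.∣ d₂ ∣ ℤ.∣ ℤ.- d₁ ∣

  private
    sign-of : ∀ i → Σ ℤ λ s → s ℤ.* s ≡ 1ℤ × s ℤ.* i ≡ + ℤ.∣ i ∣
    sign-of (+ n) = 1ℤ , refl , ℤP.*-identityˡ (+ n)
    sign-of i@(ℤ.-[1+ n ]) = ℤ.- 1ℤ , refl , ℤP.-1*i≡-i i

    bezout : ∀ m n → Σ ℤ λ x → Σ ℤ λ y → x ℤ.* + m ℤ.+ y ℤ.* + n ≡ + ℕG.gcd m n
    bezout m n with ℕG.Bézout.identity (ℕG.gcd-GCD m n)
    ... | ℕG.Bézout.+- x y eq = + x , ℤ.- + y , trans (cong (ℤ._+ (ℤ.- + y) ℤ.* + n)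
        (trans (sym (ℤP.pos-* x m)) (trans (cong +_ (sym eq)) (trans (ℤP.pos-+ _ (y ℕ.* n))
            (cong (λ t → + ℕG.gcd m n ℤ.+ t) (ℤP.pos-* y n))))))
        (S.solve 3 (λ g y n → (g S.:+ y S.:* n) S.:+ (S.:- y) S.:* n S.:= g) refl (+ ℕG.gcd m n) (+ y) (+ n))
    ... | ℕG.Bézout.-+ x y eq = ℤ.- + x , + y , trans (cong (λ t → (ℤ.- + x) ℤ.* + m ℤ.+ t)
        (trans (sym (ℤP.pos-* y n)) (trans (cong +_ (sym eq)) (trans (ℤP.pos-+ _ (x ℕ.* m))
            (cong (λ t → + ℕG.gcd m n ℤ.+ t) (ℤP.pos-* x m))))))
        (S.solve 3 (λ g x m → (S.:- x) S.:* m S.:+ (g S.:+ x S.:* m) S.:= g) refl (+ ℕG.gcd m n) (+ x) (+ m))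

    divided : ∀ {g} i → g ℕD.∣ ℤ.∣ i ∣ → Σ ℤ λ q → i ≡ q ℤ.* + g
    divided {g} i g∣i with ℤD.∣ᵤ⇒∣ {+ g} {i} g∣i
    ... | ℤD.divides q e = q , e

  -- L is the gcd of the coordinates of ŵ - v̂ and d the quotient; c consists of Bézout coefficients
  -- for the absolute values, with the signs s₁ and s₂ put back.
  primitive-step : ∀ v̂ ŵ → v̂ ≢ ŵ → Σ ℕ λ L → Σ ℤ² λ c → Σ ℤ² λ d →
    L ≢ 0 × dt c d ≡ 1ℤ × ŵ ≡ comb 1ℤ v̂ (+ L) d
  primitive-step (v₁ , v₂) (w₁ , w₂) v≢w
    with sign-of (w₁ ℤ.- v₁) | sign-of (w₂ ℤ.- v₂) | bezout ℤ.∣ w₁ ℤ.- v₁ ∣ ℤ.∣ w₂ ℤ.- v₂ ∣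
       | divided (w₁ ℤ.- v₁) (ℕG.gcd[m,n]∣m ℤ.∣ w₁ ℤ.- v₁ ∣ ℤ.∣ w₂ ℤ.- v₂ ∣)
       | divided (w₂ ℤ.- v₂) (ℕG.gcd[m,n]∣n ℤ.∣ w₁ ℤ.- v₁ ∣ ℤ.∣ w₂ ℤ.- v₂ ∣)
  ... | s₁ , _ , abs₁ | s₂ , _ , abs₂ | x , y , xy | q₁ , e₁ | q₂ , e₂ =
    g , (y ℤ.* s₂ , ℤ.- (x ℤ.* s₁)) , (q₁ , q₂) , g≢0 , unit , cong₂ _,_ (move v₁ w₁ q₁ e₁) (move v₂ w₂ q₂ e₂)
    where
    g : ℕ
    g = ℕG.gcd ℤ.∣ w₁ ℤ.- v₁ ∣ ℤ.∣ w₂ ℤ.- v₂ ∣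
    g≢0 : g ≢ 0
    g≢0 g≡0 = v≢w (cong₂ _,_ (same v₁ w₁ (ℤP.∣i∣≡0⇒i≡0 (ℕG.gcd[m,n]≡0⇒m≡0 g≡0)))
                             (same v₂ w₂ (ℤP.∣i∣≡0⇒i≡0 (ℕG.gcd[m,n]≡0⇒n≡0 ℤ.∣ w₁ ℤ.- v₁ ∣ g≡0))))
      where
      same : ∀ v w → w ℤ.- v ≡ 0ℤ → v ≡ w
      same v w e = sym (ℤP.i-j≡0⇒i≡j w v e)
    move : ∀ v w q → w ℤ.- v ≡ q ℤ.* + g → w ≡ 1ℤ ℤ.* v ℤ.+ + g ℤ.* q
    move v w q e = trans (S.solve 2 (λ v w → w S.:= S.con 1ℤ S.:* v S.:+ (w S.:- v)) refl v w)
      (cong (λ t → 1ℤ ℤ.* v ℤ.+ t) (trans e (ℤP.*-comm q (+ g))))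
    unit : (y ℤ.* s₂) ℤ.* q₂ ℤ.- (ℤ.- (x ℤ.* s₁)) ℤ.* q₁ ≡ 1ℤ
    unit = ℤP.*-cancelʳ-≡ _ 1ℤ (+ g) {{ℤ.≢-nonZero (λ e → g≢0 (ℤP.+-injective e))}} (trans
      (S.solve 7 (λ x y s₁ s₂ q₁ q₂ g → ((y S.:* s₂) S.:* q₂ S.:- (S.:- (x S.:* s₁)) S.:* q₁) S.:* g S.:=
         x S.:* (s₁ S.:* (q₁ S.:* g)) S.:+ y S.:* (s₂ S.:* (q₂ S.:* g))) refl x y s₁ s₂ q₁ q₂ (+ g))
      (trans (cong₂ (λ s t → x ℤ.* s ℤ.+ y ℤ.* t)
          (trans (cong (s₁ ℤ.*_) (sym e₁)) abs₁) (trans (cong (s₂ ℤ.*_) (sym e₂)) abs₂))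
        (trans xy (sym (ℤP.*-identityˡ (+ g))))))

-- Edges in adapted lattice coordinates

ι2 : ℚ
ι2 = ι (+ 2)

opaque
  unfolding ι
  ι2-pos : 0ℚ < ι2
  ι2-pos = ℚP.positive⁻¹ (ι (+ 2))

≤⇔scaled : ∀ {c a b} → 0ℚ < c → a ≤ b ⇔ c * a ≤ c * b
≤⇔scaled {c} p = mk⇔ (ℚP.*-monoˡ-≤-nonNeg c {{nonNegative (ℚP.<⇒≤ p)}}) (ℚP.*-cancelˡ-≤-pos c {{positive p}})

<⇔scaled : ∀ {c a b} → 0ℚ < c → a < b ⇔ c * a < c * b
<⇔scaled {c} p = mk⇔ (ℚP.*-monoʳ-<-pos c {{positive p}}) (ℚP.*-cancelˡ-<-nonNeg c {{nonNegative (ℚP.<⇒≤ p)}})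

-- In the basis (c , d) of ℤ² the doubled ends of the edge are H c + A d and H c + B d, so H is twice the
-- lattice distance of the edge from the origin and L is twice its lattice length.
record LatticeEdge (W : List ℚ²) : Set where
  field
    v w : ℚ²
    edge : (v , w) ∈ cyclicPairs W
    v̂ ŵ c d : ℤ²
    H L : ℕ
    A B : ℤ
    v̂≡ : embed v̂ ≡ ι2 ⊙ v
    ŵ≡ : embed ŵ ≡ ι2 ⊙ w
    unit : dt c d ≡ 1ℤ
    v̂-coords : v̂ ≡ comb (+ H) c A d
    ŵ-coords : ŵ ≡ comb (+ H) c B d
    B≡A+L : B ≡ A ℤ.+ + L
    H≢0 : H ≢ 0
    L≢0 : L ≢ 0

  instance
    H-nonZero : ℕ.NonZero H
    H-nonZero = ℕ.≢-nonZero H≢0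
    L-positive : ℤ.Positive (+ L)
    L-positive = ℤ.positive (ℤ.+<+ (ℕP.n≢0⇒n>0 L≢0))

  edge-height : ℚ² → ℚ
  edge-height = height v w

  edge-det : ℚ
  edge-det = cross v w

  -- The coordinates of z in the basis (c , d). The edge itself lies on level H / 2.
  level offset : ℤ² → ℤ
  level z = dt z d
  offset z = dt c z

  private
    off = offset
    shape : ∀ {û X} z → û ≡ comb (+ H) c X d → dt û z ≡ off z ℤ.* + H ℤ.- X ℤ.* level z
    shape {û} {X} z refl = trans (dt-combˡ (+ H) c X d z) (trans (cong (λ t → + H ℤ.* off z ℤ.+ X ℤ.* t) (dt-anti d z))
      (S.solve 4 (λ h o x l → h S.:* o S.:+ x S.:* (S.:- l) S.:= o S.:* h S.:- x S.:* l) refl (+ H) (off z) X (level z)))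

    scaled-cross : ∀ {u û} z → embed û ≡ ι2 ⊙ u → ι2 * cross u (embed z) ≡ ι (dt û z)
    scaled-cross {u} {û} z e = trans (trans (sym (trans (anti (ι2 ⊙ u) (embed z)) (trans (cong -_ (cross-⊙ʳ ι2 (embed z) u))
      (trans (cong (λ t → - (ι2 * t)) (anti (embed z) u))
          (solve 2 (λ a b → :- (a :* (:- b)) := a :* b) refl ι2 (cross u (embed z)))))))
      (cong (λ t → cross t (embed z)) (sym e))) (cross-embed û z)

  scaled-tail : ∀ z → ι2 * cross v (embed z) ≡ ι (off z ℤ.* + H ℤ.- A ℤ.* level z)
  scaled-tail z = trans (scaled-cross {v} {v̂} z v̂≡) (cong ι (shape z v̂-coords))

  scaled-head : ∀ z → ι2 * cross (embed z) w ≡ ι (B ℤ.* level z ℤ.- off z ℤ.* + H)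
  scaled-head z = trans (trans (cong (ι2 *_) (anti (embed z) w))
      (solve 2 (λ a b → a :* (:- b) := :- (a :* b)) refl ι2 (cross w (embed z))))
    (trans (cong -_ (trans (scaled-cross {w} {ŵ} z ŵ≡) (cong ι (shape z ŵ-coords)))) (trans
        (sym (ι-neg (off z ℤ.* + H ℤ.- B ℤ.* level z)))
      (cong ι (S.solve 2 (λ a b → S.:- (a S.:- b) S.:= b S.:- a) refl (off z ℤ.* + H) (B ℤ.* level z)))))

  private
    nonNeg⇔ : ∀ {x a b} → ι2 * x ≡ ι (b ℤ.- a) → 0ℚ ≤ x ⇔ a ℤ.≤ b
    nonNeg⇔ {x} e = mk⇔
      (λ 0≤x → ℤP.0≤i-j⇒j≤i (ι-cancel-≤ (subst₂ _≤_ (sym ι0) e (nonNeg*nonNeg (ℚP.<⇒≤ ι2-pos) 0≤x))))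
      (λ a≤b → nonNeg-cancel ι2-pos (subst₂ _≤_ ι0 (sym e) (ι-mono-≤ (ℤP.i≤j⇒0≤j-i a≤b))))

    sub-pos : ∀ {a b} → a ℤ.< b → 0ℤ ℤ.< b ℤ.- a
    sub-pos {a} {b} a<b = subst (ℤ._< b ℤ.- a) (ℤP.+-inverseʳ a) (ℤP.+-monoˡ-< (ℤ.- a) a<b)

    pos-sub : ∀ {a b} → 0ℤ ℤ.< b ℤ.- a → a ℤ.< b
    pos-sub {a} {b} p = subst₂ ℤ._<_ (ℤP.+-identityˡ a) (S.solve 2 (λ a b → (b S.:- a) S.:+ a S.:= b) refl a b) (ℤP.+-monoˡ-< a p)

    pos⇔ : ∀ {x a b} → ι2 * x ≡ ι (b ℤ.- a) → 0ℚ < x ⇔ a ℤ.< b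
    pos⇔ {x} e = mk⇔
      (λ 0<x → pos-sub (ι-cancel-< (subst₂ _<_ (sym ι0) e (pos*pos ι2-pos 0<x))))
      (λ a<b → pos-cancel (ℚP.<⇒≤ ι2-pos) (subst₂ _<_ ι0 (sym e) (ι-mono-< (sub-pos a<b))))

  tail-≤ : ∀ z → 0ℚ ≤ cross v (embed z) ⇔ A ℤ.* level z ℤ.≤ off z ℤ.* + H
  tail-≤ z = nonNeg⇔ (scaled-tail z)

  tail-< : ∀ z → 0ℚ < cross v (embed z) ⇔ A ℤ.* level z ℤ.< off z ℤ.* + H
  tail-< z = pos⇔ (scaled-tail z)

  head-≤ : ∀ z → 0ℚ ≤ cross (embed z) w ⇔ off z ℤ.* + H ℤ.≤ B ℤ.* level z
  head-≤ z = nonNeg⇔ (scaled-head z)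

  head-< : ∀ z → 0ℚ < cross (embed z) w ⇔ off z ℤ.* + H ℤ.< B ℤ.* level z
  head-< z = pos⇔ (scaled-head z)

  scaled-height : ∀ z → ι2 * height v w (embed z) ≡ ι (+ L ℤ.* level z)
  scaled-height z = trans (cong (ι2 *_) (dot-normal v w (embed z))) (trans (ℚP.*-distribˡ-+ ι2 _ _)
    (trans (cong₂ _+_ (scaled-head z) (scaled-tail z)) (trans
        (sym (ι-+ (B ℤ.* level z ℤ.- off z ℤ.* + H) (off z ℤ.* + H ℤ.- A ℤ.* level z)))
      (cong ι (trans (cong (λ t → (t ℤ.* level z ℤ.- off z ℤ.* + H) ℤ.+ (off z ℤ.* + H ℤ.- A ℤ.* level z)) B≡A+L)
        (S.solve 4 (λ a l s x → ((a S.:+ l) S.:* s S.:- x) S.:+ (x S.:- a S.:* s) S.:=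
            l S.:* s) refl A (+ L) (level z) (off z ℤ.* + H)))))))

  tail-height : level v̂ ≡ + H
  tail-height = trans (cong level v̂-coords) (trans (dt-combˡ (+ H) c A d d) (trans
      (cong₂ (λ s t → + H ℤ.* s ℤ.+ A ℤ.* t) unit (dt-self d))
    (S.solve 2 (λ h a → h S.:* S.con 1ℤ S.:+ a S.:* S.con 0ℤ S.:= h) refl (+ H) A)))

  -- `scaled-height` evaluated at v̂, that is at 2 v, whose level is H. Summed over the edges, this
  -- makes Σ L H eight times the area.
  scaled-det : ι2 * (ι2 * cross v w) ≡ ι (+ L ℤ.* + H)
  scaled-det = trans (cong (λ t → ι2 * (ι2 * t)) (sym (trans (dot-normal v w v) (trans
      (cong (λ t → cross v w + t) (alternating v)) (ℚP.+-identityʳ (cross v w))))))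
    (trans (cong (ι2 *_) (sym (dot-⊙ ι2 v (normal v w)))) (trans (cong (λ t → ι2 * dot t (normal v w)) (sym v̂≡))
      (trans (scaled-height v̂) (cong (λ t → ι (+ L ℤ.* t)) tail-height))))

  height-pos : ∀ z → 0ℚ < height v w (embed z) → 0ℤ ℤ.< level z
  height-pos z p = ℤP.*-cancelˡ-<-nonNeg (+ L) (subst (ℤ._< + L ℤ.* level z) (sym (ℤP.*-zeroʳ (+ L)))
    (ι-cancel-< (subst₂ _<_ (sym ι0) (scaled-height z) (pos*pos ι2-pos p))))

  private
    scaled-bound : ∀ k z → ι2 * (ι2 * (ι k * cross v w)) ≡ ι (+ L ℤ.* (k ℤ.* + H))
    scaled-bound k z = trans (solve 3 (λ a k x → a :* (a :* (k :* x)) := k :* (a :* (a :* x))) refl ι2 (ι k) (cross v w))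
      (trans (cong (ι k *_) scaled-det) (trans (sym (ι-* k (+ L ℤ.* + H)))
        (cong ι (S.solve 3 (λ k l h → k S.:* (l S.:* h) S.:= l S.:* (k S.:* h)) refl k (+ L) (+ H)))))

    scaled-level : ∀ z → ι2 * (ι2 * height v w (embed z)) ≡ ι (+ L ℤ.* (+ 2 ℤ.* level z))
    scaled-level z = trans (cong (ι2 *_) (scaled-height z)) (trans (sym (ι-* (+ 2) (+ L ℤ.* level z)))
      (cong ι (S.solve 3 (λ a l x → a S.:* (l S.:* x) S.:= l S.:* (a S.:* x)) refl (+ 2) (+ L) (level z))))

  height-≤ : ∀ k z → height v w (embed z) ≤ ι k * cross v w ⇔ + 2 ℤ.* level z ℤ.≤ k ℤ.* + H
  height-≤ k z = mk⇔
    (λ le → ℤP.*-cancelˡ-≤-pos _ _ (+ L) (ι-cancel-≤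
        (subst₂ _≤_ (scaled-level z) (scaled-bound k z) (to (≤⇔scaled ι2-pos) (to (≤⇔scaled ι2-pos) le)))))
    (λ le → from (≤⇔scaled ι2-pos) (from (≤⇔scaled ι2-pos) (subst₂ _≤_ (sym (scaled-level z)) (sym (scaled-bound k z))
      (ι-mono-≤ (ℤP.*-monoˡ-≤-nonNeg (+ L) le)))))

  height-< : ∀ k z → height v w (embed z) < ι k * cross v w ⇔ + 2 ℤ.* level z ℤ.< k ℤ.* + H
  height-< k z = mk⇔
    (λ lt → ℤP.*-cancelˡ-<-nonNeg (+ L) (ι-cancel-<
        (subst₂ _<_ (scaled-level z) (scaled-bound k z) (to (<⇔scaled ι2-pos) (to (<⇔scaled ι2-pos) lt)))))
    (λ lt → from (<⇔scaled ι2-pos) (from (<⇔scaled ι2-pos) (subst₂ _<_ (sym (scaled-level z)) (sym (scaled-bound k z))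
      (ι-mono-< (ℤP.*-monoˡ-<-pos (+ L) lt)))))

private
  module LE = LatticeEdge

-- Counting in a cone level by level, in unimodular coordinates (lev, κ); term j of the sum is level 1 + j.
module _ {lev κ : ℤ² → ℤ} {point : ℤ → ℤ → ℤ²}
  (lev-point : ∀ l k → lev (point l k) ≡ l) (κ-point : ∀ l k → κ (point l k) ≡ k)
  (point-coords : ∀ z → point (lev z) (κ z) ≡ z) {H : ℕ} .{{_ : ℕ.NonZero H}} where

  card-cone : ∀ {A B} → A ℤ.≤ B → ∀ M →
    Card (λ z → 0ℤ ℤ.< lev z × lev z ℤ.≤ + M × A ℤ.* lev z ℤ.≤ κ z ℤ.* + H × κ z ℤ.* + H ℤ.< B ℤ.* lev z)
         (sumTo M (λ j → ceil (B ℤ.* + suc j) H ℤ.- ceil (A ℤ.* + suc j) H))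
  card-cone {A} {B} A≤B M = card-cong members (card-map slice-point
      (λ { {j , k} {j′ , k′} e → cong₂ _,_ (ℕP.suc-injective (ℤP.+-injective (trans (sym (lev-point (+ suc j) k)) (trans
          (cong lev e) (lev-point (+ suc j′) k′)))))
        (trans (sym (κ-point (+ suc j) k)) (trans (cong κ e) (κ-point (+ suc j′) k′))) })
      (card-slices (λ j → ceil (A ℤ.* + suc j) H) (λ j → ceil (B ℤ.* + suc j) H)
        (λ j → ceil-least (ℤP.≤-trans (ℤP.*-monoʳ-≤-nonNeg (+ suc j) A≤B) ceil-upper)) M))
    where
    slice-point : ℕ × ℤ → ℤ²
    slice-point (j , k) = point (+ suc j) k
    Cone : ℤ² → Set
    Cone z = 0ℤ ℤ.< lev z × lev z ℤ.≤ + M × A ℤ.* lev z ℤ.≤ κ z ℤ.* + H × κ z ℤ.* + H ℤ.< B ℤ.* lev z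
    below-ceil : ∀ {a k} → k ℤ.* + H ℤ.< a → k ℤ.< ceil a H
    below-ceil {a} {k} lt = ℤP.≰⇒> (λ c≤k → ℤP.<⇒≱ lt (from (ceil-galois k) c≤k))
    ceil-below : ∀ {a k} → k ℤ.< ceil a H → k ℤ.* + H ℤ.< a
    ceil-below {a} {k} lt = ℤP.≰⇒> (λ a≤ → ℤP.<⇒≱ lt (ceil-least a≤))
    Sliced : ℤ² → Set
    Sliced z = Σ (ℕ × ℤ) λ p → (proj₁ p ℕ.< M × ceil (A ℤ.* + suc (proj₁ p)) H ℤ.≤ proj₂ p × proj₂ p ℤ.< ceil (B ℤ.* + suc
        (proj₁ p)) H) × z ≡ slice-point p
    members : ∀ z → Sliced z ⇔ Cone z
    members z = mk⇔ fwd (λ cone → bwd (lev z) refl cone)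
      where
      fwd : Sliced z → Cone z
      fwd ((j , k) , (j<M , lo , hi) , refl) rewrite lev-point (+ suc j) k | κ-point (+ suc j) k =
        ℤ.+<+ (ℕ.s≤s ℕ.z≤n) , ℤ.+≤+ j<M , from (ceil-galois k) lo , ceil-below {k = k} hi
      bwd : ∀ l → lev z ≡ l → Cone z → Sliced z
      bwd (+ zero) e (pos , _) = ⊥-elim (ℤP.<-irrefl refl (subst (0ℤ ℤ.<_) e pos))
      bwd ℤ.-[1+ n ] e (pos , _) = ⊥-elim (ℤP.<-asym ℤ.-<+ (subst (0ℤ ℤ.<_) e pos))
      bwd (+ suc j) e (_ , le , lo , hi) = (j , κ z) ,
        (ℤP.drop‿+≤+ (subst (ℤ._≤ + M) e le) ,
         ceil-least {k = κ z} (subst (λ l → A ℤ.* l ℤ.≤ κ z ℤ.* + H) e lo) ,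
         below-ceil {k = κ z} (subst (λ l → κ z ℤ.* + H ℤ.< B ℤ.* l) e hi)) ,
        sym (trans (cong (λ l → point l (κ z)) (sym e)) (point-coords z))

comb-level : ∀ {c d} l k → dt c d ≡ 1ℤ → dt (comb l c k d) d ≡ l
comb-level {c} {d} l k unit = trans (dt-combˡ l c k d d) (trans (cong₂ (λ s t → l ℤ.* s ℤ.+ k ℤ.* t) unit (dt-self d))
  (S.solve 2 (λ l k → l S.:* S.con 1ℤ S.:+ k S.:* S.con 0ℤ S.:= l) refl l k))

comb-offset : ∀ {c d} l k → dt c d ≡ 1ℤ → dt c (comb l c k d) ≡ k
comb-offset {c} {d} l k unit = trans (dt-anti c (comb l c k d)) (trans (cong ℤ.-_ (dt-combˡ l c k d c))
  (trans (cong₂ (λ s t → ℤ.- (l ℤ.* s ℤ.+ k ℤ.* t)) (dt-self c) (trans (dt-anti d c) (cong ℤ.-_ unit)))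
    (S.solve 2 (λ l k → S.:- (l S.:* S.con 0ℤ S.:+ k S.:* (S.:- S.con 1ℤ)) S.:= k) refl l k)))

opaque
  unfolding dt

  dt-zero : ∀ d → dt (0ℤ , 0ℤ) d ≡ 0ℤ
  dt-zero _ = refl

rotation-unique : (x : ℚ²) (xs : List ℚ²) → Unique (x ∷ xs) → Unique (xs ++ [ x ])
rotation-unique x xs (x∉ ∷ unique) = UniqueP.++⁺ unique ([] ∷ []) λ { (y∈ , here refl) → All.lookup x∉ y∈ refl ; (_ , there ()) }

map-fst-cyclic : ∀ x xs (y : ℚ²) → map proj₁ (zip (x ∷ xs) (xs ++ [ y ])) ≡ x ∷ xs
map-fst-cyclic x [] y = refl
map-fst-cyclic x (z ∷ zs) y = cong (x ∷_) (map-fst-cyclic z zs y)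

map-snd-cyclic : ∀ x xs (y : ℚ²) → map proj₂ (zip (x ∷ xs) (xs ++ [ y ])) ≡ xs ++ [ y ]
map-snd-cyclic x [] y = refl
map-snd-cyclic x (z ∷ zs) y = cong (z ∷_) (map-snd-cyclic z zs y)

cyclic-tails-unique : ∀ W → Unique W → Unique (map proj₁ (cyclicPairs W))
cyclic-tails-unique [] u = []
cyclic-tails-unique (x ∷ xs) u = subst Unique (sym (map-fst-cyclic x xs x)) u

cyclic-heads-unique : ∀ W → Unique W → Unique (map proj₂ (cyclicPairs W))
cyclic-heads-unique [] u = []
cyclic-heads-unique (x ∷ xs) u = subst Unique (sym (map-snd-cyclic x xs x)) (rotation-unique x xs u)

module _ {W : List ℚ²} (poly : Polygon W) (half-integral : ∀ {v} → v ∈ W → Σ ℤ² λ z → embed z ≡ ι2 ⊙ v) where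
  open Faces poly

  lattice-edge : ∀ {v w} → IsEdge v w → Σ (LatticeEdge W) λ i → LE.v i ≡ v × LE.w i ≡ w
  lattice-edge {v} {w} e = build (half-integral (proj₁ (ed-mem e))) (half-integral (proj₂ (ed-mem e)))
    where
    build : (Σ ℤ² λ z → embed z ≡ ι2 ⊙ v) → (Σ ℤ² λ z → embed z ≡ ι2 ⊙ w) → _
    build (v̂ , v̂≡) (ŵ , ŵ≡) = complete (primitive-step v̂ ŵ v̂≢ŵ)
      where
      scaled : ι2 * (ι2 * cross v w) ≡ ι (dt v̂ ŵ)
      scaled = trans (cong (ι2 *_) (sym (cross-⊙ʳ ι2 v w))) (trans (cong (ι2 *_) (anti v (ι2 ⊙ w)))
        (trans (solve 2 (λ a b → a :* (:- b) := :- (a :* b)) refl ι2 (cross (ι2 ⊙ w) v))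
        (trans (cong -_ (sym (cross-⊙ʳ ι2 (ι2 ⊙ w) v))) (trans (sym (anti (ι2 ⊙ v) (ι2 ⊙ w)))
        (trans (sym (cong₂ cross v̂≡ ŵ≡)) (cross-embed v̂ ŵ))))))
      positive-det : 0ℤ ℤ.< dt v̂ ŵ
      positive-det = ι-cancel-< (subst₂ _<_ (sym ι0) scaled (pos*pos ι2-pos (pos*pos ι2-pos (ed-pos e))))
      v̂≢ŵ : v̂ ≢ ŵ
      v̂≢ŵ v̂≡ŵ = ℤP.<-irrefl (sym (trans (cong (dt v̂) (sym v̂≡ŵ)) (dt-self v̂))) positive-det
      complete : (Σ ℕ λ L → Σ ℤ² λ c → Σ ℤ² λ d → L ≢ 0 × dt c d ≡ 1ℤ × ŵ ≡ comb 1ℤ v̂ (+ L) d) →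
        Σ (LatticeEdge W) λ i → LE.v i ≡ v × LE.w i ≡ w
      complete (L , c , d , L≢0 , unit , step) = record
        { v = v ; w = w ; edge = e ; v̂ = v̂ ; ŵ = ŵ ; c = c ; d = d ; H = H ; L = L ; A = A ; B = A ℤ.+ + L
        ; v̂≡ = v̂≡ ; ŵ≡ = ŵ≡ ; unit = unit
        ; v̂-coords = trans (coordinates v̂ unit) (cong (λ h → comb h c A d) (sym +H≡))
        ; ŵ-coords = trans (coordinates ŵ unit) (cong₂ (λ h b → comb h c b d) (trans ŵ-level (sym +H≡)) ŵ-offset)
        ; B≡A+L = refl ; H≢0 = H≢0 ; L≢0 = L≢0 } , refl , refl
        where
        A = dt c v̂
        H = ℤ.∣ dt v̂ d ∣
        dtvw : dt v̂ ŵ ≡ + L ℤ.* dt v̂ d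
        dtvw = trans (dt-anti v̂ ŵ) (trans (cong (λ t → ℤ.- dt t v̂) step) (trans (cong ℤ.-_ (dt-combˡ 1ℤ v̂ (+ L) d v̂))
          (trans (cong₂ (λ s t → ℤ.- (1ℤ ℤ.* s ℤ.+ + L ℤ.* t)) (dt-self v̂) (dt-anti d v̂))
            (S.solve 2 (λ l x → S.:- (S.con 1ℤ S.:* S.con 0ℤ S.:+ l S.:* (S.:- x)) S.:= l S.:* x) refl (+ L) (dt v̂ d)))))
        -- The counter-clockwise orientation makes dt v̂ ŵ, which is L times the level of v̂,
        -- positive; so the absolute value taken in H changes nothing.
        0<level : 0ℤ ℤ.< dt v̂ d
        0<level = ℤP.*-cancelˡ-<-nonNeg (+ L) (subst₂ ℤ._<_ (sym (ℤP.*-zeroʳ (+ L))) dtvw positive-det)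
        +H≡ : + H ≡ dt v̂ d
        +H≡ = ℤP.0≤i⇒+∣i∣≡i (ℤP.<⇒≤ 0<level)
        H≢0 : H ≢ 0
        H≢0 h = ℤP.<-irrefl (trans (cong +_ (sym h)) +H≡) 0<level
        ŵ-level : dt ŵ d ≡ dt v̂ d
        ŵ-level = trans (cong (λ t → dt t d) step) (trans (dt-combˡ 1ℤ v̂ (+ L) d d) (trans
            (cong (λ t → 1ℤ ℤ.* dt v̂ d ℤ.+ + L ℤ.* t) (dt-self d))
          (S.solve 2 (λ x l → S.con 1ℤ S.:* x S.:+ l S.:* S.con 0ℤ S.:= x) refl (dt v̂ d) (+ L))))
        ŵ-offset : dt c ŵ ≡ A ℤ.+ + L
        ŵ-offset = trans (dt-anti c ŵ) (trans (cong (λ t → ℤ.- dt t c) step) (trans (cong ℤ.-_ (dt-combˡ 1ℤ v̂ (+ L) d c))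
          (trans (cong₂ (λ s t → ℤ.- (1ℤ ℤ.* s ℤ.+ + L ℤ.* t)) (dt-anti v̂ c) (trans (dt-anti d c) (cong ℤ.-_ unit)))
            (S.solve 2 (λ a l → S.:- (S.con 1ℤ S.:* (S.:- a) S.:+ l S.:* (S.:- S.con 1ℤ)) S.:= a S.:+ l) refl A (+ L)))))

  lattice-edges-from : ∀ L → (∀ {e} → e ∈ L → e ∈ cyclicPairs W) → Σ (List (LatticeEdge W)) λ I →
    map LE.v I ≡ map proj₁ L × map LE.w I ≡ map proj₂ L ×
    (∀ {v w} → (v , w) ∈ L → Any (λ i → LE.v i ≡ v × LE.w i ≡ w) I)
  lattice-edges-from [] _ = [] , refl , refl , λ ()
  lattice-edges-from ((v , w) ∷ L) ⊆E =
    let i , v≡ , w≡ = lattice-edge (⊆E (here refl)) ; I , vs , ws , every = lattice-edges-from L (⊆E ∘ there) in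
    i ∷ I , cong₂ _∷_ v≡ vs , cong₂ _∷_ w≡ ws , λ { (here refl) → here (v≡ , w≡) ; (there e) → there (every e) }

-- `tails` and `heads` keep the order of `cyclicPairs W`, so that the shoelace sum can be compared
-- term by term.
record LatticeEdges (W : List ℚ²) : Set where
  field
    I : List (LatticeEdge W)
    tails-distinct : AllPairs (λ i j → LE.v i ≢ LE.v j) I
    heads-distinct : AllPairs (λ i j → LE.w i ≢ LE.w j) I
    tails : map LE.v I ≡ map proj₁ (cyclicPairs W)
    heads : map LE.w I ≡ map proj₂ (cyclicPairs W)
    every : ∀ {v w} → (v , w) ∈ cyclicPairs W → Any (λ i → LE.v i ≡ v × LE.w i ≡ w) I

lattice-edges : ∀ {W} → Polygon W → (∀ {v} → v ∈ W → Σ ℤ² λ z → embed z ≡ ι2 ⊙ v) → LatticeEdges W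
lattice-edges {W} poly half-integral = assemble (lattice-edges-from poly half-integral (cyclicPairs W) (λ e → e))
  where
  assemble : _ → LatticeEdges W
  assemble (I , vs , ws , every) = record
    { I = I ; tails = vs ; heads = ws ; every = every
    ; tails-distinct = AllPairsP.map⁻ (subst Unique (sym vs) (cyclic-tails-unique W (Polygon.unique poly)))
    ; heads-distinct = AllPairsP.map⁻ (subst Unique (sym ws) (cyclic-heads-unique W (Polygon.unique poly))) }

-- ⌈ X s / H ⌉ + ⌊ X s / H ⌋ at level s = 1 + j
roundings : ℤ → (H : ℕ) .{{_ : ℕ.NonZero H}} → ℕ → ℤ
roundings X H j = ceil (X ℤ.* + suc j) H ℤ.- ceil ((ℤ.- X) ℤ.* + suc j) H

-- Counting lattice points cone by cone

sumTo-cong : ∀ {f g : ℕ → ℤ} n → (∀ j → f j ≡ g j) → sumTo n f ≡ sumTo n g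
sumTo-cong zero e = refl
sumTo-cong (suc n) e = cong₂ ℤ._+_ (sumTo-cong n e) (e n)

sumTo-+ : ∀ (f g : ℕ → ℤ) n → sumTo n f ℤ.+ sumTo n g ≡ sumTo n (λ j → f j ℤ.+ g j)
sumTo-+ f g zero = refl
sumTo-+ f g (suc n) = trans (S.solve 4 (λ a b c d → (a S.:+ b) S.:+ (c S.:+ d) S.:=
    (a S.:+ c) S.:+ (b S.:+ d)) refl (sumTo n f) (f n) (sumTo n g) (g n))
  (cong (ℤ._+ (f n ℤ.+ g n)) (sumTo-+ f g n))

sumOver-+ : ∀ {I : Set} (f g : I → ℤ) L → sumOver f L ℤ.+ sumOver g L ≡ sumOver (λ i → f i ℤ.+ g i) L
sumOver-+ f g [] = refl
sumOver-+ f g (i ∷ L) = trans (S.solve 4 (λ a b c d → (a S.:+ b) S.:+ (c S.:+ d) S.:=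
    (a S.:+ c) S.:+ (b S.:+ d)) refl (f i) (sumOver f L) (g i) (sumOver g L))
  (cong (λ t → (f i ℤ.+ g i) ℤ.+ t) (sumOver-+ f g L))

sumOver-cong : ∀ {I : Set} {f g : I → ℤ} L → (∀ {i} → i ∈ L → f i ≡ g i) → sumOver f L ≡ sumOver g L
sumOver-cong [] e = refl
sumOver-cong (i ∷ L) e = cong₂ ℤ._+_ (e (here refl)) (sumOver-cong L (e ∘ there))

-- The numbers of lattice points on level 1 + j in the cones over [v , w) and (v , w]. For the
-- second, negating the offset exchanges the ends, so the same formula applies to -B and -A.
left-weight right-weight : ∀ {W} → LatticeEdge W → ℕ → ℤ
left-weight i j = ceil (B ℤ.* + suc j) H ℤ.- ceil (A ℤ.* + suc j) H
  where open LatticeEdge i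
right-weight i j = ceil ((ℤ.- A) ℤ.* + suc j) H ℤ.- ceil ((ℤ.- B) ℤ.* + suc j) H
  where open LatticeEdge i

edge-weight : ∀ {W} → LatticeEdge W → ℕ → ℤ
edge-weight i j = roundings B H j ℤ.- roundings A H j
  where open LatticeEdge i

left+right : ∀ {W} (i : LatticeEdge W) j → left-weight i j ℤ.+ right-weight i j ≡ edge-weight i j
left+right i j = S.solve 4 (λ b a a′ b′ → (b S.:- a) S.:+ (a′ S.:- b′) S.:= (b S.:- b′) S.:- (a S.:- a′)) refl
  (ceil (B ℤ.* + suc j) H) (ceil (A ℤ.* + suc j) H) (ceil ((ℤ.- A) ℤ.* + suc j) H) (ceil ((ℤ.- B) ℤ.* + suc j) H)
  where open LatticeEdge i

sector-weight : ∀ {W} → (LatticeEdge W → ℕ) → LatticeEdge W → ℤ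
sector-weight M i = sumTo (M i) (edge-weight i)

-- R will be a dilate or the interior of one. All that matters is that it contains the origin and
-- that in the cone of each edge membership is an upper bound on the level.
module Counting {W : List ℚ²} (poly : Polygon W) (edges : LatticeEdges W)
  {R : ℤ² → Set} (R-zero : R (0ℤ , 0ℤ)) (M : LatticeEdge W → ℕ)
  (R⇔ : ∀ i z → 0ℚ ≤ cross (LE.v i) (embed z) → 0ℚ ≤ cross (embed z) (LE.w i) →
    0ℤ ℤ.< LE.level i z → R z ⇔ LE.level i z ℤ.≤ + M i) where
  open Faces poly
  open LatticeEdges edges
  open LatticeEdge using (level; offset; tail-≤; tail-<; head-≤; head-<)

  private
    A B : LatticeEdge W → ℤ
    A = LE.A
    B = LE.B
    H : LatticeEdge W → ℕ
    H = LE.H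

    A≤B : ∀ i → A i ℤ.≤ B i
    A≤B i = subst (A i ℤ.≤_) (sym (LE.B≡A+L i)) (ℤP.i≤i+j (A i) (+ LE.L i))

    nonzero-embed : ∀ {z} → z ≢ (0ℤ , 0ℤ) → embed z ≢ origin
    nonzero-embed z≢0 e = z≢0 (embed-injective (trans e (sym embed-origin)))

    level-pos : ∀ (i : LatticeEdge W) z → 0ℚ < cross (LE.v i) (embed z) + cross (embed z) (LE.w i) → 0ℤ ℤ.< level i z
    level-pos i z p = LE.height-pos i z (subst (0ℚ <_) (trans (ℚP.+-comm (cross (LE.v i) (embed z)) (cross (embed z) (LE.w i)))
      (sym (dot-normal (LE.v i) (LE.w i) (embed z)))) p)

    Left Right : LatticeEdge W → ℤ² → Set
    Left i z = 0ℤ ℤ.< level i z × level i z ℤ.≤ + M i × A i ℤ.* level i z ℤ.≤ offset i z ℤ.* + H i × offset i z ℤ.* + H i ℤ.< B i ℤ.* level i z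
    Right i z = 0ℤ ℤ.< level i z × level i z ℤ.≤ + M i × (ℤ.- B i) ℤ.* level i z ℤ.≤ (ℤ.- offset i z) ℤ.* + H i ×
        (ℤ.- offset i z) ℤ.* + H i ℤ.< (ℤ.- A i) ℤ.* level i z

    left-card : ∀ i → Card (Left i) (sumTo (M i) (left-weight i))
    left-card i = card-cone (λ l k → comb-level l k unit) (λ l k → comb-offset l k unit) (λ z →
        sym (coordinates z unit)) (A≤B i) (M i)
      where open LatticeEdge i using (unit; H-nonZero)

    right-card : ∀ i → Card (Right i) (sumTo (M i) (right-weight i))
    right-card i = card-cone {point = λ l k → comb l c (ℤ.- k) d} (λ l k → comb-level l (ℤ.- k) unit)
      (λ l k → trans (cong ℤ.-_ (comb-offset l (ℤ.- k) unit)) (ℤP.neg-involutive k))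
      (λ z → trans (cong (λ t → comb (dt z d) c t d) (ℤP.neg-involutive (dt c z)))
          (sym (coordinates z unit))) (ℤP.neg-mono-≤ (A≤B i)) (M i)
      where open LatticeEdge i using (unit; c; d; H-nonZero)

    neg-≤ : ∀ x y p q → (ℤ.- x) ℤ.* y ℤ.≤ (ℤ.- p) ℤ.* q ⇔ p ℤ.* q ℤ.≤ x ℤ.* y
    neg-≤ x y p q = mk⇔
      (λ le → ℤP.neg-cancel-≤ (subst₂ ℤ._≤_ (sym (ℤP.neg-distribˡ-* x y)) (sym (ℤP.neg-distribˡ-* p q)) le))
      (λ le → subst₂ ℤ._≤_ (ℤP.neg-distribˡ-* x y) (ℤP.neg-distribˡ-* p q) (ℤP.neg-mono-≤ le))

    neg-< : ∀ x y p q → (ℤ.- x) ℤ.* y ℤ.< (ℤ.- p) ℤ.* q ⇔ p ℤ.* q ℤ.< x ℤ.* y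
    neg-< x y p q = mk⇔
      (λ lt → ℤP.neg-cancel-< (subst₂ ℤ._<_ (sym (ℤP.neg-distribˡ-* x y)) (sym (ℤP.neg-distribˡ-* p q)) lt))
      (λ lt → subst₂ ℤ._<_ (ℤP.neg-distribˡ-* x y) (ℤP.neg-distribˡ-* p q) (ℤP.neg-mono-< lt))

    left-sector : ∀ i z → Left i z → 0ℚ ≤ cross (LE.v i) (embed z) × 0ℚ < cross (embed z) (LE.w i)
    left-sector i z (_ , _ , t , h) = from (tail-≤ i z) t , from (head-< i z) h

    right-sector : ∀ i z → Right i z → 0ℚ < cross (LE.v i) (embed z) × 0ℚ ≤ cross (embed z) (LE.w i)
    right-sector i z (_ , _ , h , t) = from (tail-< i z) (to (neg-< (offset i z) (+ H i) (A i) (level i z)) t) , from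
        (head-≤ i z) (to (neg-≤ (B i) (level i z) (offset i z) (+ H i)) h)

    left-from : ∀ i z → R z → 0ℚ ≤ cross (LE.v i) (embed z) → 0ℚ < cross (embed z) (LE.w i) → Left i z
    left-from i z r t h = pos , to (R⇔ i z t (ℚP.<⇒≤ h) pos) r , to (tail-≤ i z) t , to (head-< i z) h
      where
      pos : 0ℤ ℤ.< level i z
      pos = level-pos i z (nonNeg+pos t h)

    right-from : ∀ i z → R z → 0ℚ < cross (LE.v i) (embed z) → 0ℚ ≤ cross (embed z) (LE.w i) → Right i z
    right-from i z r t h = pos , to (R⇔ i z (ℚP.<⇒≤ t) h pos) r , neg-head , neg-tail
      where
      pos : 0ℤ ℤ.< level i z
      pos = level-pos i z (pos+nonNeg t h)
      neg-head : (ℤ.- B i) ℤ.* level i z ℤ.≤ (ℤ.- offset i z) ℤ.* + H i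
      neg-head = from (neg-≤ (B i) (level i z) (offset i z) (+ H i)) (to (head-≤ i z) h)
      neg-tail : (ℤ.- offset i z) ℤ.* + H i ℤ.< (ℤ.- A i) ℤ.* level i z
      neg-tail = from (neg-< (offset i z) (+ H i) (A i) (level i z)) (to (tail-< i z) t)

    at-zero : ∀ (i : LatticeEdge W) → level i (0ℤ , 0ℤ) ≡ 0ℤ
    at-zero i = dt-zero (LE.d i)

    _≟ᶻ_ = ≡-dec ℤ._≟_ ℤ._≟_

  private
    assemble : (T : LatticeEdge W → ℤ² → Set) (f : LatticeEdge W → ℤ) →
      (∀ i → Card (T i) (f i)) →
      AllPairs (λ i j → ∀ z → T i z → ¬ T j z) I →
      (∀ i z → T i z → 0ℤ ℤ.< level i z × R z) →
      (∀ z → z ≢ (0ℤ , 0ℤ) → R z → Any (λ i → T i z) I) →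
      Card R (1ℤ ℤ.+ sumOver f I)
    assemble T f cards disjoint sound complete = card-cong members
      (card-∪ (λ { z refl some → not-zero some }) (card-singleton (0ℤ , 0ℤ)) (card-⋃ I (λ {i} _ → cards i) disjoint))
      where
      not-zero : ∀ {L} → ¬ Any (λ i → T i (0ℤ , 0ℤ)) L
      not-zero (here {x = i} t) = ℤP.<-irrefl (sym (at-zero i)) (proj₁ (sound i _ t))
      not-zero (there r) = not-zero r
      holds : ∀ {L z} → Any (λ i → T i z) L → R z
      holds (here {x = i} t) = proj₂ (sound i _ t)
      holds (there r) = holds r
      members : ∀ z → (z ≡ (0ℤ , 0ℤ) ⊎ Any (λ i → T i z) I) ⇔ R z
      members z = mk⇔ [ (λ { refl → R-zero }) , holds ]′ (λ r → decide r (z ≟ᶻ (0ℤ , 0ℤ)))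
        where
        decide : R z → Dec (z ≡ (0ℤ , 0ℤ)) → z ≡ (0ℤ , 0ℤ) ⊎ Any (λ i → T i z) I
        decide r (yes e) = inj₁ e
        decide r (no z≢0) = inj₂ (complete z z≢0 r)

  count-left : Card R (1ℤ ℤ.+ sumOver (λ i → sumTo (M i) (left-weight i)) I)
  count-left = assemble Left _ left-card
    (AllPairs.map (λ {i} {j} v≢ z s t → let i₁ , i₂ = left-sector i z s ; j₁ , j₂ = left-sector j z t in
      v≢ (sector-unique (LE.edge i) (LE.edge j) i₁ i₂ j₁ j₂)) tails-distinct)
    (λ i z s → let t , h = left-sector i z s in proj₁ s , from (R⇔ i z t (ℚP.<⇒≤ h) (proj₁ s)) (proj₁ (proj₂ s)))
    (λ z z≢0 r → locate z r (sector (embed z) (nonzero-embed z≢0)))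
    where
    locate : ∀ z → R z → (Σ ℚ² λ v → Σ ℚ² λ w → IsEdge v w × 0ℚ ≤ cross v (embed z) × 0ℚ < cross (embed z) w) → Any (λ i →
        Left i z) I
    locate z r (v , w , e , t , h) = Any.map (λ { {i} (refl , refl) → left-from i z r t h }) (every e)

  count-right : Card R (1ℤ ℤ.+ sumOver (λ i → sumTo (M i) (right-weight i)) I)
  count-right = assemble Right _ right-card
    (AllPairs.map (λ {i} {j} w≢ z s t → let i₁ , i₂ = right-sector i z s ; j₁ , j₂ = right-sector j z t in
      w≢ (sectorˡ-unique (LE.edge i) (LE.edge j) i₂ i₁ j₂ j₁)) heads-distinct)
    (λ i z s → let t , h = right-sector i z s in proj₁ s , from (R⇔ i z (ℚP.<⇒≤ t) h (proj₁ s)) (proj₁ (proj₂ s)))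
    (λ z z≢0 r → locate z r (sectorˡ (embed z) (nonzero-embed z≢0)))
    where
    locate : ∀ z → R z → (Σ ℚ² λ w → Σ ℚ² λ v → IsEdge v w × 0ℚ ≤ cross (embed z) w × 0ℚ < cross v (embed z)) → Any (λ i →
        Right i z) I
    locate z r (w , v , e , h , t) = Any.map (λ { {i} (refl , refl) → right-from i z r t h }) (every e)

  -- Averaging the two half-open decompositions makes the rays through the vertices count half from each side.
  count-doubled : ∀ {n} → Card R n → + 2 ℤ.* n ≡ + 2 ℤ.+ sumOver (sector-weight M) I
  count-doubled {n} card = trans (S.solve 1 (λ n → S.con (+ 2) S.:* n S.:= n S.:+ n) refl n)
    (trans (cong₂ ℤ._+_ (card-unique card count-left) (card-unique card count-right))
      (trans (S.solve 2 (λ a b → (S.con 1ℤ S.:+ a) S.:+ (S.con 1ℤ S.:+ b) S.:=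
          S.con (+ 2) S.:+ (a S.:+ b)) refl (sumOver lefts I) (sumOver rights I))
        (cong (λ t → + 2 ℤ.+ t) (trans (sumOver-+ lefts rights I) (sumOver-cong I (λ {i} _ →
          trans (sumTo-+ (left-weight i) (right-weight i) (M i)) (sumTo-cong (M i) (left+right i))))))))
    where
    lefts rights : LatticeEdge W → ℤ
    lefts i = sumTo (M i) (left-weight i)
    rights i = sumTo (M i) (right-weight i)

-- Sums of roundings

module _ {H : ℕ} .{{_ : ℕ.NonZero H}} where

  -- ⌈ a / H ⌉ + ⌊ a / H ⌋
  rounding : ℤ → ℤ
  rounding a = ceil a H ℤ.- ceil (ℤ.- a) H

  ceil-shift : ∀ a n → ceil (a ℤ.+ n ℤ.* + H) H ≡ ceil a H ℤ.+ n
  ceil-shift a n = ℤP.≤-antisym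
    (ceil-least {k = ceil a H ℤ.+ n} (subst (a ℤ.+ n ℤ.* + H ℤ.≤_)
        (sym (ℤP.*-distribʳ-+ (+ H) (ceil a H) n)) (ℤP.+-monoˡ-≤ (n ℤ.* + H) (ceil-upper {a} {H}))))
    (subst (ceil a H ℤ.+ n ℤ.≤_) (S.solve 2 (λ c n → (c S.:- n) S.:+ n S.:= c) refl c n) (ℤP.+-monoˡ-≤ n (ceil-least {k = c ℤ.- n}
      (subst₂ ℤ._≤_ (S.solve 3 (λ a n h → (a S.:+ n S.:* h) S.:- n S.:* h S.:= a) refl a n (+ H))
        (S.solve 3 (λ c n h → c S.:* h S.:- n S.:* h S.:= (c S.:- n) S.:* h) refl c n (+ H))
        (ℤP.+-monoˡ-≤ (ℤ.- (n ℤ.* + H)) (ceil-upper {a ℤ.+ n ℤ.* + H} {H}))))))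
    where
    c : ℤ
    c = ceil (a ℤ.+ n ℤ.* + H) H

  rounding-shift : ∀ a n → rounding (a ℤ.+ n ℤ.* + H) ≡ rounding a ℤ.+ + 2 ℤ.* n
  rounding-shift a n = trans (cong₂ ℤ._-_ (ceil-shift a n) (trans (cong (λ t → ceil t H)
      (S.solve 3 (λ a n h → S.:- (a S.:+ n S.:* h) S.:=
          (S.:- a) S.:+ (S.:- n) S.:* h) refl a n (+ H))) (ceil-shift (ℤ.- a) (ℤ.- n))))
    (S.solve 3 (λ x y n → (x S.:+ n) S.:- (y S.:+ (S.:- n)) S.:=
        (x S.:- y) S.:+ S.con (+ 2) S.:* n) refl (ceil a H) (ceil (ℤ.- a) H) n)

  rounding-neg : ∀ a → rounding (ℤ.- a) ≡ ℤ.- rounding a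
  rounding-neg a = trans (cong (λ t → ceil (ℤ.- a) H ℤ.- ceil t H) (ℤP.neg-involutive a))
    (S.solve 2 (λ x y → y S.:- x S.:= S.:- (x S.:- y)) refl (ceil a H) (ceil (ℤ.- a) H))

  -- Oddness combined with the shift by an integer; this is what makes opposite levels of a period
  -- cancel.
  rounding-reflect : ∀ a n → rounding (n ℤ.* + H ℤ.- a) ≡ + 2 ℤ.* n ℤ.- rounding a
  rounding-reflect a n = trans (cong rounding (ℤP.+-comm (n ℤ.* + H) (ℤ.- a))) (trans (rounding-shift (ℤ.- a) n)
    (trans (cong (ℤ._+ + 2 ℤ.* n) (rounding-neg a)) (ℤP.+-comm (ℤ.- rounding a) (+ 2 ℤ.* n))))

  -- A half-integer is fixed by the reflection.
  rounding-half : ∀ a n → + 2 ℤ.* a ≡ n ℤ.* + H → rounding a ≡ n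
  rounding-half a n e = ℤP.*-cancelˡ-≡ (+ 2) (rounding a) n (
    (trans (S.solve 1 (λ r → S.con (+ 2) S.:* r S.:= r S.:+ r) refl (rounding a))
      (trans (cong (λ t → rounding a ℤ.+ t) reflected)
          (S.solve 2 (λ r n → r S.:+ (S.con (+ 2) S.:* n S.:- r) S.:= S.con (+ 2) S.:* n) refl (rounding a) n))))
    where
    reflected : rounding a ≡ + 2 ℤ.* n ℤ.- rounding a
    reflected = trans (cong rounding (trans (S.solve 1 (λ a → a S.:= S.con (+ 2) S.:* a S.:- a) refl a)
        (cong (ℤ._- a) e))) (rounding-reflect a n)

  module _ (X : ℤ) where
    term : ℕ → ℤ
    term = roundings X H

    term≡ : ∀ j → term j ≡ rounding (X ℤ.* + suc j)
    term≡ j = cong (λ t → ceil (X ℤ.* + suc j) H ℤ.- ceil t H) (sym (ℤP.neg-distribˡ-* X (+ suc j)))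

sumTo-front : ∀ (f : ℕ → ℤ) n → sumTo (suc n) f ≡ f 0 ℤ.+ sumTo n (f ∘ suc)
sumTo-front f zero = ℤP.+-comm 0ℤ (f 0)
sumTo-front f (suc n) = trans (cong (ℤ._+ f (suc n)) (sumTo-front f n)) (ℤP.+-assoc (f 0) (sumTo n (f ∘ suc)) (f (suc n)))

sumTo-reverse : ∀ (f : ℕ → ℤ) n → sumTo n (λ j → f (n ℕ.∸ suc j)) ≡ sumTo n f
sumTo-reverse f zero = refl
sumTo-reverse f (suc n) = trans (sumTo-front (λ j → f (n ℕ.∸ j)) n)
  (trans (ℤP.+-comm (f n) (sumTo n (λ j → f (n ℕ.∸ suc j)))) (cong (ℤ._+ f n) (sumTo-reverse f n)))

sumTo-append : ∀ (f : ℕ → ℤ) m n → sumTo (m ℕ.+ n) f ≡ sumTo m f ℤ.+ sumTo n (λ j → f (m ℕ.+ j))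
sumTo-append f m zero = trans (cong (λ t → sumTo t f) (ℕP.+-identityʳ m)) (sym (ℤP.+-identityʳ (sumTo m f)))
sumTo-append f m (suc n) = trans (cong (λ t → sumTo t f) (ℕP.+-suc m n))
  (trans (cong (ℤ._+ f (m ℕ.+ n)) (sumTo-append f m n)) (ℤP.+-assoc (sumTo m f) (sumTo n (λ j → f (m ℕ.+ j))) (f (m ℕ.+ n))))

sumTo-cong< : ∀ {f g : ℕ → ℤ} n → (∀ j → j ℕ.< n → f j ≡ g j) → sumTo n f ≡ sumTo n g
sumTo-cong< zero e = refl
sumTo-cong< (suc n) e = cong₂ ℤ._+_ (sumTo-cong< n (λ j j<n → e j (ℕP.m≤n⇒m≤1+n j<n))) (e n (ℕP.n<1+n n))

sumTo-shift : ∀ (f : ℕ → ℤ) c n → sumTo n (λ j → f j ℤ.+ c) ≡ sumTo n f ℤ.+ + n ℤ.* c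
sumTo-shift f c zero = sym (trans (ℤP.+-identityˡ _) (ℤP.*-zeroˡ c))
sumTo-shift f c (suc n) = trans (cong (ℤ._+ (f n ℤ.+ c)) (sumTo-shift f c n))
  (S.solve 4 (λ s n c x → (s S.:+ n S.:* c) S.:+ (x S.:+ c) S.:=
      (s S.:+ x) S.:+ (S.con 1ℤ S.:+ n) S.:* c) refl (sumTo n f) (+ n) c (f n))

sumTo-neg : ∀ (f : ℕ → ℤ) n → sumTo n (λ j → ℤ.- f j) ≡ ℤ.- sumTo n f
sumTo-neg f zero = refl
sumTo-neg f (suc n) = trans (cong (ℤ._+ (ℤ.- f n)) (sumTo-neg f n)) (sym (ℤP.neg-distrib-+ (sumTo n f) (f n)))

module _ {H : ℕ} .{{_ : ℕ.NonZero H}} (X : ℤ) where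
  private
    f : ℕ → ℤ
    f = roundings X H

  -- Levels s′ and sH − s′ are paired.
  period-sum : ∀ s n → suc n ≡ s ℕ.* H → sumTo n f ≡ + n ℤ.* (X ℤ.* + s)
  period-sum s n e = ℤP.*-cancelˡ-≡ (+ 2) (sumTo n f) (+ n ℤ.* (X ℤ.* + s)) (trans
    (S.solve 1 (λ t → S.con (+ 2) S.:* t S.:= t S.:+ t) refl (sumTo n f))
    (trans (cong (λ t → sumTo n f ℤ.+ t) (trans (sym (sumTo-reverse f n)) (trans (sumTo-cong< n reflect)
      (trans (sumTo-shift (λ j → ℤ.- f j) (+ 2 ℤ.* (X ℤ.* + s)) n) (cong (ℤ._+ + n ℤ.* (+ 2 ℤ.* (X ℤ.* + s))) (sumTo-neg f n))))))
      (S.solve 3 (λ t n c → t S.:+ ((S.:- t) S.:+ n S.:* (S.con (+ 2) S.:* c)) S.:=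
          S.con (+ 2) S.:* (n S.:* c)) refl (sumTo n f) (+ n) (X ℤ.* + s))))
    where
    reflect : ∀ j → j ℕ.< n → f (n ℕ.∸ suc j) ≡ ℤ.- f j ℤ.+ + 2 ℤ.* (X ℤ.* + s)
    reflect j j<n = trans (term≡ X (n ℕ.∸ suc j)) (trans (cong rounding position)
      (trans (rounding-reflect (X ℤ.* + suc j) (X ℤ.* + s)) (trans (cong (λ t → + 2 ℤ.* (X ℤ.* + s) ℤ.- t) (sym (term≡ X j)))
        (ℤP.+-comm (+ 2 ℤ.* (X ℤ.* + s)) (ℤ.- f j)))))
      where
      position : X ℤ.* + suc (n ℕ.∸ suc j) ≡ (X ℤ.* + s) ℤ.* + H ℤ.- X ℤ.* + suc j
      position = trans (S.solve 3 (λ x a b → x S.:* a S.:=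
          x S.:* (a S.:+ b) S.:- x S.:* b) refl X (+ suc (n ℕ.∸ suc j)) (+ suc j))
        (trans (cong (λ t → X ℤ.* t ℤ.- X ℤ.* + suc j) (trans (cong +_ (trans (cong suc (ℕP.m∸n+n≡m j<n)) e)) (ℤP.pos-* s H)))
          (S.solve 4 (λ x s h y → x S.:* (s S.:* h) S.:- y S.:= (x S.:* s) S.:* h S.:- y) refl X (+ s) (+ H) (X ℤ.* + suc j)))

  -- The period sum leaves out the top level s H, where X s H / H is an integer and contributes 2 X
  -- s.
  multiple-sum : ∀ s n → suc n ≡ s ℕ.* H → sumTo (s ℕ.* H) f ≡ (X ℤ.* + s) ℤ.* (+ (s ℕ.* H) ℤ.+ 1ℤ)
  multiple-sum s n e = trans (cong (λ t → sumTo t f) (sym e)) (trans (cong₂ ℤ._+_ (period-sum s n e)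
      (trans (term≡ X n) (trans (rounding-half (X ℤ.* + suc n) (+ 2 ℤ.* (X ℤ.* + s)) (trans (cong (λ t → + 2 ℤ.* (X ℤ.* + t)) e)
        (trans (cong (λ t → + 2 ℤ.* (X ℤ.* t)) (ℤP.pos-* s H))
            (S.solve 3 (λ x s h → S.con (+ 2) S.:* (x S.:* (s S.:* h)) S.:=
            (S.con (+ 2) S.:* (x S.:* s)) S.:* h) refl X (+ s) (+ H))))) refl)))
    (trans (S.solve 2 (λ n c → n S.:* c S.:+ S.con (+ 2) S.:* c S.:=
        c S.:* ((S.con 1ℤ S.:+ n) S.:+ S.con 1ℤ)) refl (+ n) (X ℤ.* + s))
      (cong (λ t → (X ℤ.* + s) ℤ.* (+ t ℤ.+ 1ℤ)) e)))

  shifted-sum : ∀ m → sumTo m (λ j → f (H ℕ.+ j)) ≡ sumTo m f ℤ.+ + m ℤ.* (+ 2 ℤ.* X)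
  shifted-sum m = trans (sumTo-cong m (λ j → trans (term≡ X (H ℕ.+ j)) (trans (cong rounding (position j))
      (trans (rounding-shift (X ℤ.* + suc j) X) (cong (ℤ._+ + 2 ℤ.* X) (sym (term≡ X j))))))) (sumTo-shift f (+ 2 ℤ.* X) m)
    where
    position : ∀ j → X ℤ.* + suc (H ℕ.+ j) ≡ X ℤ.* + suc j ℤ.+ X ℤ.* + H
    position j = trans (cong (X ℤ.*_) (trans (cong +_ (trans
        (cong suc (ℕP.+-comm H j)) refl)) (ℤP.pos-+ (suc j) H))) (ℤP.*-distribˡ-+ X (+ suc j) (+ H))

difference : ∀ {W : List ℚ²} (i : LatticeEdge W) M →
  sumTo M (edge-weight i) ≡ sumTo M (roundings (LE.B i) (LE.H i) {{LE.H-nonZero i}}) ℤ.-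
    sumTo M (roundings (LE.A i) (LE.H i) {{LE.H-nonZero i}})
difference i M = sym (trans (cong (λ t → sumTo M (roundings B H) ℤ.+ t) (sym (sumTo-neg (roundings A H) M)))
  (sumTo-+ (roundings B H) (λ j → ℤ.- roundings A H j) M))
  where open LatticeEdge i

module _ {W : List ℚ²} (i : LatticeEdge W) where
  open LatticeEdge i

  private
    weight : ℕ → ℤ
    weight M = sumTo M (edge-weight i)

    spread : B ℤ.- A ≡ + L
    spread = trans (cong (ℤ._- A) B≡A+L) (S.solve 2 (λ a l → (a S.:+ l) S.:- a S.:= l) refl A (+ L))

    factor : ∀ c → B ℤ.* c ℤ.- A ℤ.* c ≡ + L ℤ.* c
    factor c = trans (S.solve 3 (λ a b c → b S.:* c S.:- a S.:* c S.:= (b S.:- a) S.:* c) refl A B c) (cong (ℤ._* c) spread)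

    1≤H : 1 ℕ.≤ H
    1≤H = ℕP.n≢0⇒n>0 H≢0

  weight-multiple : ∀ s → weight (suc s ℕ.* H) ≡ + L ℤ.* (+ suc s ℤ.* (+ (suc s ℕ.* H) ℤ.+ 1ℤ))
  weight-multiple s = trans (difference i (suc s ℕ.* H)) (trans
      (cong₂ ℤ._-_ (multiple-sum B (suc s) n e) (multiple-sum A (suc s) n e))
    (trans (cong₂ ℤ._-_ (ℤP.*-assoc B (+ suc s) (+ (suc s ℕ.* H) ℤ.+ 1ℤ)) (ℤP.*-assoc A (+ suc s) (+ (suc s ℕ.* H) ℤ.+ 1ℤ)))
        (factor (+ suc s ℤ.* (+ (suc s ℕ.* H) ℤ.+ 1ℤ)))))
    where
    n = ℕ.pred (suc s ℕ.* H)
    e : suc n ≡ suc s ℕ.* H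
    e = ℕP.suc-pred (suc s ℕ.* H) {{ℕ.>-nonZero (ℕP.≤-trans 1≤H (ℕP.m≤m+n H (s ℕ.* H)))}}

  -- Raising the level by H adds the integer X to the quotient that is rounded, so the first m
  -- levels recur with 2 L added on each. For m = ⌊H / 2⌋ this relates 3P to P.
  weight-shift : ∀ m → weight (H ℕ.+ m) ≡ + L ℤ.* (+ H ℤ.+ 1ℤ) ℤ.+ weight m ℤ.+ + 2 ℤ.* (+ L ℤ.* + m)
  weight-shift m = trans (sumTo-append (edge-weight i) H m) (trans (cong₂ ℤ._+_ whole rest)
    (sym (ℤP.+-assoc (+ L ℤ.* (+ H ℤ.+ 1ℤ)) (weight m) (+ 2 ℤ.* (+ L ℤ.* + m)))))
    where
    whole : weight H ≡ + L ℤ.* (+ H ℤ.+ 1ℤ)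
    whole = trans (cong weight (sym (ℕP.*-identityˡ H))) (trans (weight-multiple 0) (cong (λ t → + L ℤ.* t)
      (trans (ℤP.*-identityˡ (+ (1 ℕ.* H) ℤ.+ 1ℤ)) (cong (λ t → + t ℤ.+ 1ℤ) (ℕP.*-identityˡ H)))))
    rest : sumTo m (λ j → edge-weight i (H ℕ.+ j)) ≡ weight m ℤ.+ + 2 ℤ.* (+ L ℤ.* + m)
    rest = trans (sym (sumTo-+ (λ j → roundings B H (H ℕ.+ j)) (λ j → ℤ.- roundings A H (H ℕ.+ j)) m))
      (trans (cong₂ ℤ._+_ (shifted-sum B m) (trans (sumTo-neg (λ j → roundings A H (H ℕ.+ j)) m) (cong ℤ.-_ (shifted-sum A m))))
        (trans (S.solve 5 (λ x y m a b → (x S.:+ m S.:* (S.con (+ 2) S.:* b)) S.:+ (S.:- (y S.:+ m S.:*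
            (S.con (+ 2) S.:* a))) S.:=
            (x S.:- y) S.:+ S.con (+ 2) S.:* (b S.:* m S.:- a S.:* m)) refl (sumTo m (roundings B H)) (sumTo m
                (roundings A H)) (+ m) A B)
          (cong₂ (λ s t → s ℤ.+ + 2 ℤ.* t) (sym (difference i m)) (factor (+ m)))))

  -- The levels below H are those of the interior of 2P; only the paired levels of one period occur.
  weight-below-period : ∀ n → suc n ≡ H → weight n ≡ + L ℤ.* + n
  weight-below-period n e = trans (difference i n) (trans (cong₂ ℤ._-_ (period-sum B 1 n e′) (period-sum A 1 n e′))
    (trans (S.solve 3 (λ a b n → n S.:* (b S.:* S.con 1ℤ) S.:- n S.:* (a S.:* S.con 1ℤ) S.:=
        b S.:* n S.:- a S.:* n) refl A B (+ n)) (factor (+ n))))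
    where
    e′ : suc n ≡ 1 ℕ.* H
    e′ = trans e (sym (ℕP.*-identityˡ H))

  -- The top level consists of the lattice points on the edge itself.
  weight-edge : ∀ m → H ≡ 2 ℕ.* suc m → weight (suc m) ≡ weight m ℤ.+ + L
  weight-edge m e = cong (λ t → weight m ℤ.+ t) (trans (cong₂ ℤ._-_ (at B) (at A)) spread)
    where
    at : ∀ X → roundings X H m ≡ X
    at X = trans (term≡ X m) (rounding-half (X ℤ.* + suc m) X (trans
      (S.solve 2 (λ x m → S.con (+ 2) S.:* (x S.:* m) S.:= x S.:* (S.con (+ 2) S.:* m)) refl X (+ suc m))
      (cong (X ℤ.*_) (trans (sym (ℤP.pos-* 2 (suc m))) (cong +_ (sym e))))))

  -- For H = 2 every quotient is a half-integer, so the rounding is exact and level s carries the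
  -- weight L s.
  weight-unit-height : H ≡ 2 → ∀ t → + 2 ℤ.* weight t ≡ + L ℤ.* (+ t ℤ.* (+ t ℤ.+ 1ℤ))
  weight-unit-height e zero = sym (ℤP.*-zeroʳ (+ L))
  weight-unit-height e (suc t) = trans (ℤP.*-distribˡ-+ (+ 2) (weight t) (edge-weight i t))
    (trans (cong₂ (λ x y → x ℤ.+ + 2 ℤ.* y) (weight-unit-height e t) (trans (cong₂ ℤ._-_ (at B) (at A)) (factor (+ suc t))))
      (S.solve 2 (λ l t → l S.:* (t S.:* (t S.:+ S.con 1ℤ)) S.:+ S.con (+ 2) S.:* (l S.:* (S.con 1ℤ S.:+ t)) S.:=
        l S.:* ((S.con 1ℤ S.:+ t) S.:* ((S.con 1ℤ S.:+ t) S.:+ S.con 1ℤ))) refl (+ L) (+ t)))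
    where
    at : ∀ X → roundings X H t ≡ X ℤ.* + suc t
    at X = trans (term≡ X t) (rounding-half (X ℤ.* + suc t) (X ℤ.* + suc t) (trans (ℤP.*-comm (+ 2) (X ℤ.* + suc t))
        (cong (λ h → X ℤ.* + suc t ℤ.* + h) (sym e))))

module _ {I : Set} where
  sumOver-zero : ∀ {f : I → ℤ} L → (∀ {i} → i ∈ L → 0ℤ ℤ.≤ f i) → sumOver f L ≡ 0ℤ → ∀ {i} → i ∈ L → f i ≡ 0ℤ
  sumOver-zero {f} (i ∷ L) nonNeg e = λ { (here refl) → head ; (there i∈) → sumOver-zero L (nonNeg ∘ there) tail i∈ }
    where
    rest≥0 : ∀ L → (∀ {i} → i ∈ L → 0ℤ ℤ.≤ f i) → 0ℤ ℤ.≤ sumOver f L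
    rest≥0 [] _ = ℤP.≤-refl
    rest≥0 (i ∷ L) nonNeg = ℤP.+-mono-≤ (nonNeg (here refl)) (rest≥0 L (nonNeg ∘ there))
    head : f i ≡ 0ℤ
    head = ℤP.≤-antisym (subst₂ ℤ._≤_ (ℤP.+-identityʳ (f i)) e (ℤP.+-monoʳ-≤ (f i) (rest≥0 L (nonNeg ∘ there)))) (nonNeg
        (here refl))
    tail : sumOver f L ≡ 0ℤ
    tail = trans (sym (ℤP.+-identityˡ (sumOver f L))) (trans (cong (ℤ._+ sumOver f L) (sym head)) e)

  sumOver-* : ∀ c (f : I → ℤ) L → sumOver (λ i → c ℤ.* f i) L ≡ c ℤ.* sumOver f L
  sumOver-* c f [] = sym (ℤP.*-zeroʳ c)
  sumOver-* c f (i ∷ L) = trans (cong (λ t → c ℤ.* f i ℤ.+ t) (sumOver-* c f L)) (sym (ℤP.*-distribˡ-+ c (f i) (sumOver f L)))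

  sumOver-minus : ∀ (f g : I → ℤ) L → sumOver (λ i → f i ℤ.- g i) L ≡ sumOver f L ℤ.- sumOver g L
  sumOver-minus f g [] = refl
  sumOver-minus f g (i ∷ L) = trans (cong (λ t → (f i ℤ.- g i) ℤ.+ t) (sumOver-minus f g L))
    (S.solve 4 (λ a b s t → (a S.:- b) S.:+ (s S.:- t) S.:=
        (a S.:+ s) S.:- (b S.:+ t)) refl (f i) (g i) (sumOver f L) (sumOver g L))

-- Criteria for all edges to have lattice distance one

-- M is ⌊n / 2⌋ in the first case and the largest integer strictly below n / 2 in the second; the
-- parity ε as a witness keeps the arithmetic linear.
IsFloorHalf IsFloorHalf< : ℕ → ℕ → Set
IsFloorHalf n M = Σ ℕ λ ε → ε ℕ.≤ 1 × n ≡ ε ℕ.+ 2 ℕ.* M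
IsFloorHalf< n M = Σ ℕ λ ε → ε ℕ.≤ 1 × n ≡ suc ε ℕ.+ 2 ℕ.* M

level-cap : ∀ {n ε M} → ε ℕ.≤ 1 → n ≡ ε ℕ.+ 2 ℕ.* M → ∀ l → + 2 ℤ.* l ℤ.≤ + n ⇔ l ℤ.≤ + M
level-cap {n} {ε} {M} ε≤1 refl l = mk⇔
  (λ le → subst (l ℤ.≤_) (ℤP.pred-suc (+ M)) (ℤP.i<j⇒i≤pred[j] {i = l} {j = + suc M} (ℤP.*-cancelˡ-<-nonNeg {i = l} {j =
      + suc M} (+ 2)
    (ℤP.≤-<-trans le (subst (+ (ε ℕ.+ 2 ℕ.* M) ℤ.<_) (ℤP.pos-* 2 (suc M)) (ℤ.+<+ (subst (ε ℕ.+ 2 ℕ.* M ℕ.<_)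
        (sym (ℕP.*-suc 2 M)) (ℕP.+-monoˡ-< (2 ℕ.* M) (ℕ.s≤s ε≤1)))))))))
  (λ l≤M → ℤP.≤-trans (ℤP.*-monoˡ-≤-nonNeg (+ 2) l≤M)
      (subst (ℤ._≤ + (ε ℕ.+ 2 ℕ.* M)) (ℤP.pos-* 2 M) (ℤ.+≤+ (ℕP.m≤n+m (2 ℕ.* M) ε))))

level-cap< : ∀ {n ε M} → ε ℕ.≤ 1 → n ≡ suc ε ℕ.+ 2 ℕ.* M → ∀ l → + 2 ℤ.* l ℤ.< + n ⇔ l ℤ.≤ + M
level-cap< {n} {ε} {M} ε≤1 refl l = mk⇔
  (λ lt → to (level-cap {ε = ε} {M} ε≤1 refl l) (subst (+ 2 ℤ.* l ℤ.≤_) (ℤP.pred-suc (+ (ε ℕ.+ 2 ℕ.* M))) (ℤP.i<j⇒i≤pred[j] lt)))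
  (λ l≤M → ℤP.≤-<-trans (from (level-cap {ε = ε} {M} ε≤1 refl l) l≤M) (ℤ.+<+ (ℕP.n<1+n (ε ℕ.+ 2 ℕ.* M))))

opaque
  unfolding ι embed
  ι-ℕ : ∀ k → ι (+ k) ≡ ℕ→ℚ k
  ι-ℕ _ = refl

ι-injective : ∀ {a b} → ι a ≡ ι b → a ≡ b
ι-injective e = ℤP.≤-antisym (ι-cancel-≤ (ℚP.≤-reflexive e)) (ι-cancel-≤ (ℚP.≤-reflexive (sym e)))

card-one : ∀ {A : Set} {T : A → Set} → Card T 1ℤ → ∀ {a b} → T a → T b → a ≡ b
card-one (x ∷ [] , _ , _ , mem) {a} {b} ta tb with from (mem a) ta | from (mem b) tb
... | here refl | here refl = refl

module Heights {V W : List ℚ²} (poly : Polygon W) (W⊆V : ∀ {x} → x ∈ W → x ∈ V)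
  (below : ∀ {n c} → 0ℚ ≤ c → Below W n c → Below V n c) (edges : LatticeEdges W) where
  open RegionOf poly W⊆V below public
  open Faces poly public
  open LatticeEdges edges public using (I; every)

  H L : LatticeEdge W → ℕ
  H = LE.H
  L = LE.L

  module Dilated (k : ℕ) {R : ℤ² → Set} (R⇔In : ∀ z → R z ⇔ In (ℕ→ℚ k) (embed z)) (M : LatticeEdge W → ℕ)
    (cap : ∀ i → IsFloorHalf (k ℕ.* H i) (M i)) where

    open Counting poly edges {R}
      (from (R⇔In (0ℤ , 0ℤ)) (λ {v} {w} e → subst₂ _≤_ (sym (trans
          (cong (λ x → dot x (normal v w)) embed-origin) (dot-origin (normal v w)))) refl
        (nonNeg*nonNeg (ℕ→ℚ-nonNeg k) (ℚP.<⇒≤ (ed-pos e))))) M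
      (λ i z t h pos → mk⇔
        (λ r → to (level-cap (proj₁ (proj₂ (cap i))) (proj₂ (proj₂ (cap i))) (LE.level i z))
            (subst (+ 2 ℤ.* LE.level i z ℤ.≤_) (sym (ℤP.pos-* k (H i)))
          (to (LE.height-≤ i (+ k) z) (subst (λ c → LE.edge-height i (embed z) ≤ c * LE.edge-det i)
              (sym (ι-ℕ k)) (to (R⇔In z) r (LE.edge i))))))
        (λ le → from (R⇔In z) (sector-In {c = ℕ→ℚ k} {x = embed z} (LE.edge i) t h
          (subst (λ c → LE.edge-height i (embed z) ≤ c * LE.edge-det i) (ι-ℕ k)
            (from (LE.height-≤ i (+ k) z) (subst (+ 2 ℤ.* LE.level i z ℤ.≤_) (ℤP.pos-* k (H i))
              (from (level-cap (proj₁ (proj₂ (cap i))) (proj₂ (proj₂ (cap i))) (LE.level i z)) le)))))))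
      public using (count-left; count-doubled)

  module Interior (k : ℕ) {R : ℤ² → Set} (R⇔In< : ∀ z → R z ⇔ In< (ℕ→ℚ (suc k)) (embed z)) (M : LatticeEdge W → ℕ)
    (cap : ∀ i → IsFloorHalf< (suc k ℕ.* H i) (M i)) where

    open Counting poly edges {R}
      (from (R⇔In< (0ℤ , 0ℤ)) (λ {v} {w} e → subst (λ x → height v w x < ℕ→ℚ (suc k) * cross v w)
          (sym embed-origin) (origin-In< (ℕ→ℚ-pos k) e))) M
      (λ i z t h pos → mk⇔
        (λ r → to (level-cap< (proj₁ (proj₂ (cap i))) (proj₂ (proj₂ (cap i))) (LE.level i z))
            (subst (+ 2 ℤ.* LE.level i z ℤ.<_) (sym (ℤP.pos-* (suc k) (H i)))
          (to (LE.height-< i (+ suc k) z) (subst (λ c → LE.edge-height i (embed z) < c * LE.edge-det i)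
              (sym (ι-ℕ (suc k))) (to (R⇔In< z) r (LE.edge i))))))
        (λ le → from (R⇔In< z) (sector-In< {c = ℕ→ℚ (suc k)} {x = embed z} (LE.edge i) t h
          (subst (λ c → LE.edge-height i (embed z) < c * LE.edge-det i) (ι-ℕ (suc k))
            (from (LE.height-< i (+ suc k) z) (subst (+ 2 ℤ.* LE.level i z ℤ.<_) (ℤP.pos-* (suc k) (H i))
              (from (level-cap< (proj₁ (proj₂ (cap i))) (proj₂ (proj₂ (cap i))) (LE.level i z)) le)))))))
      public using (count-left; count-doubled)

  -- H = 1 + e + 2m with e ≤ 1, so that m and m + e are the numbers of levels strictly, resp. weakly, below H / 2.
  m e : LatticeEdge W → ℕ
  m i = ℕ.pred (H i) ℕ./ 2
  e i = ℕ.pred (H i) ℕ.% 2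

  e≤1 : ∀ i → e i ℕ.≤ 1
  e≤1 i = ℕP.≤-pred (m%n<n (ℕ.pred (H i)) 2)

  H≡ : ∀ i → H i ≡ suc (e i) ℕ.+ 2 ℕ.* m i
  H≡ i = trans (sym (ℕP.suc-pred (H i) {{LE.H-nonZero i}})) (cong suc (trans (m≡m%n+[m/n]*n (ℕ.pred (H i)) 2)
      (cong (e i ℕ.+_) (ℕP.*-comm (m i) 2))))

  H≡ℤ : ∀ i → + H i ≡ 1ℤ ℤ.+ + e i ℤ.+ + 2 ℤ.* + m i
  H≡ℤ i = trans (cong +_ (H≡ i)) (cong (λ t → + suc (e i) ℤ.+ t) (ℤP.pos-* 2 (m i)))

  -- Condition (2) in integers, as H is twice the lattice distance. The counting conditions are all
  -- compared with this one.
  TwoHeights : Set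
  TwoHeights = ∀ {i} → i ∈ I → H i ≡ 2

  -- `ΣL` is twice the lattice length of the boundary and `ΣLH` eight times the area. In `ΣLh` the
  -- factor is ⌊H / 2⌋, and in `ΣLe` it is 1 exactly for even H.
  ΣL ΣLH ΣLh ΣLe : ℤ
  ΣL = sumOver (λ i → + L i) I
  ΣLH = sumOver (λ i → + L i ℤ.* + H i) I
  ΣLh = sumOver (λ i → + L i ℤ.* + (m i ℕ.+ e i)) I
  ΣLe = sumOver (λ i → + L i ℤ.* + e i) I

  private
    cancel-L : ∀ i {x} → + L i ℤ.* x ≡ 0ℤ → x ≡ 0ℤ
    cancel-L i {x} eq = ℤP.*-cancelˡ-≡ (+ L i) x 0ℤ {{ℤ.≢-nonZero (λ z → LE.L≢0 i (ℤP.+-injective z))}} (trans eq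
        (sym (ℤP.*-zeroʳ (+ L i))))

    nonNeg-L : ∀ i {n x} → x ≡ + n → 0ℤ ℤ.≤ + L i ℤ.* x
    nonNeg-L i {n} refl = subst (0ℤ ℤ.≤_) (ℤP.pos-* (L i) n) (ℤ.+≤+ ℕ.z≤n)

    -- Equality with a natural number n certifies that the factor f is nonnegative; as L > 0, a
    -- vanishing sum then forces every factor to vanish.
    pointwise : (f : LatticeEdge W → ℤ) → (n : LatticeEdge W → ℕ) → (∀ {i} → i ∈ I → f i ≡ + n i) →
      sumOver (λ i → + L i ℤ.* f i) I ≡ 0ℤ → ∀ {i} → i ∈ I → f i ≡ 0ℤ
    pointwise f n f≡ total {i} i∈ = cancel-L i (sumOver-zero I (λ {i} i∈ → nonNeg-L i (f≡ i∈)) total i∈)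

    two-if : ∀ i → e i ≡ 1 → m i ≡ 0 → H i ≡ 2
    two-if i e≡1 m≡0 = trans (H≡ i) (cong₂ (λ a b → suc a ℕ.+ 2 ℕ.* b) e≡1 m≡0)

    minus-sum : (f g : LatticeEdge W → ℤ) → sumOver f I ≡ sumOver g I → ∀ h → (∀ i → h i ≡ f i ℤ.- g i) → sumOver h I ≡ 0ℤ
    minus-sum f g eq h h≡ = trans (sumOver-cong I (λ {i} _ → h≡ i)) (trans (sumOver-minus f g I)
      (trans (cong (ℤ._- sumOver g I) eq) (ℤP.+-inverseʳ (sumOver g I))))

    double-sum : ∀ f → + 2 ℤ.* sumOver f I ≡ sumOver (λ i → + 2 ℤ.* f i) I
    double-sum f = sym (sumOver-* (+ 2) f I)

  -- For even H the factor H - 2 equals 2 m.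
  even-two : (∀ {i} → i ∈ I → e i ≡ 1) → ΣLH ≡ + 2 ℤ.* ΣL → TwoHeights
  even-two even eq {i} i∈ = two-if i (even i∈) (ℕP.m+n≡0⇒m≡0 (m i) (ℤP.+-injective (trans
      (sym (f≡ i∈)) (pointwise (λ i → + H i ℤ.- + 2) (λ i → m i ℕ.+ m i) f≡ total i∈))))
    where
    f≡ : ∀ {i} → i ∈ I → + H i ℤ.- + 2 ≡ + (m i ℕ.+ m i)
    f≡ {i} i∈ = trans (cong (ℤ._- + 2) (H≡ℤ i)) (trans (cong (λ t → 1ℤ ℤ.+ + t ℤ.+ + 2 ℤ.* + m i ℤ.- + 2) (even i∈))
      (S.solve 1 (λ m → S.con 1ℤ S.:+ S.con 1ℤ S.:+ S.con (+ 2) S.:* m S.:- S.con (+ 2) S.:= m S.:+ m) refl (+ m i)))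
    total : sumOver (λ i → + L i ℤ.* (+ H i ℤ.- + 2)) I ≡ 0ℤ
    total = minus-sum (λ i → + L i ℤ.* + H i) (λ i → + 2 ℤ.* + L i) (trans eq (double-sum (λ i → + L i))) _
      (λ i → S.solve 2 (λ l h → l S.:* (h S.:- S.con (+ 2)) S.:= l S.:* h S.:- S.con (+ 2) S.:* l) refl (+ L i) (+ H i))

  -- H - 2 ⌊H / 2⌋ equals 1 - e, the remainder of H modulo 2.
  all-even : ΣLH ≡ + 2 ℤ.* ΣLh → ∀ {i} → i ∈ I → e i ≡ 1
  all-even eq {i} i∈ = ℕP.≤-antisym (e≤1 i) (ℕP.m∸n≡0⇒m≤n (ℤP.+-injective (trans
      (sym (f≡ i)) (pointwise f (λ i → 1 ℕ.∸ e i) (λ {i} _ → f≡ i) total i∈))))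
    where
    f : LatticeEdge W → ℤ
    f i = + H i ℤ.- + 2 ℤ.* + (m i ℕ.+ e i)
    f≡ : ∀ i → f i ≡ + (1 ℕ.∸ e i)
    f≡ i = trans (cong₂ (λ s t → s ℤ.- + 2 ℤ.* t) (H≡ℤ i) (ℤP.pos-+ (m i) (e i)))
      (trans (S.solve 2 (λ e m → S.con 1ℤ S.:+ e S.:+ S.con (+ 2) S.:* m S.:- S.con (+ 2) S.:* (m S.:+ e) S.:=
          S.con 1ℤ S.:- e) refl (+ e i) (+ m i))
        (trans (ℤP.m-n≡m⊖n 1 (e i)) (ℤP.⊖-≥ (e≤1 i))))
    total : sumOver (λ i → + L i ℤ.* f i) I ≡ 0ℤ
    total = minus-sum (λ i → + L i ℤ.* + H i) (λ i → + 2 ℤ.* (+ L i ℤ.* + (m i ℕ.+ e i)))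
        (trans eq (double-sum (λ i → + L i ℤ.* + (m i ℕ.+ e i)))) _
      (λ i → S.solve 3 (λ l h k → l S.:* (h S.:- S.con (+ 2) S.:* k) S.:=
          l S.:* h S.:- S.con (+ 2) S.:* (l S.:* k)) refl (+ L i) (+ H i) (+ (m i ℕ.+ e i)))

  -- H + 2 - 4 e equals 3 (1 - e) + 2 m, which vanishes only for e = 1 and m = 0.
  edge-sum-two : ΣLH ℤ.+ + 2 ℤ.* ΣL ≡ + 4 ℤ.* ΣLe → TwoHeights
  edge-sum-two eq {i} i∈ = two-if i e≡1 m≡0
    where
    f : LatticeEdge W → ℤ
    f i = + H i ℤ.+ + 2 ℤ.- + 4 ℤ.* + e i
    slack : LatticeEdge W → ℕ
    slack i = 3 ℕ.* (1 ℕ.∸ e i) ℕ.+ 2 ℕ.* m i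
    f≡ : ∀ i → f i ≡ + slack i
    f≡ i = trans (cong (λ t → t ℤ.+ + 2 ℤ.- + 4 ℤ.* + e i) (H≡ℤ i))
      (trans (S.solve 2 (λ e m → S.con 1ℤ S.:+ e S.:+ S.con (+ 2) S.:* m S.:+ S.con (+ 2) S.:- S.con (+ 4) S.:* e S.:=
          S.con (+ 3) S.:* (S.con 1ℤ S.:- e) S.:+ S.con (+ 2) S.:* m) refl (+ e i) (+ m i))
        (sym (trans (ℤP.pos-+ (3 ℕ.* (1 ℕ.∸ e i)) (2 ℕ.* m i)) (cong₂ ℤ._+_ (trans (ℤP.pos-* 3 (1 ℕ.∸ e i)) (cong (+ 3 ℤ.*_)
            (sym (trans (ℤP.m-n≡m⊖n 1 (e i)) (ℤP.⊖-≥ (e≤1 i)))))) (ℤP.pos-* 2 (m i))))))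
    total : sumOver (λ i → + L i ℤ.* f i) I ≡ 0ℤ
    total = minus-sum (λ i → + L i ℤ.* + H i ℤ.+ + 2 ℤ.* + L i) (λ i → + 4 ℤ.* (+ L i ℤ.* + e i))
      (trans (trans (sym (sumOver-+ (λ i → + L i ℤ.* + H i) (λ i → + 2 ℤ.* + L i) I))
          (cong (λ t → ΣLH ℤ.+ t) (sumOver-* (+ 2) (λ i → + L i) I)))
        (trans eq (sym (sumOver-* (+ 4) (λ i → + L i ℤ.* + e i) I)))) _
      (λ i → S.solve 3 (λ l h e → l S.:* (h S.:+ S.con (+ 2) S.:- S.con (+ 4) S.:* e) S.:=
          (l S.:* h S.:+ S.con (+ 2) S.:* l) S.:- S.con (+ 4) S.:* (l S.:* e)) refl (+ L i) (+ H i) (+ e i))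
    slack≡0 : slack i ≡ 0
    slack≡0 = ℤP.+-injective (trans (sym (f≡ i)) (pointwise f slack (λ {i} _ → f≡ i) total i∈))
    e≡1 : e i ≡ 1
    e≡1 = ℕP.≤-antisym (e≤1 i) (ℕP.m∸n≡0⇒m≤n (ℕP.m+n≡0⇒m≡0 (1 ℕ.∸ e i) (ℕP.m+n≡0⇒m≡0 (3 ℕ.* (1 ℕ.∸ e i)) slack≡0)))
    m≡0 : m i ≡ 0
    m≡0 = ℕP.m+n≡0⇒m≡0 (m i) (ℕP.m+n≡0⇒n≡0 (3 ℕ.* (1 ℕ.∸ e i)) slack≡0)

-- Polynomials over ℚ

zero-product : ∀ {a b} → a ≢ 0ℚ → a * b ≡ 0ℚ → b ≡ 0ℚ
zero-product {a} {b} a≢0 ab≡0 = zero-cancel (square-pos a≢0) (trans (ℚP.*-assoc a a b) (trans (cong (a *_) ab≡0) (ℚP.*-zeroʳ a)))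

-- Synthetic division by x - a: the coefficients are the intermediate values of Horner's scheme.
quotient : ℚ → List ℚ → List ℚ
quotient a [] = []
quotient a (c ∷ []) = []
quotient a (c ∷ cs@(_ ∷ _)) = evalPoly cs a ∷ quotient a cs

quotient-length : ∀ a c cs → length (quotient a (c ∷ cs)) ≡ length cs
quotient-length a c [] = refl
quotient-length a c (c′ ∷ cs) = cong suc (quotient-length a c′ cs)

division : ∀ a cs x → evalPoly cs x ≡ evalPoly cs a + (x - a) * evalPoly (quotient a cs) x
division a [] x = solve 2 (λ a x → con 0ℚ := con 0ℚ :+ (x :- a) :* con 0ℚ) refl a x
division a (c ∷ []) x = solve 3 (λ a c x → c :+ x :* con 0ℚ := (c :+ a :* con 0ℚ) :+ (x :- a) :* con 0ℚ) refl a c x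
division a (c ∷ cs@(_ ∷ _)) x = trans (cong (λ t → c + x * t) (division a cs x))
  (solve 5 (λ a c x p q → c :+ x :* (p :+ (x :- a) :* q) :=
      (c :+ a :* p) :+ (x :- a) :* (p :+ x :* q)) refl a c x (evalPoly cs a) (evalPoly (quotient a cs) x))

-- Dividing by x - r 0 shortens the coefficient list, and the quotient still vanishes at the points
-- r (suc s), which differ from r 0.
vanishing : ∀ cs (r : ℕ → ℚ) → (∀ {s t} → r s ≡ r t → s ≡ t) → (∀ s → evalPoly cs (r s) ≡ 0ℚ) → ∀ x → evalPoly cs x ≡ 0ℚ
vanishing cs r = go (length cs) cs refl r
  where
  go : ∀ n cs → length cs ≡ n → (r : ℕ → ℚ) → (∀ {s t} → r s ≡ r t → s ≡ t) → (∀ s → evalPoly cs (r s) ≡ 0ℚ) → ∀ x →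
      evalPoly cs x ≡ 0ℚ
  go n [] len r injective zeros x = refl
  go (suc n) (c ∷ cs) len r injective zeros x = trans (factor x) (trans (cong ((x - r 0) *_)
      (go n q (trans (quotient-length (r 0) c cs) (ℕP.suc-injective len)) (r ∘ suc) (λ e →
          ℕP.suc-injective (injective e)) q-zeros x)) (ℚP.*-zeroʳ (x - r 0)))
    where
    q = quotient (r 0) (c ∷ cs)
    factor : ∀ x → evalPoly (c ∷ cs) x ≡ (x - r 0) * evalPoly q x
    factor x = trans (division (r 0) (c ∷ cs) x) (trans (cong (_+ (x - r 0) * evalPoly q x) (zeros 0)) (ℚP.+-identityˡ _))
    q-zeros : ∀ s → evalPoly q (r (suc s)) ≡ 0ℚ
    q-zeros s = zero-product distinct (trans (sym (factor (r (suc s)))) (zeros (suc s)))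
      where
      distinct : r (suc s) - r 0 ≢ 0ℚ
      distinct e = absurd (injective (trans (solve 2 (λ a b → a := b :+ (a :- b)) refl (r (suc s)) (r 0)) (trans
          (cong (λ t → r 0 + t) e) (ℚP.+-identityʳ (r 0)))))
        where
        absurd : suc s ≢ 0
        absurd ()

scalePoly : ℚ → List ℚ → List ℚ
scalePoly k = map (k *_)

evalPoly-scale : ∀ k cs x → evalPoly (scalePoly k cs) x ≡ k * evalPoly cs x
evalPoly-scale k [] x = sym (ℚP.*-zeroʳ k)
evalPoly-scale k (c ∷ cs) x = trans (cong (λ t → k * c + x * t) (evalPoly-scale k cs x))
  (solve 4 (λ k c x p → k :* c :+ x :* (k :* p) := k :* (c :+ x :* p)) refl k c x (evalPoly cs x))

addPoly : List ℚ → List ℚ → List ℚ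
addPoly [] ds = ds
addPoly (c ∷ cs) [] = c ∷ cs
addPoly (c ∷ cs) (d ∷ ds) = c + d ∷ addPoly cs ds

evalPoly-add : ∀ cs ds x → evalPoly (addPoly cs ds) x ≡ evalPoly cs x + evalPoly ds x
evalPoly-add [] ds x = sym (ℚP.+-identityˡ (evalPoly ds x))
evalPoly-add (c ∷ cs) [] x = sym (ℚP.+-identityʳ (evalPoly (c ∷ cs) x))
evalPoly-add (c ∷ cs) (d ∷ ds) x = trans (cong (λ t → (c + d) + x * t) (evalPoly-add cs ds x))
  (solve 5 (λ c d x p q → (c :+ d) :+ x :* (p :+ q) := (c :+ x :* p) :+ (d :+ x :* q)) refl c d x (evalPoly cs x) (evalPoly ds x))

agreement : ∀ cs ds (r : ℕ → ℚ) → (∀ {s t} → r s ≡ r t → s ≡ t) → (∀ s → evalPoly cs (r s) ≡ evalPoly ds (r s)) →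
  ∀ x → evalPoly cs x ≡ evalPoly ds x
agreement cs ds r injective agree x = trans
    (solve 2 (λ a b → a := (a :+ (:- con 1ℚ) :* b) :+ b) refl (evalPoly cs x) (evalPoly ds x))
  (trans (cong (_+ evalPoly ds x) (trans (sym (difference-eval x)) (vanishing diff r injective zeros x))) (ℚP.+-identityˡ
      (evalPoly ds x)))
  where
  diff = addPoly cs (scalePoly (- 1ℚ) ds)
  difference-eval : ∀ x → evalPoly diff x ≡ evalPoly cs x + (- 1ℚ) * evalPoly ds x
  difference-eval x = trans (evalPoly-add cs (scalePoly (- 1ℚ) ds) x)
      (cong (λ t → evalPoly cs x + t) (evalPoly-scale (- 1ℚ) ds x))
  zeros : ∀ s → evalPoly diff (r s) ≡ 0ℚ
  zeros s = trans (difference-eval (r s)) (trans (cong (_+ (- 1ℚ) * evalPoly ds (r s)) (agree s))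
    (solve 1 (λ a → a :+ (:- con 1ℚ) :* a := con 0ℚ) refl (evalPoly ds (r s))))

ℕ→ℚ-injective : ∀ {a b} → ℕ→ℚ a ≡ ℕ→ℚ b → a ≡ b
ℕ→ℚ-injective {a} {b} e = ℤP.+-injective (ι-injective (trans (ι-ℕ a) (trans e (sym (ι-ℕ b)))))

-- Dilates and interiors in terms of the edge sums

quadratic : ℚ → ℚ → ℚ
quadratic A x = (A * (x * x)) + ((A * x) + 1ℚ)

module Counts {V W : List ℚ²} (poly : Polygon W) (W⊆V : ∀ {x} → x ∈ W → x ∈ V)
  (below : ∀ {n c} → 0ℚ ≤ c → Below W n c → Below V n c) (edges : LatticeEdges W) where
  open Heights poly W⊆V below edges public

  dil : ∀ k z → Dil k P (emb z) ⇔ In (ℕ→ℚ k) (embed z)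
  dil k z = subst (λ x → Dil k P x ⇔ In (ℕ→ℚ k) (embed z)) (embed≡emb z) (Dil⇔In k (embed z))

  int-dil : ∀ k z → Int (Dil k P) (emb z) ⇔ In< (ℕ→ℚ k) (embed z)
  int-dil k z = subst (λ x → Int (Dil k P) x ⇔ In< (ℕ→ℚ k) (embed z)) (embed≡emb z) (Int-Dil⇔In< k (embed z))

  int : ∀ z → Int P (emb z) ⇔ In< (ℕ→ℚ 1) (embed z)
  int z = subst (λ x → Int P x ⇔ In< (ℕ→ℚ 1) (embed z)) (embed≡emb z) (Int⇔In< (embed z))

  cap-one : ∀ i → IsFloorHalf (1 ℕ.* H i) (m i ℕ.+ e i)
  cap-one i = 1 ℕ.∸ e i , ℕP.m∸n≤m 1 (e i) , trans (ℕP.*-identityˡ (H i)) (trans (H≡ i) (trans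
      (cong (λ t → t ℕ.+ e i ℕ.+ 2 ℕ.* m i) (sym (ℕP.m∸n+n≡m (e≤1 i))))
    (T.solve 3 (λ a e m → (a T.:+ e T.:+ e T.:+ T.con 2 T.:* m) T.:=
        a T.:+ T.con 2 T.:* (m T.:+ e)) refl (1 ℕ.∸ e i) (e i) (m i))))

  -- ⌊3 H / 2⌋ is split as H + ⌊H / 2⌋, the form needed for `weight-shift`.
  cap-three : ∀ i → IsFloorHalf (3 ℕ.* H i) (H i ℕ.+ (m i ℕ.+ e i))
  cap-three i = let ε , ε≤1 , eq = cap-one i in ε , ε≤1 ,
    trans (T.solve 1 (λ h → T.con 3 T.:* h T.:= T.con 1 T.:* h T.:+ T.con 2 T.:* h) refl (H i))
      (trans (cong (ℕ._+ 2 ℕ.* H i) eq) (T.solve 3 (λ a h k → (a T.:+ T.con 2 T.:* k) T.:+ T.con 2 T.:* h T.:=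
        a T.:+ T.con 2 T.:* (h T.:+ k)) refl ε (H i) (m i ℕ.+ e i)))

  cap-even : ∀ s i → IsFloorHalf ((2 ℕ.* suc s) ℕ.* H i) (suc s ℕ.* H i)
  cap-even s i = 0 , ℕ.z≤n , ℕP.*-assoc 2 (suc s) (H i)

  cap-inner : ∀ i → IsFloorHalf< (1 ℕ.* H i) (m i)
  cap-inner i = e i , e≤1 i , trans (ℕP.*-identityˡ (H i)) (H≡ i)

  cap-double : ∀ i → IsFloorHalf< (2 ℕ.* H i) (ℕ.pred (H i))
  cap-double i = 1 , ℕP.≤-refl , trans (cong (2 ℕ.*_) (sym (ℕP.suc-pred (H i) {{LE.H-nonZero i}}))) (ℕP.*-suc 2 (ℕ.pred (H i)))

  weights : (LatticeEdge W → ℕ) → ℤ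
  weights M = sumOver (sector-weight M) I

  weights-multiple : ∀ s → weights (λ i → suc s ℕ.* H i) ≡ + suc s ℤ.* (+ suc s ℤ.* ΣLH ℤ.+ ΣL)
  weights-multiple s = trans (sumOver-cong I (λ {i} _ → trans (weight-multiple i s) (trans
      (cong (λ t → + L i ℤ.* (+ suc s ℤ.* (t ℤ.+ 1ℤ))) (ℤP.pos-* (suc s) (H i)))
      (S.solve 3 (λ l s h → l S.:* (s S.:* (s S.:* h S.:+ S.con 1ℤ)) S.:=
          s S.:* (s S.:* (l S.:* h) S.:+ l)) refl (+ L i) (+ suc s) (+ H i)))))
    (trans (sumOver-* (+ suc s) (λ i → + suc s ℤ.* (+ L i ℤ.* + H i) ℤ.+ + L i) I) (cong (λ t → + suc s ℤ.* t)
      (trans (sym (sumOver-+ (λ i → + suc s ℤ.* (+ L i ℤ.* + H i)) (λ i → + L i) I))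
          (cong (ℤ._+ ΣL) (sumOver-* (+ suc s) (λ i → + L i ℤ.* + H i) I)))))

  weights-three : weights (λ i → H i ℕ.+ (m i ℕ.+ e i)) ≡ (ΣLH ℤ.+ ΣL) ℤ.+ weights (λ i → m i ℕ.+ e i) ℤ.+ + 2 ℤ.* ΣLh
  weights-three = trans (sumOver-cong I (λ {i} _ → weight-shift i (m i ℕ.+ e i)))
    (trans (sym (sumOver-+ (λ i → + L i ℤ.* (+ H i ℤ.+ 1ℤ) ℤ.+ sector-weight (λ i → m i ℕ.+ e i) i) (λ i →
        + 2 ℤ.* (+ L i ℤ.* + (m i ℕ.+ e i))) I))
      (cong₂ ℤ._+_ (trans (sym (sumOver-+ (λ i → + L i ℤ.* (+ H i ℤ.+ 1ℤ)) (sector-weight (λ i → m i ℕ.+ e i)) I))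
          (cong (ℤ._+ weights (λ i → m i ℕ.+ e i))
          (trans (sumOver-cong I (λ {i} _ → S.solve 2 (λ l h → l S.:* (h S.:+ S.con 1ℤ) S.:=
              l S.:* h S.:+ l) refl (+ L i) (+ H i))) (sym (sumOver-+ (λ i → + L i ℤ.* + H i) (λ i → + L i) I)))))
        (sumOver-* (+ 2) (λ i → + L i ℤ.* + (m i ℕ.+ e i)) I)))

  -- The closed and the open cut-off differ only for even H, where the additional level is that of
  -- the edge itself and carries weight L.
  weights-edge : weights (λ i → m i ℕ.+ e i) ≡ weights m ℤ.+ ΣLe
  weights-edge = trans (sumOver-cong I (λ {i} _ → at i)) (sym (sumOver-+ (sector-weight m) (λ i → + L i ℤ.* + e i) I))
    where
    at : ∀ i → sector-weight (λ i → m i ℕ.+ e i) i ≡ sector-weight m i ℤ.+ + L i ℤ.* + e i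
    at i = cases (e i) refl (e≤1 i)
      where
      cases : ∀ x → e i ≡ x → x ℕ.≤ 1 → sumTo (m i ℕ.+ e i) (edge-weight i) ≡ sumTo (m i) (edge-weight i) ℤ.+ + L i ℤ.* + e i
      cases 0 eq _ = trans (cong (λ t → sumTo t (edge-weight i)) (trans (cong (m i ℕ.+_) eq) (ℕP.+-identityʳ (m i))))
        (sym (trans (cong (λ t → sumTo (m i) (edge-weight i) ℤ.+ + L i ℤ.* + t) eq) (trans
            (cong (λ t → sumTo (m i) (edge-weight i) ℤ.+ t) (ℤP.*-zeroʳ (+ L i))) (ℤP.+-identityʳ _))))
      cases 1 eq _ = trans (cong (λ t → sumTo t (edge-weight i)) (trans (cong (m i ℕ.+_) eq) (ℕP.+-comm (m i) 1)))
        (trans (weight-edge i (m i) (trans (H≡ i) (trans (cong (λ t → suc t ℕ.+ 2 ℕ.* m i) eq) (sym (ℕP.*-suc 2 (m i))))))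
          (cong (λ t → sumTo (m i) (edge-weight i) ℤ.+ t) (sym (trans (cong (λ t → + L i ℤ.* + t) eq) (ℤP.*-identityʳ (+ L i))))))
      cases (suc (suc _)) _ (ℕ.s≤s ())

  inner-zero : Card (λ z → Int P (emb z)) 1ℤ → weights m ≡ 0ℤ
  inner-zero card = ∙-cancelˡ (+ 2) (weights m) 0ℤ (sym (Interior.count-doubled 0 int m cap-inner card))

-- Counting conditions and lattice distance one

two four : ℚ
two = ℕ→ℚ 2
four = ℕ→ℚ 4

ι-scale : ∀ k x → ι (+ k ℤ.* x) ≡ ℕ→ℚ k * ι x
ι-scale k x = trans (ι-* (+ k) x) (cong (_* ι x) (ι-ℕ k))

cancel-factor : ∀ {c x y} → 0ℚ < c → c * x ≡ c * y → x ≡ y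
cancel-factor {c} {x} {y} p e = trans (solve 2 (λ x y → x := (x :- y) :+ y) refl x y)
  (trans (cong (_+ y) (zero-cancel p (trans (solve 3 (λ c x y → c :* (x :- y) := c :* x :- c :* y) refl c x y)
    (trans (cong (_- c * y) e) (ℚP.+-inverseʳ (c * y)))))) (ℚP.+-identityˡ y))

div2-even : ∀ n → n ℕ.* 2 ℕ./ 2 ≡ n
div2-even n = m*n/n≡m n 2

div2-odd : ∀ n → suc (n ℕ.* 2) ℕ./ 2 ≡ n
div2-odd zero = refl
div2-odd (suc n) = trans (m/n≡1+[m∸n]/n {suc (suc (suc (n ℕ.* 2)))} {2} (ℕ.s≤s (ℕ.s≤s ℕ.z≤n))) (cong suc (div2-odd n))

module Implications {V W : List ℚ²} (poly : Polygon W) (W⊆V : ∀ {x} → x ∈ W → x ∈ V)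
  (below : ∀ {n c} → 0ℚ ≤ c → Below W n c → Below V n c) (edges : LatticeEdges W) where
  open Counts poly W⊆V below edges public

  ehrhart-weights : ∀ t M → (∀ i → IsFloorHalf (suc t ℕ.* H i) (M i)) →
    ∀ q → EhrhartValue P (suc t) q → ι (weights M) ≡ two * q - two
  ehrhart-weights t M cap q (n , count , e) = trans (solve 2 (λ w c → w := (c :+ w) :- c) refl (ι (weights M)) two)
    (cong (_- two) (sym (trans (cong (two *_) (trans (sym e) (sym (ι-ℕ n)))) (trans (sym (ι-scale 2 (+ n)))
      (trans (cong ι (Dilated.count-doubled (suc t) (dil (suc t)) M cap (hasCard⇒card count)))
          (trans (ι-+ (+ 2) (weights M)) (cong (_+ ι (weights M)) (ι-ℕ 2))))))))

  -- A is eliminated instead of being compared with the area. The weights of P, 2P, 3P, 4P are 4A,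
  -- 12A, 24A, 40A. Those of 2P and 4P give Σ L H = 2 Σ L; those of P, 3P and 4P give Σ L H = 2 Σ L
  -- ⌊H / 2⌋, so all H are even.
  quadratic⇒two : ∀ A → (∀ t → EhrhartValue P (suc t) (quadratic A (ℕ→ℚ (suc t)))) → TwoHeights
  quadratic⇒two A ehrhart = even-two (all-even LH≡2Lh) LH≡2L
    where
    M₁ M₂ M₃ M₄ : LatticeEdge W → ℕ
    M₁ i = m i ℕ.+ e i
    M₂ i = 1 ℕ.* H i
    M₃ i = H i ℕ.+ (m i ℕ.+ e i)
    M₄ i = 2 ℕ.* H i
    S₁ = ehrhart-weights 0 M₁ cap-one _ (ehrhart 0)
    S₂ = ehrhart-weights 1 M₂ (cap-even 0) _ (ehrhart 1)
    S₃ = ehrhart-weights 2 M₃ cap-three _ (ehrhart 2)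
    S₄ = ehrhart-weights 3 M₄ (cap-even 1) _ (ehrhart 3)
    first : + 10 ℤ.* weights M₂ ≡ + 3 ℤ.* weights M₄
    first = ι-injective (trans (trans (ι-scale 10 (weights M₂)) (cong (ℕ→ℚ 10 *_) S₂))
      (trans (solve 1 (λ A → con (ℕ→ℚ 10) :* (con two :* (A :* (con two :* con two) :+ (A :* con two :+ con 1ℚ)) :- con two) :=
          con (ℕ→ℚ 3) :* (con two :* (A :* (con four :* con four) :+ (A :* con four :+ con 1ℚ)) :- con two)) refl A)
        (sym (trans (ι-scale 3 (weights M₄)) (cong (ℕ→ℚ 3 *_) S₄)))))
    second : weights M₄ ℤ.+ + 2 ℤ.* weights M₁ ≡ + 2 ℤ.* weights M₃
    second = ι-injective (trans (trans (ι-+ (weights M₄) (+ 2 ℤ.* weights M₁)) (cong₂ _+_ S₄ (trans (ι-scale 2 (weights M₁))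
        (cong (two *_) S₁))))
      (trans (solve 1 (λ A → (con two :* (A :* (con four :* con four) :+ (A :* con four :+ con 1ℚ)) :- con two) :+
          con two :* (con two :* (A :* (con 1ℚ :* con 1ℚ) :+ (A :* con 1ℚ :+ con 1ℚ)) :- con two) :=
          con two :* (con two :* (A :* (con (ℕ→ℚ 3) :* con (ℕ→ℚ 3)) :+ (A :* con (ℕ→ℚ 3) :+ con 1ℚ)) :- con two)) refl A)
        (sym (trans (ι-scale 2 (weights M₃)) (cong (two *_) S₃)))))
    LH≡2L : ΣLH ≡ + 2 ℤ.* ΣL
    LH≡2L = ℤP.*-cancelˡ-≡ (+ 2) ΣLH (+ 2 ℤ.* ΣL) (trans
      (S.solve 2 (λ p q → S.con (+ 2) S.:* p S.:=
          S.con (+ 3) S.:* (S.con (+ 2) S.:* (S.con (+ 2) S.:* p S.:+ q)) S.:-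
          (S.con (+ 10) S.:* p S.:+ S.con (+ 6) S.:* q)) refl ΣLH ΣL)
      (trans (cong (ℤ._- (+ 10 ℤ.* ΣLH ℤ.+ + 6 ℤ.* ΣL)) (trans (cong (+ 3 ℤ.*_) (sym (weights-multiple 1))) (trans
          (sym first) (cong (+ 10 ℤ.*_) (weights-multiple 0)))))
        (S.solve 2 (λ p q → S.con (+ 10) S.:* (S.con (+ 1) S.:* (S.con (+ 1) S.:* p S.:+ q)) S.:-
            (S.con (+ 10) S.:* p S.:+ S.con (+ 6) S.:* q) S.:= S.con (+ 2) S.:* (S.con (+ 2) S.:* q)) refl ΣLH ΣL)))
    LH≡2Lh : ΣLH ≡ + 2 ℤ.* ΣLh
    LH≡2Lh = ℤP.*-cancelˡ-≡ (+ 2) ΣLH (+ 2 ℤ.* ΣLh) (trans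
      (S.solve 3 (λ p q s → S.con (+ 2) S.:* p S.:=
          (S.con (+ 2) S.:* (S.con (+ 2) S.:* p S.:+ q) S.:+ S.con (+ 2) S.:* s) S.:-
          (S.con (+ 2) S.:* p S.:+ S.con (+ 2) S.:* q S.:+ S.con (+ 2) S.:* s)) refl ΣLH ΣL (weights M₁))
      (trans (cong (ℤ._- (+ 2 ℤ.* ΣLH ℤ.+ + 2 ℤ.* ΣL ℤ.+ + 2 ℤ.* weights M₁)) (trans (cong (ℤ._+ + 2 ℤ.* weights M₁)
          (sym (weights-multiple 1))) (trans second (cong (+ 2 ℤ.*_) weights-three))))
        (S.solve 4 (λ p q s t → S.con (+ 2) S.:* ((p S.:+ q) S.:+ s S.:+ S.con (+ 2) S.:* t) S.:-
            (S.con (+ 2) S.:* p S.:+ S.con (+ 2) S.:* q S.:+ S.con (+ 2) S.:* s) S.:=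
            S.con (+ 2) S.:* (S.con (+ 2) S.:* t)) refl ΣLH ΣL (weights M₁) ΣLh)))

  -- On even dilates the polynomial agrees with 1 + x ΣL / 4 + x² ΣLH / 8, hence also at x = 1.
  pseudo-integral⇒two : Card (λ z → Int P (emb z)) 1ℤ → PseudoIntegral P → TwoHeights
  pseudo-integral⇒two interior-one (cs , ehrhart) = edge-sum-two (ι-injective (trans (ι-+ ΣLH (+ 2 ℤ.* ΣL)) (trans
      (cong (λ t → ι ΣLH + t) (ι-scale 2 ΣL))
    (trans (solve 2 (λ p q → p :+ con two :* q :=
        (con (ℕ→ℚ 8) :+ con 1ℚ :* (con two :* q :+ con 1ℚ :* (p :+ con 1ℚ :* con 0ℚ))) :- con (ℕ→ℚ 8)) refl (ι ΣLH) (ι ΣL))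
      (trans (cong (_- ℕ→ℚ 8) (trans (sym (agree 1ℚ)) (evalPoly-scale (ℕ→ℚ 8) cs 1ℚ)))
        (trans (solve 1 (λ q → con (ℕ→ℚ 8) :* q :- con (ℕ→ℚ 8) := con four :* (con two :* q :- con two)) refl (evalPoly cs 1ℚ))
          (trans (cong (four *_) (sym at-one)) (sym (ι-scale 4 ΣLe)))))))))
    where
    M₁ : LatticeEdge W → ℕ
    M₁ i = m i ℕ.+ e i
    -- The interior has weight zero, so only the lattice points on the edges contribute: 2 |P ∩ ℤ²|
    -- = 2 + `ΣLe`.
    at-one : ι ΣLe ≡ two * evalPoly cs 1ℚ - two
    at-one = trans (cong ι (trans (sym (ℤP.+-identityˡ ΣLe)) (trans (cong (ℤ._+ ΣLe) (sym (inner-zero interior-one)))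
        (sym weights-edge))))
      (ehrhart-weights 0 M₁ cap-one _ (ehrhart 0))
    -- The factor 8 clears the denominators of the polynomial known from the even dilates.
    ds : List ℚ
    ds = ℕ→ℚ 8 ∷ two * ι ΣL ∷ ι ΣLH ∷ []
    even : ℕ → ℚ
    even s = ℕ→ℚ (2 ℕ.* suc s)
    agree-even : ∀ s → evalPoly (scalePoly (ℕ→ℚ 8) cs) (even s) ≡ evalPoly ds (even s)
    agree-even s = trans (evalPoly-scale (ℕ→ℚ 8) cs (even s))
      (trans (solve 1 (λ q → con (ℕ→ℚ 8) :* q :=
          con four :* (con two :* q :- con two) :+ con (ℕ→ℚ 8)) refl (evalPoly cs (even s)))
        -- `s + suc (s + 0)` is what remains of `2 * suc s` after its leading `suc`, so the value is
        -- taken at `even s`.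
        (trans (cong (λ t → four * t + ℕ→ℚ 8) (sym (ehrhart-weights (s ℕ.+ suc (s ℕ.+ 0)) (λ i →
            suc s ℕ.* H i) (cap-even s) _ (ehrhart (s ℕ.+ suc (s ℕ.+ 0))))))
          (trans (cong (λ t → four * t + ℕ→ℚ 8) (trans (cong ι (weights-multiple s))
              (trans (ι-* (+ suc s) (+ suc s ℤ.* ΣLH ℤ.+ ΣL))
              (cong (u *_) (trans (ι-+ (+ suc s ℤ.* ΣLH) ΣL) (cong (_+ ι ΣL) (ι-* (+ suc s) ΣLH)))))))
            (trans (solve 3 (λ u p q → con four :* (u :* (u :* p :+ q)) :+ con (ℕ→ℚ 8) :=
                con (ℕ→ℚ 8) :+ (con two :* u) :* (con two :* q :+ (con two :* u) :* (p :+ (con two :* u) :* con 0ℚ))) refl u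
                    (ι ΣLH) (ι ΣL))
              (cong (λ x → ℕ→ℚ 8 + x * (two * ι ΣL + x * (ι ΣLH + x * 0ℚ))) (sym even≡))))))
      where
      u : ℚ
      u = ι (+ suc s)
      even≡ : even s ≡ two * u
      even≡ = trans (sym (ι-ℕ (2 ℕ.* suc s))) (trans (cong ι (ℤP.pos-* 2 (suc s))) (ι-scale 2 (+ suc s)))
    agree : ∀ x → evalPoly (scalePoly (ℕ→ℚ 8) cs) x ≡ evalPoly ds x
    agree = agreement (scalePoly (ℕ→ℚ 8) cs) ds even (λ {s} {t} e → ℕP.suc-injective (ℕP.*-cancelˡ-≡
        (suc s) (suc t) 2 (ℕ→ℚ-injective e))) agree-even

  origin-only : Card (λ z → Dil 0 P (emb z)) 1ℤ
  origin-only = card-cong (λ z → mk⇔ (λ { refl → from (dil 0 (0ℤ , 0ℤ)) zero-in }) (λ d → embed-injective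
      (trans (In-zero (to (dil 0 z) d)) (sym embed-origin))))
    (card-singleton (0ℤ , 0ℤ))
    where
    zero-in : In 0ℚ (embed (0ℤ , 0ℤ))
    zero-in {v} {w} e = ℚP.≤-reflexive (trans (trans
        (cong (λ x → dot x (normal v w)) embed-origin) (dot-origin (normal v w))) (sym (ℚP.*-zeroˡ (cross v w))))

  -- Only k = 0 and k = 1 enter. The first leaves just the origin in the interior of P, so for even
  -- H twice the count of P is 2 + `ΣL`; the second equates this with 2 + `ΣLH` - `ΣL` from the
  -- interior of 2P.
  shells⇒two : (∀ {i} → i ∈ I → e i ≡ 1) →
    (∀ k → Σ ℕ λ n → LatticeCount (Dil k P) n × LatticeCount (Int (Dil (suc k) P)) n) → TwoHeights
  shells⇒two even shells = even-two even (double (cancel-two (trans (sym inner₂) (trans (sym double-eq) outer₁))))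
    where
    n₁ = + proj₁ (shells 1)
    interior₁ : Card (λ z → Int (Dil 1 P) (emb z)) 1ℤ
    interior₁ = subst (Card (λ z → Int (Dil 1 P) (emb z))) (card-unique (hasCard⇒card (proj₁ (proj₂ (shells 0)))) origin-only)
      (hasCard⇒card (proj₂ (proj₂ (shells 0))))
    inner₁ : weights m ≡ 0ℤ
    inner₁ = ∙-cancelˡ (+ 2) (weights m) 0ℤ (sym (Interior.count-doubled 0 (int-dil 1) m cap-inner interior₁))
    outer₁ : + 2 ℤ.* n₁ ≡ + 2 ℤ.+ ΣL
    outer₁ = trans (Dilated.count-doubled 1 (dil 1) (λ i → m i ℕ.+ e i) cap-one (hasCard⇒card (proj₁ (proj₂ (shells 1)))))
      (cong (λ t → + 2 ℤ.+ t) (trans weights-edge (trans (cong (ℤ._+ ΣLe) inner₁) (trans (ℤP.+-identityˡ ΣLe)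
        (sumOver-cong I (λ {i} i∈ → trans (cong (λ t → + L i ℤ.* + t) (even i∈)) (ℤP.*-identityʳ (+ L i))))))))
    double-eq : + 2 ℤ.* n₁ ≡ + 2 ℤ.+ weights (λ i → ℕ.pred (H i))
    double-eq = Interior.count-doubled 1 (int-dil 2) (λ i → ℕ.pred (H i)) cap-double (hasCard⇒card (proj₂ (proj₂ (shells 1))))
    inner₂ : + 2 ℤ.+ weights (λ i → ℕ.pred (H i)) ≡ + 2 ℤ.+ (ΣLH ℤ.- ΣL)
    inner₂ = cong (λ t → + 2 ℤ.+ t) (trans (sumOver-cong I (λ {i} _ → at i)) (sumOver-minus (λ i → + L i ℤ.* + H i) (λ i →
        + L i) I))
      where
      at : ∀ i → sector-weight (λ i → ℕ.pred (H i)) i ≡ + L i ℤ.* + H i ℤ.- + L i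
      at i = trans (weight-below-period i (ℕ.pred (H i)) pred-H) (trans
          (S.solve 2 (λ l n → l S.:* n S.:= l S.:* (S.con 1ℤ S.:+ n) S.:- l) refl (+ L i) (+ ℕ.pred (H i)))
        (cong (λ t → + L i ℤ.* + t ℤ.- + L i) pred-H))
        where
        pred-H : suc (ℕ.pred (H i)) ≡ H i
        pred-H = ℕP.suc-pred (H i) {{LE.H-nonZero i}}
    cancel-two : + 2 ℤ.+ (ΣLH ℤ.- ΣL) ≡ + 2 ℤ.+ ΣL → ΣLH ℤ.- ΣL ≡ ΣL
    cancel-two eq = trans (S.solve 1 (λ w → w S.:= (S.con (+ 2) S.:+ w) S.:- S.con (+ 2)) refl (ΣLH ℤ.- ΣL))
      (trans (cong (ℤ._- + 2) eq) (S.solve 1 (λ w → (S.con (+ 2) S.:+ w) S.:- S.con (+ 2) S.:= w) refl ΣL))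
    double : ΣLH ℤ.- ΣL ≡ ΣL → ΣLH ≡ + 2 ℤ.* ΣL
    double eq = trans (S.solve 2 (λ p q → p S.:= (p S.:- q) S.:+ q) refl ΣLH ΣL) (trans (cong (ℤ._+ ΣL) eq)
      (S.solve 1 (λ q → q S.:+ q S.:= S.con (+ 2) S.:* q) refl ΣL))

  -- `Counting` asks for a cut-off at every `LatticeEdge`, whereas `TwoHeights` speaks only of those
  -- in `I`. The general cut-offs are used for counting and evaluated afterwards.
  outer inner : ℕ → LatticeEdge W → ℕ
  outer k i = (k ℕ.* H i) ℕ./ 2
  inner k i = ℕ.pred (suc k ℕ.* H i) ℕ./ 2

  cap-outer : ∀ k i → IsFloorHalf (k ℕ.* H i) (outer k i)
  cap-outer k i = (k ℕ.* H i) ℕ.% 2 , ℕP.≤-pred (m%n<n (k ℕ.* H i) 2) ,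
    trans (m≡m%n+[m/n]*n (k ℕ.* H i) 2) (cong (λ t → (k ℕ.* H i) ℕ.% 2 ℕ.+ t) (ℕP.*-comm (outer k i) 2))

  cap-interior : ∀ k i → IsFloorHalf< (suc k ℕ.* H i) (inner k i)
  cap-interior k i = n ℕ.% 2 , ℕP.≤-pred (m%n<n n 2) , trans
      (sym (ℕP.suc-pred (suc k ℕ.* H i) {{ℕ.>-nonZero (ℕP.≤-trans (ℕP.n≢0⇒n>0 (LE.H≢0 i)) (ℕP.m≤m+n (H i) (k ℕ.* H i)))}}))
    (cong suc (trans (m≡m%n+[m/n]*n n 2) (cong (λ t → n ℕ.% 2 ℕ.+ t) (ℕP.*-comm (inner k i) 2))))
    where
    n = ℕ.pred (suc k ℕ.* H i)

  module _ (twoH : TwoHeights) where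
    outer≡ : ∀ k {i} → i ∈ I → outer k i ≡ k
    outer≡ k i∈ = trans (cong (λ h → (k ℕ.* h) ℕ./ 2) (twoH i∈)) (div2-even k)

    inner≡ : ∀ k {i} → i ∈ I → inner k i ≡ k
    inner≡ k i∈ = trans (cong (λ h → ℕ.pred (suc k ℕ.* h) ℕ./ 2) (twoH i∈)) (div2-odd k)

    -- For H = 2 both regions are cut off at level k in every cone, so the two counts are the same
    -- sum.
    shell : ∀ k → Σ ℕ λ n → LatticeCount (Dil k P) n × LatticeCount (Int (Dil (suc k) P)) n
    shell k = merge (card⇒hasCard (Dilated.count-left k (dil k) (outer k) (cap-outer k)))
      (card⇒hasCard (Interior.count-left k (int-dil (suc k)) (inner k) (cap-interior k)))
      where
      same : sumOver (λ i → sumTo (outer k i) (left-weight i)) I ≡ sumOver (λ i → sumTo (inner k i) (left-weight i)) I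
      same = sumOver-cong I (λ {i} i∈ → cong (λ t → sumTo t (left-weight i)) (trans (outer≡ k i∈) (sym (inner≡ k i∈))))
      merge : (Σ ℕ λ n → LatticeCount (Dil k P) n × + n ≡ 1ℤ ℤ.+ sumOver (λ i → sumTo (outer k i) (left-weight i)) I) →
        (Σ ℕ λ n → LatticeCount (Int (Dil (suc k) P)) n × + n ≡ 1ℤ ℤ.+ sumOver (λ i → sumTo (inner k i) (left-weight i)) I) →
        Σ ℕ λ n → LatticeCount (Dil k P) n × LatticeCount (Int (Dil (suc k) P)) n
      merge (n , c , eq) (n′ , c′ , eq′) = n , c , subst (LatticeCount (Int (Dil (suc k) P)))
        (ℤP.+-injective (trans eq′ (trans (cong (λ t → 1ℤ ℤ.+ t) (sym same)) (sym eq)))) c′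

    interior-origin : Card (λ z → Int P (emb z)) 1ℤ
    interior-origin = subst (Card (λ z → Int P (emb z))) (trans (cong (λ t → 1ℤ ℤ.+ t)
        (trans (sumOver-cong I (λ {i} i∈ → cong (λ t → sumTo t (left-weight i)) (inner≡ 0 i∈)))
      (zeros I))) refl) (Interior.count-left 0 int (inner 0) (cap-interior 0))
      where
      zeros : ∀ J → sumOver (λ (i : LatticeEdge W) → 0ℤ) J ≡ 0ℤ
      zeros [] = refl
      zeros (i ∷ J) = trans (ℤP.+-identityˡ _) (zeros J)

    -- For H = 2 the levels up to x carry L x (x + 1) / 2 on each edge, so four times the count is 4
    -- + `ΣL` x (x + 1).
    ehrhart-two : ∀ {A} → four * A ≡ ι ΣL → ∀ t → EhrhartValue P (suc t) (quadratic A (ℕ→ℚ (suc t)))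
    ehrhart-two {A} area t = value (card⇒hasCard (Dilated.count-left (suc t) (dil (suc t)) (outer (suc t)) (cap-outer (suc t))))
      where
      x = ι (+ suc t)
      double : + 2 ℤ.* weights (outer (suc t)) ≡ ΣL ℤ.* (+ suc t ℤ.* (+ suc t ℤ.+ 1ℤ))
      double = trans (sym (sumOver-* (+ 2) (sector-weight (outer (suc t))) I)) (trans (sumOver-cong I (λ {i} i∈ →
          trans (cong (λ k → + 2 ℤ.* sumTo k (edge-weight i)) (outer≡ (suc t) i∈))
              (trans (weight-unit-height i (twoH i∈) (suc t)) (ℤP.*-comm (+ L i) (+ suc t ℤ.* (+ suc t ℤ.+ 1ℤ))))))
        (trans (sumOver-* (+ suc t ℤ.* (+ suc t ℤ.+ 1ℤ)) (λ i → + L i) I) (ℤP.*-comm (+ suc t ℤ.* (+ suc t ℤ.+ 1ℤ)) ΣL)))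
      value : (Σ ℕ λ n → LatticeCount (Dil (suc t) P) n × + n ≡ _) → EhrhartValue P (suc t) (quadratic A (ℕ→ℚ (suc t)))
      value (n , count , _) = n , count , cancel-factor (ℕ→ℚ-pos 3) (trans (cong (four *_) (sym (ι-ℕ n))) (trans
          (sym (ι-scale 4 (+ n))) (trans (cong ι quadruple)
        (trans (trans (ι-+ (+ 4) (ΣL ℤ.* (+ suc t ℤ.* (+ suc t ℤ.+ 1ℤ)))) (cong₂ _+_ (ι-ℕ 4)
            (trans (ι-* ΣL (+ suc t ℤ.* (+ suc t ℤ.+ 1ℤ))) (cong₂ _*_ (sym area)
            (trans (ι-* (+ suc t) (+ suc t ℤ.+ 1ℤ)) (cong (x *_) (trans (ι-+ (+ suc t) 1ℤ) (cong (λ t → x + t) ι1))))))))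
          (trans (solve 2 (λ A x → con four :+ (con four :* A) :* (x :* (x :+ con 1ℚ)) :=
              con four :* (A :* (x :* x) :+ (A :* x :+ con 1ℚ))) refl A x)
            (cong (λ x → four * quadratic A x) (ι-ℕ (suc t))))))))
        where
        quadruple : + 4 ℤ.* + n ≡ + 4 ℤ.+ ΣL ℤ.* (+ suc t ℤ.* (+ suc t ℤ.+ 1ℤ))
        quadruple = trans (S.solve 1 (λ n → S.con (+ 4) S.:* n S.:= S.con (+ 2) S.:* (S.con (+ 2) S.:* n)) refl (+ n))
          (trans (cong (+ 2 ℤ.*_) (Dilated.count-doubled (suc t) (dil (suc t)) (outer (suc t)) (cap-outer (suc t))
              (hasCard⇒card count)))
            (trans (ℤP.*-distribˡ-+ (+ 2) (+ 2) (weights (outer (suc t)))) (cong (λ t → + 4 ℤ.+ t) double)))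

-- Primitive normals and the lines of edges

opaque
  unfolding cross dot dt comb ι embed normal

  normalℤ-surjective : ∀ z → Σ ℤ² λ y → z ≡ normalℤ y
  normalℤ-surjective (a , b) = (ℤ.- b , a) , cong (a ,_) (sym (ℤP.neg-involutive b))

  negℤ² : ℤ² → ℤ²
  negℤ² (a , b) = ℤ.- a , ℤ.- b

  negℤ²-primitive : ∀ {z} → PrimitiveVec z → PrimitiveVec (negℤ² z)
  negℤ²-primitive {a , b} p = trans (cong₂ ℕG.gcd (ℤP.∣-i∣≡∣i∣ a) (ℤP.∣-i∣≡∣i∣ b)) p

  dot-negℤ² : ∀ x z → dot x (embed (negℤ² z)) ≡ - dot x (embed z)
  dot-negℤ² (x , y) (a , b) = trans (cong₂ (λ s t → x * s + y * t) (ι-neg a) (ι-neg b))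
    (solve 4 (λ x y a b → x :* (:- a) :+ y :* (:- b) := :- (x :* a :+ y :* b)) refl x y (ι a) (ι b))

  primitive-multiple : ∀ {c k d} → PrimitiveVec (normalℤ (comb 0ℤ c k d)) → ℤ.∣ k ∣ ≡ 1
  primitive-multiple {c₁ , c₂} {k} {d₁ , d₂} p = ℕD.∣1⇒≡1 (subst (ℤ.∣ k ∣ ℕD.∣_) p
    (ℕG.gcd-greatest (divides c₂ d₂) (subst (ℤ.∣ k ∣ ℕD.∣_) (sym (ℤP.∣-i∣≡∣i∣ (0ℤ ℤ.* c₁ ℤ.+ k ℤ.* d₁))) (divides c₁ d₁))))
    where
    divides : ∀ c d → ℤ.∣ k ∣ ℕD.∣ ℤ.∣ 0ℤ ℤ.* c ℤ.+ k ℤ.* d ∣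
    divides c d = ℤD.∣⇒∣ᵤ {k} {0ℤ ℤ.* c ℤ.+ k ℤ.* d} (ℤD.divides d
        (S.solve 3 (λ c k d → S.con 0ℤ S.:* c S.:+ k S.:* d S.:= d S.:* k) refl c k d))

  left-of-edge : ∀ v w x → det (w ⊕ ((- 1ℚ) ⊙ v)) (x ⊕ ((- 1ℚ) ⊙ v)) ≡ cross v w - height v w x
  left-of-edge (v₁ , v₂) (w₁ , w₂) (x₁ , x₂) = solve 6 (λ v₁ v₂ w₁ w₂ x₁ x₂ → let n = λ t → (:- con 1ℚ) :* t in
    (w₁ :+ n v₁) :* (x₂ :+ n v₂) :- (w₂ :+ n v₂) :* (x₁ :+ n v₁) :=
    (v₁ :* w₂ :- v₂ :* w₁) :- (x₁ :* (w₂ :- v₂) :+ x₂ :* (v₁ :- w₁))) refl v₁ v₂ w₁ w₂ x₁ x₂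

-- By `cross-expand` x is a combination of v and w, and the common value D forces the coefficients
-- to sum to one.
affine-point : ∀ {D} v w n x → 0ℚ < D → v ≢ w → dot v n ≡ D → dot w n ≡ D → dot x n ≡ D →
  Σ ℚ λ t → x ≡ v ⊕ (t ⊙ (w ⊕ ((- 1ℚ) ⊙ v)))
-- `cross v w` may have either sign here, so its square is inverted.
affine-point {D} v w n x 0<D v≢w vn wn xn = solve-for (reciprocal (square-pos v×w≢0))
  where
  K = cross v w
  unscale : ∀ {r} → D * r ≡ 1ℚ → ∀ y → r ⊙ (D ⊙ y) ≡ y
  unscale {r} Dr y = trans (⊙-assoc r D y) (trans (cong (_⊙ y) (trans (ℚP.*-comm r D) Dr)) (⊙-identity y))
  v×w≢0 : K ≢ 0ℚ
  v×w≢0 e = let r , _ , Dr = reciprocal 0<D in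
    v≢w (trans (sym (unscale Dr v)) (trans (cong (r ⊙_) (equal-dots {v} {w} {n} {D} vn wn e)) (unscale Dr w)))
  split : K ≡ cross x w + cross v x
  split = cancel-factor 0<D (trans (ℚP.*-comm D K) (trans (cong (K *_) (sym xn)) (trans (cramer v w x n)
    (trans (cong₂ (λ s t → cross x w * s + cross v x * t) vn wn)
        (solve 3 (λ a b d → a :* d :+ b :* d := d :* (a :+ b)) refl (cross x w) (cross v x) D)))))
  solve-for : (Σ ℚ λ r → 0ℚ < r × K * K * r ≡ 1ℚ) → Σ ℚ λ t → x ≡ v ⊕ (t ⊙ (w ⊕ ((- 1ℚ) ⊙ v)))
  solve-for (r , _ , KKr) = t , trans (sym (⊙-identity x)) (trans (cong (_⊙ x) (sym sK)) (trans (sym (⊙-assoc s K x)) (trans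
      (cong (s ⊙_) (cross-expand v w x))
      (cong₂ _,_ (coordinate (proj₁ v) (proj₁ w)) (coordinate (proj₂ v) (proj₂ w))))))
    where
    s = K * r
    t = s * cross v x
    sK : s * K ≡ 1ℚ
    sK = trans (solve 2 (λ k r → (k :* r) :* k := (k :* k) :* r) refl K r) KKr
    rest : s * cross x w ≡ 1ℚ - t
    rest = trans (cong (s *_) (trans (solve 2 (λ a b → a := (a :+ b) :- b) refl (cross x w) (cross v x))
        (cong (_- cross v x) (sym split))))
      (trans (solve 3 (λ s k b → s :* (k :- b) := s :* k :- s :* b) refl s K (cross v x)) (cong (_- t) sK))
    coordinate : ∀ a b → s * (cross x w * a + cross v x * b) ≡ a + t * (b + (- 1ℚ) * a)
    coordinate a b = trans (solve 5 (λ s p q a b → s :* (p :* a :+ q :* b) :=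
        (s :* p) :* a :+ (s :* q) :* b) refl s (cross x w) (cross v x) a b)
      (trans (cong (λ z → z * a + t * b) rest) (solve 3 (λ t a b → (con 1ℚ :- t) :* a :+ t :* b :=
          a :+ t :* (b :+ (:- con 1ℚ) :* a)) refl t a b))

-- Both sides are linear in x and agree at v and w; `cramer` carries this over to x.
opposite-height : ∀ {v w y} → dot v y ≡ - 1ℚ → dot w y ≡ - 1ℚ → ∀ x → height v w x ≡ - (cross v w * dot x y)
opposite-height {v} {w} {y} vy wy x = trans (dot-normal v w x) (trans
    (solve 2 (λ a b → a :+ b := :- (a :* (:- con 1ℚ) :+ b :* (:- con 1ℚ))) refl (cross x w) (cross v x))
  (cong -_ (trans (cong₂ (λ s t → cross x w * s + cross v x * t) (sym vy) (sym wy)) (sym (cramer v w x y)))))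

module EdgeLattice {W : List ℚ²} (i : LatticeEdge W) (edge-pos : 0ℚ < LE.edge-det i) where
  open LatticeEdge i

  ιL-pos : 0ℚ < ι (+ L)
  ιL-pos = subst (_< ι (+ L)) ι0 (ι-mono-< (ℤ.+<+ (ℕP.n≢0⇒n>0 L≢0)))

  -- The rational and the primitive normal are proportional, because the two linear forms agree on
  -- the basis c, d.
  scaled-normal : ∀ x → ι2 * height v w x ≡ ι (+ L) * dot x (embed (normalℤ d))
  scaled-normal x = trans (sym (trans (dot-comm x (ι2 ⊙ N)) (trans (dot-⊙ ι2 N x) (cong (ι2 *_) (dot-comm N x)))))
    (trans (cong (dot x) same) (trans (dot-comm x (ι (+ L) ⊙ n)) (trans (dot-⊙ (ι (+ L)) n x)
        (cong (ι (+ L) *_) (dot-comm n x)))))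
    where
    N = normal v w
    n = embed (normalℤ d)
    at : ∀ z → dot (ι2 ⊙ N) (embed z) ≡ dot (ι (+ L) ⊙ n) (embed z)
    at z = trans (dot-⊙ ι2 N (embed z)) (trans (cong (ι2 *_) (dot-comm N (embed z))) (trans (scaled-height z)
      (trans (ι-* (+ L) (level z)) (sym (trans (dot-⊙ (ι (+ L)) n (embed z)) (cong (ι (+ L) *_)
          (trans (dot-comm n (embed z)) (dot-normalℤ z d))))))))
    same : ι2 ⊙ N ≡ ι (+ L) ⊙ n
    same = dot-separates {embed c} {embed d} (ι2 ⊙ N) (ι (+ L) ⊙ n)
      (subst (0ℚ <_) (sym (trans (cross-embed c d) (trans (cong ι unit) ι1))) (ℚP.positive⁻¹ 1ℚ)) (at c) (at d)

  module _ (H≡2 : H ≡ 2) where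
    half-det : ι2 * cross v w ≡ ι (+ L)
    half-det = cancel-factor ι2-pos (trans scaled-det (trans (ι-* (+ L) (+ H)) (trans
        (cong (λ h → ι (+ L) * ι (+ h)) H≡2) (ℚP.*-comm (ι (+ L)) ι2))))

    unit-height : ∀ {x} → height v w x ≡ cross v w → dot x (embed (normalℤ d)) ≡ 1ℚ
    unit-height {x} tight = cancel-factor ιL-pos (trans (sym (scaled-normal x)) (trans (cong (ι2 *_) tight) (trans half-det
        (sym (ℚP.*-identityʳ (ι (+ L)))))))

    -- c has level 1, which for H = 2 is the level H / 2 of the edge.
    lattice-point-height : height v w (embed c) ≡ cross v w
    lattice-point-height = cancel-factor ι2-pos (trans (scaled-height c) (trans (cong (λ t → ι (+ L ℤ.* t)) unit) (trans
        (cong ι (ℤP.*-identityʳ (+ L))) (sym half-det))))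

  -- Write z as `normalℤ y`. Comparing heights at d and at c gives y = k d and 2 = -H k; primitivity
  -- of z gives |k| = 1.
  two-from-normal : ∀ {z} → PrimitiveVec z → dot v (embed z) ≡ - 1ℚ → dot w (embed z) ≡ - 1ℚ → H ≡ 2
  two-from-normal {z} = from-preimage (normalℤ-surjective z)
    where
    from-preimage : (Σ ℤ² λ y → z ≡ normalℤ y) → PrimitiveVec z → dot v (embed z) ≡ - 1ℚ → dot w (embed z) ≡ - 1ℚ → H ≡ 2
    from-preimage (y , refl) prim vz wz = trans (sym (ℕP.*-identityʳ H)) (trans (cong (H ℕ.*_) (sym ∣k∣≡1)) (sym 2≡))
      where
      k = dt c y
      D = cross v w
      integral : ∀ x → + 2 ℤ.* (+ L ℤ.* level x) ≡ ℤ.- ((+ L ℤ.* + H) ℤ.* dt x y)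
      integral x = ι-injective (trans (ι-* (+ 2) (+ L ℤ.* level x)) (trans (cong (ι2 *_) (sym (scaled-height x))) (trans
          (cong (λ t → ι2 * (ι2 * t)) (opposite-height vz wz (embed x)))
        (trans (solve 3 (λ a D t → a :* (a :* (:- (D :* t))) :=
            :- ((a :* (a :* D)) :* t)) refl ι2 D (dot (embed x) (embed (normalℤ y))))
          (trans (cong -_ (trans (cong₂ _*_ scaled-det (dot-normalℤ x y)) (sym (ι-* (+ L ℤ.* + H) (dt x y)))))
              (sym (ι-neg ((+ L ℤ.* + H) ℤ.* dt x y))))))))
      cancel-L : ∀ {p q} → + L ℤ.* p ≡ + L ℤ.* q → p ≡ q
      cancel-L {p} {q} = ℤP.*-cancelˡ-≡ (+ L) p q {{ℤ.≢-nonZero (λ e → L≢0 (ℤP.+-injective e))}}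
      dy≡0 : dt d y ≡ 0ℤ
      dy≡0 = ℤP.*-cancelˡ-≡ (+ H) (dt d y) 0ℤ {{ℤ.≢-nonZero (λ e → H≢0 (ℤP.+-injective e))}} (cancel-L (trans
        (S.solve 3 (λ l h t → l S.:* (h S.:* t) S.:= S.:- (S.:- ((l S.:* h) S.:* t))) refl (+ L) (+ H) (dt d y))
        (trans (cong ℤ.-_ (sym (integral d))) (trans (cong (λ t → ℤ.- (+ 2 ℤ.* (+ L ℤ.* t))) (dt-self d))
          (S.solve 2 (λ l h → S.:- (S.con (+ 2) S.:* (l S.:* S.con 0ℤ)) S.:= l S.:* (h S.:* S.con 0ℤ)) refl (+ L) (+ H))))))
      k-eq : + 2 ≡ ℤ.- (+ H ℤ.* k)
      k-eq = cancel-L (trans (S.solve 1 (λ l → l S.:* S.con (+ 2) S.:= S.con (+ 2) S.:* (l S.:* S.con 1ℤ)) refl (+ L))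
          (trans (cong (λ t → + 2 ℤ.* (+ L ℤ.* t)) (sym unit))
        (trans (integral c) (S.solve 3 (λ l h t → S.:- ((l S.:* h) S.:* t) S.:= l S.:* (S.:- (h S.:* t))) refl (+ L) (+ H) k))))
      ∣k∣≡1 : ℤ.∣ k ∣ ≡ 1
      ∣k∣≡1 = primitive-multiple {c} {k} {d} (subst (λ y → PrimitiveVec (normalℤ y)) (trans (coordinates y unit)
        (cong (λ t → comb t c k d) (trans (dt-anti y d) (cong ℤ.-_ dy≡0)))) prim)
      2≡ : 2 ≡ H ℕ.* ℤ.∣ k ∣
      2≡ = trans (cong ℤ.∣_∣ k-eq) (trans (ℤP.∣-i∣≡∣i∣ (+ H ℤ.* k)) (ℤP.abs-* (+ H) k))

-- Lattice distance, lattice points on edge lines, area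

module Geometry {V W : List ℚ²} (poly : Polygon W) (W⊆V : ∀ {x} → x ∈ W → x ∈ V)
  (below : ∀ {n c} → 0ℚ ≤ c → Below W n c → Below V n c) (edges : LatticeEdges W) where
  open Implications poly W⊆V below edges public

  UnitDistances : Set
  UnitDistances = ∀ v w → Edge P v w → LatDistToEdge origin v w 1ℚ

  indexed : ∀ {v w} → IsEdge v w → Σ (LatticeEdge W) λ i → i ∈ I × LE.v i ≡ v × LE.w i ≡ w
  indexed e = find (every e)

  InLineOf : ℚ² → ℚ² → Set
  InLineOf v w = Σ (LatticeEdge W) λ i → i ∈ I × LE.edge-height i v ≡ LE.edge-det i × LE.edge-height i w ≡ LE.edge-det i

  -- `Edge` presents its ends in either order and by an arbitrary supporting line; that both ends
  -- lie on the line of an indexed edge is all that is needed.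
  indexed-edge : ∀ {v w} → Edge P v w → InLineOf v w
  indexed-edge {v} {w} edge = locate (EdgeOf.supporting-edge edge)
    where
    locate : (Σ ℚ² λ v′ → Σ ℚ² λ w′ → IsEdge v′ w′ × height v′ w′ v ≡ cross v′ w′ × height v′ w′ w ≡ cross v′ w′) → InLineOf v w
    locate (v′ , w′ , e , hv , hw) = let i , i∈ , v≡ , w≡ = indexed e in
      i , i∈ , subst₂ (λ a b → height a b v ≡ cross a b) (sym v≡) (sym w≡) hv , subst₂ (λ a b → height a b w ≡ cross a b)
          (sym v≡) (sym w≡) hw

  two⇒unit-distances : TwoHeights → UnitDistances
  two⇒unit-distances twoH v w edge = at-index (indexed-edge edge)
    where
    at-index : InLineOf v w → LatDistToEdge origin v w 1ℚ
    at-index (i , i∈ , hv , hw) = n , 1ℚ , unit⇒primitive (LE.unit i) , at hv , at hw , distance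
      where
      n = normalℤ (LE.d i)
      at : ∀ {x} → LE.edge-height i x ≡ LE.edge-det i → ⟨ x , emb n ⟩ ≡ 1ℚ
      at {x} h = trans (sym (trans (cong (dot x) (embed≡emb n)) (dot≡⟨⟩ x (emb n)))) (EdgeLattice.unit-height i (ed-pos
          (LE.edge i)) (twoH i∈) h)
      distance : latDist origin n 1ℚ ≡ 1ℚ
      distance = cong (λ t → ∣ t - 1ℚ ∣) {⟨ origin , emb n ⟩} {0ℚ} (trans (sym (dot≡⟨⟩ origin (emb n))) (dot-origin (emb n)))

  -- `LatDistToEdge` leaves the sign of the normal open. It is chosen to give -1 on the edge, as for
  -- points on the boundary of the dual.
  unit-normal : UnitDistances → ∀ {v w} → IsEdge v w →
    Σ ℤ² λ z → PrimitiveVec z × dot v (embed z) ≡ - 1ℚ × dot w (embed z) ≡ - 1ℚ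
  unit-normal unitD {v} {w} e = orient (unitD v w (edge-is-Edge e))
   where
   orient : LatDistToEdge origin v w 1ℚ → Σ ℤ² λ z → PrimitiveVec z × dot v (embed z) ≡ - 1ℚ × dot w (embed z) ≡ - 1ℚ
   orient (n , c , prim , vn , wn , dist) = sign (ℚP.∣p∣≡p∨∣p∣≡-p (⟨ origin , emb n ⟩ - c))
    where
    offset≡ : ⟨ origin , emb n ⟩ - c ≡ - c
    offset≡ = trans (cong (_- c) (trans (sym (dot≡⟨⟩ origin (emb n))) (dot-origin (emb n)))) (ℚP.+-identityˡ (- c))
    at : ∀ {x} → ⟨ x , emb n ⟩ ≡ c → dot x (embed n) ≡ c
    at {x} xn = trans (cong (dot x) (embed≡emb n)) (trans (dot≡⟨⟩ x (emb n)) xn)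
    sign : ∣ ⟨ origin , emb n ⟩ - c ∣ ≡ ⟨ origin , emb n ⟩ - c ⊎ ∣ ⟨ origin , emb n ⟩ - c ∣ ≡ - (⟨ origin , emb n ⟩ - c) →
      Σ ℤ² λ z → PrimitiveVec z × dot v (embed z) ≡ - 1ℚ × dot w (embed z) ≡ - 1ℚ
    sign (inj₁ p) = n , prim , trans (at vn) c≡ , trans (at wn) c≡
      where
      c≡ : c ≡ - 1ℚ
      c≡ = trans (solve 1 (λ c → c := :- (:- c)) refl c) (cong -_ (trans (sym offset≡) (trans (sym p) dist)))
    sign (inj₂ p) = negℤ² n , negℤ²-primitive prim , trans (dot-negℤ² v n) (cong -_
        (trans (at vn) c≡)) , trans (dot-negℤ² w n) (cong -_ (trans (at wn) c≡))
      where
      c≡ : c ≡ 1ℚ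
      c≡ = trans (solve 1 (λ c → c := :- (:- c)) refl c) (trans (cong -_ (sym offset≡)) (trans (sym p) dist))

  unit-distances⇒two : UnitDistances → TwoHeights
  unit-distances⇒two unitD {i} _ = let z , prim , vz , wz = unit-normal unitD (LE.edge i) in
    EdgeLattice.two-from-normal i (ed-pos (LE.edge i)) prim vz wz

  two⇒lattice-points : TwoHeights → ∀ v w → Edge P v w → AffHullHasLatticePt v w
  two⇒lattice-points twoH v w edge = at-index (indexed-edge edge)
    where
    at-index : InLineOf v w → AffHullHasLatticePt v w
    at-index (i , i∈ , hv , hw) = let t , eq = affine-point v w (normal (LE.v i) (LE.w i)) (embed c)
                                                 (ed-pos (LE.edge i)) (proj₁ (proj₂ (proj₂ edge))) hv hw
                                                 (EdgeLattice.lattice-point-height i (ed-pos (LE.edge i)) (twoH i∈)) in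
      c , t , trans (sym (embed≡emb c)) eq
      where c = LE.c i

  -- For odd H the weak and the strict cut-off at H / 2 are the same m, so a lattice point not
  -- beyond the line of the edge is strictly below it, and none lies on the line.
  lattice-points⇒even : (∀ v w → Edge P v w → AffHullHasLatticePt v w) → ∀ {i} → i ∈ I → e i ≡ 1
  lattice-points⇒even points {i} _ = decide (e i) refl (e≤1 i)
    where
    v = LE.v i
    w = LE.w i
    N = normal v w
    D = cross v w
    on-line : Σ ℤ² λ z → height v w (embed z) ≡ ι (+ 1) * D
    on-line = locate (points v w (edge-is-Edge (LE.edge i)))
     where
     locate : AffHullHasLatticePt v w → Σ ℤ² λ z → height v w (embed z) ≡ ι (+ 1) * D
     locate (z , t , eq) = z , trans (cong (λ x → dot x N) (trans (embed≡emb z) eq)) (trans (dot-⊕ v (t ⊙ (w ⊕ ((- 1ℚ) ⊙ v))) N)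
      (trans (cong₂ _+_ (height-tail v w) (trans (dot-⊙ t (w ⊕ ((- 1ℚ) ⊙ v)) N) (cong (t *_) (trans (dot-⊕ w ((- 1ℚ) ⊙ v) N)
          (cong₂ _+_ (height-head v w) (trans (dot-⊙ (- 1ℚ) v N) (cong ((- 1ℚ) *_) (height-tail v w))))))))
        (trans (solve 2 (λ d t → d :+ t :* (d :+ (:- con 1ℚ) :* d) := con 1ℚ :* d) refl D t) (cong (_* D) (sym ι1)))))
    decide : ∀ x → e i ≡ x → x ℕ.≤ 1 → e i ≡ 1
    decide 1 eq _ = eq
    decide (suc (suc _)) _ (ℕ.s≤s ())
    decide 0 eq _ = ⊥-elim (impossible on-line)
      where
      odd : 1 ℕ.* H i ≡ 1 ℕ.+ 2 ℕ.* m i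
      odd = trans (ℕP.*-identityˡ (H i)) (trans (H≡ i) (cong (λ t → suc t ℕ.+ 2 ℕ.* m i) eq))
      impossible : ¬ Σ ℤ² λ z → height v w (embed z) ≡ ι (+ 1) * D
      impossible (z , h) = ℚP.<-irrefl h (from (LE.height-< i (+ 1) z)
          (subst (λ t → + 2 ℤ.* LE.level i z ℤ.< t) (ℤP.pos-* 1 (H i))
        (from (level-cap< {1 ℕ.* H i} {0} {m i} ℕ.z≤n odd (LE.level i z))
          (to (level-cap {1 ℕ.* H i} {1} {m i} ℕP.≤-refl odd (LE.level i z))
            (subst (λ t → + 2 ℤ.* LE.level i z ℤ.≤ t) (sym (ℤP.pos-* 1 (H i)))
              (to (LE.height-≤ i (+ 1) z) (ℚP.≤-reflexive h)))))))

  ccw : CCWVertexList P W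
  ccw = unique , (λ v → mk⇔ generator-vertex vertex-in-W) , All.tabulate (λ { {v , w} e x x∈ →
    subst (0ℚ ≤_) (sym (left-of-edge v w x)) (≤⇒0≤ (height≤ e x∈)) })

  -- For H = 2 twice the determinant of an edge is its L, by `half-det`.
  area-two : TwoHeights → four * shoelace W ≡ ι ΣL
  area-two twoH = trans (solve 1 (λ s → con four :* (con (ℤ.+ 1 / 2) :* s) :=
      con two :* s) refl (sumℚ (map area (cyclicPairs W))))
    (sums I (cyclicPairs W) (LatticeEdges.tails edges) (LatticeEdges.heads edges) (λ i∈ → i∈))
    where
    area : ℚ² × ℚ² → ℚ
    area p = det (proj₁ p) (proj₂ p)
    sums : ∀ J E → map LE.v J ≡ map proj₁ E → map LE.w J ≡ map proj₂ E → (∀ {i} → i ∈ J → i ∈ I) →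
      two * sumℚ (map area E) ≡ ι (sumOver (λ i → + L i) J)
    sums [] [] _ _ _ = trans (ℚP.*-zeroʳ two) (sym ι0)
    sums (i ∷ J) ((v , w) ∷ E) vs ws J⊆I = trans (ℚP.*-distribˡ-+ two (det v w) (sumℚ (map area E)))
      (trans (cong₂ _+_ head-term (sums J E (∷-injectiveʳ vs) (∷-injectiveʳ ws) (J⊆I ∘ there)))
          (sym (ι-+ (+ L i) (sumOver (λ i → + L i) J))))
      where
      open import Data.List.Properties using (∷-injectiveˡ; ∷-injectiveʳ)
      head-term : two * det v w ≡ ι (+ L i)
      head-term = trans (cong₂ _*_ (sym (ι-ℕ 2)) (trans (sym (cross≡det v w)) (cong₂ cross (sym (∷-injectiveˡ vs))
          (sym (∷-injectiveˡ ws)))))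
        (EdgeLattice.half-det i (ed-pos (LE.edge i)) (twoH (J⊆I (here refl))))

-- The dual polygon

module Duality {V W : List ℚ²} (poly : Polygon W) (W⊆V : ∀ {x} → x ∈ W → x ∈ V)
  (below : ∀ {n c} → 0ℚ ≤ c → Below W n c → Below V n c) where
  open RegionOf poly W⊆V below
  open Faces poly

  IsNormal : ℚ² → ℚ² → ℚ² → Set
  IsNormal v w y = dot v y ≡ - 1ℚ × dot w y ≡ - 1ℚ

  normal-bound : ∀ {v w y x} → IsEdge v w → IsNormal v w y → height v w x ≤ cross v w → - 1ℚ ≤ dot x y
  normal-bound {v} {w} {y} {x} e (vy , wy) le = ≤-from (nonNeg-cancel (ed-pos e) (subst (0ℚ ≤_)
      (trans (cong (λ t → cross v w - t) (opposite-height vy wy x))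
          (solve 2 (λ d t → d :- (:- (d :* t)) := d :* (t :+ con 1ℚ)) refl (cross v w) (dot x y)))
      (≤⇒0≤ le))) (solve 1 (λ t → t :+ con 1ℚ := t :- (:- con 1ℚ)) refl (dot x y))

  module _ (normals : List ℤ²)
    (sound : ∀ {z} → z ∈ normals → PrimitiveVec z × Σ ℚ² λ v → Σ ℚ² λ w → IsEdge v w × IsNormal v w (emb z))
    (complete : ∀ {v w} → IsEdge v w → Σ ℤ² λ z → z ∈ normals × IsNormal v w (emb z)) where

    private
      V′ : List ℚ²
      V′ = map emb normals

      -- The edge whose cone contains -n has positive height there, so its normal is positive on n.
      normal-positive : ∀ n → n ≢ origin → Σ ℚ² λ p → p ∈ V′ × 0ℚ < dot p n
      normal-positive n n≢0 = choose (sector (neg² n) (neg²-nonzero n≢0))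
        where
        choose : (Σ ℚ² λ v → Σ ℚ² λ w → IsEdge v w × 0ℚ ≤ cross v (neg² n) × 0ℚ < cross (neg² n) w) → Σ ℚ² λ p →
            p ∈ V′ × 0ℚ < dot p n
        choose (v , w , e , vn , nw) = let z , z∈ , vz , wz = complete e in
          emb z , ∈-map⁺ emb z∈ , pos-cancel (ℚP.<⇒≤ (ed-pos e)) (subst (0ℚ <_)
            (trans (sym (dot-normal v w (neg² n))) (trans (opposite-height vz wz (neg² n)) (trans
                (cong (λ t → - (cross v w * t)) (trans (dot-comm (neg² n) (emb z)) (dot-neg² (emb z) n)))
              (solve 2 (λ d t → :- (d :* (:- t)) := d :* t) refl (cross v w) (dot (emb z) n))))) (pos+nonNeg nw vn))

      hull⊆dual : ∀ y → Conv V′ y → Dual P y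
      hull⊆dual y y∈ x x∈ = subst (- 1ℚ ≤_) (dot≡⟨⟩ y x) (neg-swap-≤ (subst (_≤ 1ℚ) (dot-neg² y x) (conv-below generators y∈)))
        where
        generators : ∀ {p} → p ∈ V′ → dot p (neg² x) ≤ 1ℚ
        generators {p} p∈ = bound (∈-map⁻ emb p∈)
          where
          bound : (Σ ℤ² λ z → z ∈ normals × p ≡ emb z) → dot p (neg² x) ≤ 1ℚ
          bound (z , z∈ , refl) = let _ , v , w , e , vz = sound z∈ in
            subst (_≤ 1ℚ) (sym (dot-neg² (emb z) x)) (neg-swap-≤
                (subst (- 1ℚ ≤_) (dot-comm x (emb z)) (normal-bound e vz (height≤ e x∈))))

    module _ {W′ : List ℚ²} (poly′ : Polygon W′) (W′⊆V′ : ∀ {x} → x ∈ W′ → x ∈ V′)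
      (below′ : ∀ {n c} → 0ℚ ≤ c → Below W′ n c → Below V′ n c) where
      private
        module R′ = RegionOf poly′ W′⊆V′ below′
        module F′ = Faces poly′

        -- Each edge of the hull of the normals comes from a point of P.
        dual⊆hull : ∀ y → Dual P y → F′.In 1ℚ y
        dual⊆hull y y∈ {a} {b} e′ = bound (reciprocal (F′.ed-pos e′))
          where
          N = normal a b
          D′ = cross a b
          bound : (Σ ℚ λ r → 0ℚ < r × D′ * r ≡ 1ℚ) → height a b y ≤ 1ℚ * D′
          bound (r , 0<r , D′r) = subst₂ _≤_ (trans (sym (ℚP.*-assoc D′ r (height a b y))) (trans
              (cong (_* height a b y) D′r) (ℚP.*-identityˡ (height a b y))))
            (trans (ℚP.*-identityʳ D′) (sym (ℚP.*-identityˡ D′)))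
            (ℚP.*-monoˡ-≤-nonNeg D′ {{nonNegative (ℚP.<⇒≤ (F′.ed-pos e′))}} (subst₂ _≤_
                (solve 1 (λ t → :- (:- t) := t) refl (r * height a b y))
              (solve 1 (λ t → :- (:- t) := t) refl 1ℚ) (ℚP.neg-antimono-≤ (subst (- 1ℚ ≤_) (dot-p y) (subst (- 1ℚ ≤_)
                  (sym (dot≡⟨⟩ y p)) (y∈ p p∈))))))
            where
            -- -N / D′, the pole of the line through a and b. It lies in P because every normal has
            -- height at most D′, and the dual inequality of y at p is the bound sought.
            p = neg² (r ⊙ N)
            dot-p : ∀ x → dot x p ≡ - (r * height a b x)
            dot-p x = trans (dot-neg² x (r ⊙ N)) (cong -_ (trans (dot-comm x (r ⊙ N)) (trans (dot-⊙ r N x)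
                (cong (r *_) (dot-comm N x)))))
            p∈ : P p
            p∈ = from (Conv⇔In p) inside
              where
              inside : In 1ℚ p
              inside {v} {w} e = let z , z∈ , vz , wz = complete e in
                subst₂ _≤_ (trans (solve 2 (λ d t → d :* t := :- (d :* (:- t))) refl (cross v w) (r * height a b (emb z)))
                    (trans (cong (λ t → - (cross v w * t)) (trans (sym (dot-p (emb z))) (dot-comm (emb z) p)))
                        (sym (opposite-height vz wz p))))
                  (ℚP.*-comm (cross v w) 1ℚ)
                  (ℚP.*-monoˡ-≤-nonNeg (cross v w) {{nonNegative (ℚP.<⇒≤ (ed-pos e))}} (subst (r * height a b (emb z) ≤_)
                      (trans (ℚP.*-comm r D′) D′r)
                    (ℚP.*-monoˡ-≤-nonNeg r {{nonNegative (ℚP.<⇒≤ 0<r)}} (R′.height≤ e′ (weighted-point (∈-map⁺ emb z∈))))))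

        Dual⇔In : ∀ y → Dual P y ⇔ F′.In 1ℚ y
        Dual⇔In y = mk⇔ (dual⊆hull y) (λ inside → hull⊆dual y (from (R′.Conv⇔In y) inside))

      Dual⇔hull : ∀ y → Dual P y ⇔ Conv V′ y
      Dual⇔hull y = mk⇔ (λ y∈ → from (R′.Conv⇔In y) (dual⊆hull y y∈)) (hull⊆dual y)

      -- The vertices of the hull are among its generators, the edge normals, which are primitive
      -- lattice vectors.
      dual-LDP : LDP (Dual P)
      dual-LDP = (normals , Dual⇔hull) , from (F′.interior {c =
          1ℚ} Dual⇔In origin) (F′.origin-In< (ℚP.positive⁻¹ 1ℚ)) , λ v vert →
          generator (∈-map⁻ emb (vertex-generator (vertex-cong Dual⇔hull vert)))
        where
        generator : ∀ {v} → (Σ ℤ² λ z → z ∈ normals × v ≡ emb z) → Σ ℤ² λ z → emb z ≡ v × PrimitiveVec z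
        generator (z , z∈ , refl) = z , refl , proj₁ (sound z∈)

    normals-LDP : LDP (Dual P)
    normals-LDP = let W′ , poly′ , W′⊆V′ , below′ = polygon V′ normal-positive in dual-LDP poly′ W′⊆V′ below′

  EdgeNormals : Set
  EdgeNormals = ∀ {v w} → IsEdge v w → Σ ℤ² λ z → PrimitiveVec z × dot v (embed z) ≡ - 1ℚ × dot w (embed z) ≡ - 1ℚ

  edge-normals⇒LDP : EdgeNormals → LDP (Dual P)
  edge-normals⇒LDP normal-of = let zs , sound , complete = collect (cyclicPairs W) (λ e → e) in normals-LDP zs sound complete
    where
    collect : ∀ L → (∀ {e} → e ∈ L → e ∈ cyclicPairs W) → Σ (List ℤ²) λ zs →
      (∀ {z} → z ∈ zs → PrimitiveVec z × Σ ℚ² λ v → Σ ℚ² λ w → IsEdge v w × IsNormal v w (emb z)) ×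
      (∀ {v w} → (v , w) ∈ L → Σ ℤ² λ z → z ∈ zs × IsNormal v w (emb z))
    collect [] _ = [] , (λ ()) , λ ()
    collect ((v , w) ∷ L) ⊆E =
      let z , prim , vz , wz = normal-of (⊆E (here refl))
          zs , sound , complete = collect L (⊆E ∘ there)
          is-normal = trans (cong (dot v) (sym (embed≡emb z))) vz , trans (cong (dot w) (sym (embed≡emb z))) wz in
      z ∷ zs , (λ { (here refl) → prim , v , w , ⊆E (here refl) , is-normal ; (there z∈) → sound z∈ }) ,
      λ { (here refl) → z , here refl , is-normal ; (there e) → let z′ , z′∈ , n = complete e in z′ , there z′∈ , n }

  -- The vertex of the dual that is polar to the edge is a primitive lattice vector with value -1 on
  -- it, hence the normal required.
  LDP⇒unit-distances : LDP (Dual P) → ∀ v w → Edge P v w → LatDistToEdge origin v w 1ℚ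
  LDP⇒unit-distances (_ , _ , vertices) v w edge = from-vertex (EdgeOf.dual-vertex edge)
    where
    from-vertex : (Σ ℚ² λ y → Vertex (Dual P) y × dot v y ≡ - 1ℚ × dot w y ≡ - 1ℚ) → LatDistToEdge origin v w 1ℚ
    from-vertex (y , vert , vy , wy) = from-lattice (vertices y vert)
      where
      from-lattice : (Σ ℤ² λ z → emb z ≡ y × PrimitiveVec z) → LatDistToEdge origin v w 1ℚ
      from-lattice (z , z≡y , prim) = z , - 1ℚ , prim , at v vy , at w wy ,
        cong (λ t → ∣ t - - 1ℚ ∣) {⟨ origin , emb z ⟩} {0ℚ} (trans (sym (dot≡⟨⟩ origin (emb z))) (dot-origin (emb z)))
        where
        at : ∀ x → dot x y ≡ - 1ℚ → ⟨ x , emb z ⟩ ≡ - 1ℚ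
        at x xy = trans (sym (dot≡⟨⟩ x (emb z))) (trans (cong (dot x) z≡y) xy)

-- The equivalences, with `TwoHeights` as the common link

module Equivalences {V W : List ℚ²} (poly : Polygon W) (W⊆V : ∀ {x} → x ∈ W → x ∈ V)
  (below : ∀ {n c} → 0ℚ ≤ c → Below W n c → Below V n c)
  (half-integral : ∀ {v} → v ∈ W → Σ ℤ² λ z → embed z ≡ ι2 ⊙ v) where
  open Geometry poly W⊆V below (lattice-edges poly half-integral)
  open Duality poly W⊆V below using (edge-normals⇒LDP; LDP⇒unit-distances)

  C1 C2 C3 C4 C5 : Set
  C1 = LDP (Dual P)
  C2 = ∀ v w → Edge P v w → LatDistToEdge origin v w 1ℚ
  C3 = (∀ k → Σ ℕ λ n → LatticeCount (Dil k P) n × LatticeCount (Int (Dil (suc k) P)) n) ×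
       (∀ v w → Edge P v w → AffHullHasLatticePt v w)
  C4 = Σ ℚ λ A → IsArea P A × (∀ t → EhrhartValue P (suc t) (quadratic A (ℕ→ℚ (suc t))))
  C5 = (∀ z → Int P (emb z) ⇔ (z ≡ (0ℤ , 0ℤ))) × PseudoIntegral P

  C1⇔C2 : C1 ⇔ C2
  C1⇔C2 = mk⇔ LDP⇒unit-distances (λ c2 → edge-normals⇒LDP (unit-normal c2))

  two⇒C3 : TwoHeights → C3
  two⇒C3 twoH = shell twoH , two⇒lattice-points twoH

  C3⇒two : C3 → TwoHeights
  C3⇒two (shells , points) = shells⇒two (lattice-points⇒even points) shells

  two⇒C4 : TwoHeights → C4
  two⇒C4 twoH = shoelace W , (W , ccw , refl) , ehrhart-two twoH {shoelace W} (area-two twoH)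

  C4⇒two : C4 → TwoHeights
  C4⇒two (A , _ , ehrhart) = quadratic⇒two A ehrhart

  two⇒C5 : TwoHeights → C5
  two⇒C5 twoH = (λ z → mk⇔ (λ z∈ → card-one (interior-origin twoH) z∈ origin∈) (λ { refl → origin∈ })) ,
    1ℚ ∷ A ∷ A ∷ [] , λ t → subst (EhrhartValue P (suc t)) (horner (ℕ→ℚ (suc t))) (ehrhart-two twoH {shoelace W}
        (area-two twoH) t)
    where
    A = shoelace W
    origin∈ : Int P (emb (0ℤ , 0ℤ))
    origin∈ = from (int (0ℤ , 0ℤ)) (λ {v} {w} e → subst (λ x → height v w x < ℕ→ℚ 1 * cross v w)
        (sym embed-origin) (origin-In< (ℕ→ℚ-pos 0) e))
    horner : ∀ x → quadratic A x ≡ evalPoly (1ℚ ∷ A ∷ A ∷ []) x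
    horner = horner-form A
      where
      horner-form : ∀ A x → quadratic A x ≡ evalPoly (1ℚ ∷ A ∷ A ∷ []) x
      horner-form = solve 2 (λ A x → A :* (x :* x) :+ (A :* x :+ con 1ℚ) := con 1ℚ :+ x :* (A :+ x :* (A :+ x :* con 0ℚ))) refl

  C5⇒two : C5 → TwoHeights
  C5⇒two (interior-only , pseudo) = pseudo-integral⇒two
    (card-cong (λ z → mk⇔ (from (interior-only z)) (to (interior-only z))) (card-singleton (0ℤ , 0ℤ))) pseudo

  equivalences : (C1 ⇔ C2) × (C2 ⇔ C3) × (C3 ⇔ C4) × (C4 ⇔ C5)
  equivalences = C1⇔C2 ,
    mk⇔ (two⇒C3 ∘ unit-distances⇒two) (two⇒unit-distances ∘ C3⇒two) ,
    mk⇔ (two⇒C4 ∘ C3⇒two) (two⇒C3 ∘ C4⇒two) ,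
    mk⇔ (two⇒C5 ∘ C4⇒two) (two⇒C4 ∘ C5⇒two)

theorem5p10 : (V : List ℚ²) → HalfIntegral (Conv V) → Int (Conv V) origin →
    let P = Conv V
        C1 = LDP (Dual P)
        C2 = ∀ v w → Edge P v w → LatDistToEdge origin v w 1ℚ
        C3 = (∀ k → Σ ℕ λ n → LatticeCount (Dil k P) n × LatticeCount (Int (Dil (suc k) P)) n) ×
             (∀ v w → Edge P v w → AffHullHasLatticePt v w)
        C4 = Σ ℚ λ A → IsArea P A ×
             (∀ t → EhrhartValue P (suc t) ((A * (ℕ→ℚ (suc t) * ℕ→ℚ (suc t))) + ((A * ℕ→ℚ (suc t)) + 1ℚ)))
        C5 = (∀ z → Int P (emb z) ⇔ (z ≡ (+ 0 , + 0))) × PseudoIntegral P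
    in (C1 ⇔ C2) × (C2 ⇔ C3) × (C3 ⇔ C4) × (C4 ⇔ C5)
theorem5p10 V half int₀ =
  let W , poly , W⊆V , below = polygon V (interior-positive int₀) in
  Equivalences.equivalences {V} {W} poly W⊆V below (λ v∈ → lattice-double (RegionOf.generator-vertex poly W⊆V below v∈))
  where
  lattice-double : ∀ {v} → Vertex (Conv V) v → Σ ℤ² λ z → embed z ≡ ι2 ⊙ v
  lattice-double {v} vert = let z , e = proj₁ half v vert in z , trans (embed≡emb z) (trans e (cong (_⊙ v) (sym (ι-ℕ 2))))
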